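{- For every integer $p\ge 1$, $$\begin{aligned} &\sum_{n=1}^\infty\frac{L_n^2(1)}{n^{p+1}}+\left((-1)^{p-1}-1\right)\sum_{n=1}^\infty\frac{H_nL_n(1)}{n^{p+1}}\\ &=\zeta^\star(p+1,\overline 2)-\ln 2\,\zeta^\star(p+1,\overline 1)+\zeta^\star(\overline{p+2},\overline 1)+\frac12\zeta(2)\zeta(p+1)\\ &\quad+\sum_{i=1}^{p+1}\zeta^\star(\overline i,\overline 1)\,\bar\zeta(p+2-i)+\left(p+1+(-1)^p\right)\zeta^\star(p+2,\overline 1)\\ &\quad+\frac12\ln^2 2\left\{2\zeta(p+1)+\bar\zeta(p+1)\right\}+\ln 2\,(-1)^{p-1}\left(\zeta^\star(p+1,1)-\zeta^\star(\overline{p+1},1)\right)\\ &\quad-\sum_{i=1}^{p-1}(-1)^{i-1}\bar\zeta(p+1-i)\,\zeta^\star(\overline{i+1},1)-\ln 2\left(\zeta^\star(p+1,1)-\zeta^\star(p+1,\overline 1)\right)\\ &\quad-\sum_{i=1}^{p-1}(-1)^{i-1}\bar\zeta(p+1-i)\,\bar\zeta(i+2)-\ln 2\,(-1)^{p-1}\left\{\zeta(p+2)+\bar\zeta(p+2)\right\}. \end{aligned}$$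
   Context: For integers $n,k\ge1$: $H_n=\sum_{j=1}^n \frac1j$, $L_n(k)=\sum_{j=1}^n \frac{(-1)^{j-1}}{j^k}$. $\zeta$ is the Riemann zeta function and $\bar\zeta(s)=\sum_{n=1}^\infty \frac{(-1)^{n-1}}{n^s}$ for $\Re(s)\ge 1$ (so $\bar\zeta(1)=\ln 2$). Multiple zeta-star values: for positive integers $s_1,\dots,s_k$, each possibly carrying a bar, $\zeta^\star(s_1,\dots,s_k)=\sum_{n_1\ge n_2\ge\cdots\ge n_k\ge1}\prod_{j=1}^k \frac{\varepsilon_j^{n_j}}{n_j^{s_j}}$, where $\varepsilon_j=-1$ if $s_j$ is barred and $\varepsilon_j=1$ otherwise; the series is read as the sum over $n_1$ of the finite inner sums (possibly only conditionally convergent when $s_1=\bar 1$). For instance $\zeta^\star(\bar q,p)=\sum_{m\ge1}\frac{(-1)^m}{m^q}\sum_{n=1}^m\frac1{n^p}$. Empty sums are zero. -}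

module Defs where

open import Data.Integer.Base as ℤ using (ℤ; +_; 1ℤ; -1ℤ)
open import Data.List.Base using (List; []; _∷_)
open import Data.Nat.Base as ℕ using (ℕ; zero; suc; NonZero; _∸_)
import Data.Integer.Properties as ℤ
import Data.Nat.Properties as ℕ
open import Data.Product.Base using (∃; _×_; _,_; proj₁; proj₂)
open import Data.Rational.Base as ℚ using (ℚ; 0ℚ; 1ℚ; ½)
import Data.Rational.Unnormalised.Base as ℚᵘ
import Data.Rational.Unnormalised.Properties as ℚᵘ
open import Data.Sum.Base using (inj₁; inj₂)
open import Data.Unit.Base using (⊤)
open import Relation.Binary.PropositionalEquality

-- f 1 + ⋯ + f N
sumℚ : ℕ → (∀ n → .{{NonZero n}} → ℚ) → ℚ
sumℚ zero    f = 0ℚ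
sumℚ (suc N) f = sumℚ N f ℚ.+ f (suc N)

syntax sumℚ N (λ n → e) = ∑[ n ≤ N ] e

infix 8 _/_^_

_/_^_ : ℤ → (n s : ℕ) → .{{NonZero n}} → ℚ
z / n ^ s = (z ℚ./ (n ℕ.^ s)) {{ℕ.m^n≢0 n s}}

H : ℕ → ℚ
H n = ∑[ j ≤ n ] (1ℤ ℚ./ j)

L : ℕ → ℕ → ℚ
L n k = ∑[ j ≤ n ] ((-1ℤ ℤ.^ (j ∸ 1)) / j ^ k)

n+j≢0 : ∀ n j → .{{NonZero j}} → NonZero (n ℕ.+ j)
n+j≢0 zero    (suc j) = _
n+j≢0 (suc n) j       = _

-- The n-th right Riemann sum of ∫₁² dx / x over equal subintervals, that is
-- ∑ⱼ (1/n) · 1/(1 + j/n).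
ln2-riemann : ℕ → ℚ
ln2-riemann n = ∑[ j ≤ n ] ((1ℤ ℚ./ (n ℕ.+ j)) {{n+j≢0 n j}})

-- `bar s` is the exponent s written with a bar.
data Exponent : Set where
  plain bar : (s : ℕ) → .{{NonZero s}} → Exponent

factor : Exponent → ∀ n → .{{NonZero n}} → ℚ
factor (plain s) n = 1ℤ / n ^ s
factor (bar s)   n = (-1ℤ ℤ.^ n) / n ^ s

-- The sum over N ≥ n₁ ≥ n₂ ≥ ⋯ ≥ n_k ≥ 1.
S⋆ : List Exponent → ℕ → ℚ
S⋆ []       N = 1ℚ
S⋆ (s ∷ ss) N = ∑[ n ≤ N ] (factor s n ℚ.* S⋆ ss n)

Cauchy : (ℕ → ℚ) → Set
Cauchy a = ∀ ε → 0ℚ ℚ.< ε →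
  ∃ λ N → ∀ m n → N ℕ.≤ m → N ℕ.≤ n → ℚ.∣ a m ℚ.- a n ∣ ℚ.< ε

Null : (ℕ → ℚ) → Set
Null a = ∀ ε → 0ℚ ℚ.< ε → ∃ λ N → ∀ n → N ℕ.≤ n → ℚ.∣ a n ∣ ℚ.< ε

Converges : (∀ n → .{{NonZero n}} → ℚ) → Set
Converges a = Cauchy (λ N → sumℚ N a)

-- Proofs that the sequences and series in use converge.  They are opaque, each in
-- a block of its own, because unfolding ℚ arithmetic makes type checking explode.
module CauchyProperties where

  open import Data.Rational.Base hiding (NonZero; _/_)
  open import Data.Rational.Properties
  open import Data.Rational.Solver using (module +-*-Solver)
  open +-*-Solver using (solve; con; _:=_; _:+_; _:*_; _:-_; :-_)
  open ≤-Reasoning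

  opaque
    ring₁ : ∀ a b → a + (b - a) ≡ b
    ring₁ = solve 2 (λ a b → a :+ (b :- a) := b) refl

  opaque
    ring₂ : ∀ a b → - (a - b) ≡ b - a
    ring₂ = solve 2 (λ a b → :- (a :- b) := b :- a) refl

  opaque
    ring₃ : ∀ c e i → c * (e * i) ≡ e * (c * i)
    ring₃ = solve 3 (λ c e i → c :* (e :* i) := e :* (c :* i)) refl

  opaque
    ring₄ : ∀ x y z w → (x + y) - (z + w) ≡ (x - z) + (y - w)
    ring₄ = solve 4 (λ x y z w → (x :+ y) :- (z :+ w) := (x :- z) :+ (y :- w)) refl

  opaque
    ring₅ : ∀ x y → - x - - y ≡ - (x - y)
    ring₅ = solve 2 (λ x y → :- x :- :- y := :- (x :- y)) refl

  opaque
    ring₆ : ∀ x y z w → x * y - z * w ≡ x * (y - w) + w * (x - z)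
    ring₆ = solve 4 (λ x y z w → x :* y :- z :* w := x :* (y :- w) :+ w :* (x :- z)) refl

  opaque
    ring₇ : ∀ x y z → x - z ≡ (x - y) + (y - z)
    ring₇ = solve 3 (λ x y z → x :- z := (x :- y) :+ (y :- z)) refl

  opaque
    ring₈ : ∀ x y z → (y - x) + (z - y) ≡ z - x
    ring₈ = solve 3 (λ x y z → (y :- x) :+ (z :- y) := z :- x) refl

  opaque
    ring₉ : ∀ s t x y → (((s + (- t) * y) + (s + (- t) * y)) - (- t) * y) - ((s + s) - t * x) ≡ (- t) * (y - x)
    ring₉ = solve 4 (λ s t x y → (((s :+ (:- t) :* y) :+ (s :+ (:- t) :* y)) :- (:- t) :* y) :- ((s :+ s) :- t :* x)
      := (:- t) :* (y :- x)) refl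

  opaque
    ring₁₀ : ∀ s t x → ½ * (((s + s) - t * x) + t * x) ≡ s
    ring₁₀ = solve 3 (λ s t x → con ½ :* (((s :+ s) :- t :* x) :+ t :* x) := s) refl

  opaque
    ring₁₁ : ∀ u a v → u * ((1ℚ + a) * v) ≡ (a * u) * v + u * v
    ring₁₁ = solve 3 (λ u a v → u :* ((con 1ℚ :+ a) :* v) := (a :* u) :* v :+ u :* v) refl

  opaque
    ring₁₂ : ∀ a b c → (a + b * c) + c ≡ a + (1ℚ + b) * c
    ring₁₂ = solve 3 (λ a b c → (a :+ b :* c) :+ c := a :+ (con 1ℚ :+ b) :* c) refl

  opaque
    ring₁₃ : ∀ a b c d → ((a + b * c) + 1ℚ) * d ≡ (a + 1ℚ) * d + (b * d) * c
    ring₁₃ = solve 4 (λ a b c d → ((a :+ b :* c) :+ con 1ℚ) :* d := (a :+ con 1ℚ) :* d :+ (b :* d) :* c) refl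

  opaque
    ring₁₄ : ∀ a b c → (a + c) * (b * (c + c)) ≡ (a + c) * (b * c + b * c)
    ring₁₄ = solve 3 (λ a b c → (a :+ c) :* (b :* (c :+ c)) := (a :+ c) :* (b :* c :+ b :* c)) refl

  opaque
    ring₁₅ : ∀ h v e → (h + v) * (e + e) ≡
      (((h + 1ℚ) * (v + e) + (h + 1ℚ) * (v + e)) - (((h + v) + 1ℚ) * v + ((h + v) + 1ℚ) * v))
      - ((e - (v + e) * v) + (e - (v + e) * v))
    ring₁₅ = solve 3 (λ h v e → (h :+ v) :* (e :+ e) :=
      (((h :+ con 1ℚ) :* (v :+ e) :+ (h :+ con 1ℚ) :* (v :+ e))
        :- (((h :+ v) :+ con 1ℚ) :* v :+ ((h :+ v) :+ con 1ℚ) :* v))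
      :- ((e :- (v :+ e) :* v) :+ (e :- (v :+ e) :* v))) refl

  opaque
    ring₁₆ : ∀ s a → (s + a) - s ≡ a
    ring₁₆ = solve 2 (λ s a → (s :+ a) :- s := a) refl

  opaque
    ring₁₇ : ∀ c x y → c * (x - y) ≡ c * x - c * y
    ring₁₇ = solve 3 (λ c x y → c :* (x :- y) := c :* x :- c :* y) refl

  opaque
    ring₁₈ : ∀ h b x → (h * b) * x ≡ b * (h * x)
    ring₁₈ = solve 3 (λ h b x → (h :* b) :* x := b :* (h :* x)) refl

  opaque
    ring₁₉ : ∀ e t f d → e * (t + f * 1ℚ) - d * t ≡ e * f - (d - e) * t
    ring₁₉ = solve 4 (λ e t f d → e :* (t :+ f :* con 1ℚ) :- d :* t := e :* f :- (d :- e) :* t) refl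

  opaque
    ring₂₀ : ∀ e v d h → e * v + (d - e) * h ≡ (d * h - e * (h + v)) + (e * v + e * v)
    ring₂₀ = solve 4 (λ e v d h → e :* v :+ (d :- e) :* h := (d :* h :- e :* (h :+ v)) :+ (e :* v :+ e :* v)) refl

  opaque
    ring₂₁ : ∀ x y u v → (x - y) + ((u - v) + (u - v)) ≡ (x + (u + u)) - (y + (v + v))
    ring₂₁ = solve 4 (λ x y u v → (x :- y) :+ ((u :- v) :+ (u :- v)) := (x :+ (u :+ u)) :- (y :+ (v :+ v))) refl

  opaque
    ring₂₂ : ∀ s a → s ≡ (s + a) - a
    ring₂₂ = solve 2 (λ s a → s := (s :+ a) :- a) refl

  opaque
    ring₂₃ : ∀ r a b → (((r + a) + b) - (b + b)) - r ≡ a - b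
    ring₂₃ = solve 3 (λ r a b → (((r :+ a) :+ b) :- (b :+ b)) :- r := a :- b) refl

  opaque
    ring₂₄ : ∀ a x b → x * ((a + a) * b) ≡ (a * x) * b + (a * x) * b
    ring₂₄ = solve 3 (λ a x b → x :* ((a :+ a) :* b) := (a :* x) :* b :+ (a :* x) :* b) refl

  opaque
    0≤-* : ∀ {a b} → 0ℚ ≤ a → 0ℚ ≤ b → 0ℚ ≤ a * b
    0≤-* {a} {b} p q = nonNegative⁻¹ (a * b)
      {{nonNeg*nonNeg⇒nonNeg a {{nonNegative p}} b {{nonNegative q}}}}

  opaque
    0≤-+ : ∀ {a b} → 0ℚ ≤ a → 0ℚ ≤ b → 0ℚ ≤ a + b
    0≤-+ p q = +-mono-≤ p q

  opaque
    *-monoˡ : ∀ {a b} c → 0ℚ ≤ c → a ≤ b → c * a ≤ c * b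
    *-monoˡ c 0≤c = *-monoˡ-≤-nonNeg c {{nonNegative 0≤c}}

  opaque
    *-monoʳ : ∀ {a b} c → 0ℚ ≤ c → a ≤ b → a * c ≤ b * c
    *-monoʳ c 0≤c = *-monoʳ-≤-nonNeg c {{nonNegative 0≤c}}

  opaque
    *-mono : ∀ {a b c d} → 0ℚ ≤ a → 0ℚ ≤ d → a ≤ b → c ≤ d → a * c ≤ b * d
    *-mono {a} {b} {c} {d} 0≤a 0≤d a≤b c≤d =
      ≤-trans (*-monoˡ a 0≤a c≤d) (*-monoʳ d 0≤d a≤b)

  opaque
    0≤⇒-≤ : ∀ {a b} → 0ℚ ≤ b - a → a ≤ b
    0≤⇒-≤ {a} {b} p = begin
      a            ≡⟨ +-identityʳ a ⟨
      a + 0ℚ       ≤⟨ +-monoʳ-≤ a p ⟩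
      a + (b - a)  ≡⟨ ring₁ a b ⟩
      b            ∎

  opaque
    -≤⇒0≤ : ∀ {a b} → a ≤ b → 0ℚ ≤ b - a
    -≤⇒0≤ {a} {b} p = begin
      0ℚ     ≡⟨ +-inverseʳ a ⟨
      a - a  ≤⟨ +-monoˡ-≤ (- a) p ⟩
      b - a  ∎

  opaque
    ∣-∣-swap : ∀ a b → ∣ a - b ∣ ≡ ∣ b - a ∣
    ∣-∣-swap a b = trans (sym (∣-p∣≡∣p∣ (a - b)))
      (cong ∣_∣ (ring₂ a b))

  opaque
    0<½ : 0ℚ < ½
    0<½ = positive⁻¹ ½

  half : ℚ → ℚ
  half ε = ½ * ε

  opaque
    half-pos : ∀ {ε} → 0ℚ < ε → 0ℚ < half ε
    half-pos {ε} p = positive⁻¹ (½ * ε) {{pos*pos⇒pos ½ ε {{positive p}}}}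

  opaque
    half+half : ∀ ε → half ε + half ε ≡ ε
    half+half = solve 1 (λ ε → con ½ :* ε :+ con ½ :* ε := ε) refl

  opaque
    shrink : ∀ C ε → 0ℚ < ε →
      ∃ λ δ → (0ℚ < δ) × (∀ x → 0ℚ ≤ x → x < δ → C * x < ε)
    shrink C ε 0<ε = δ , 0<δ , bound
      where
      c : ℚ
      c = 1ℚ + ∣ C ∣
      instance
        c-pos : Positive c
        c-pos = positive (<-≤-trans (positive⁻¹ 1ℚ)
          (≤-trans (≤-reflexive (sym (+-identityʳ 1ℚ))) (+-monoʳ-≤ 1ℚ (0≤∣p∣ C))))
        c≢0 : ℚ.NonZero c
        c≢0 = pos⇒nonZero c
        ε-pos : Positive ε
        ε-pos = positive 0<ε
        1/c-pos : Positive (1/ c)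
        1/c-pos = 1/pos⇒pos c
      δ : ℚ
      δ = ε * 1/ c
      0<δ : 0ℚ < δ
      0<δ = positive⁻¹ δ {{pos*pos⇒pos ε (1/ c)}}
      C≤c : C ≤ c
      C≤c = begin
        C          ≤⟨ C≤∣C∣ ⟩
        ∣ C ∣      ≡⟨ +-identityˡ ∣ C ∣ ⟨
        0ℚ + ∣ C ∣ ≤⟨ +-monoˡ-≤ ∣ C ∣ (<⇒≤ (positive⁻¹ 1ℚ)) ⟩
        c          ∎
        where
        C≤∣C∣ : C ≤ ∣ C ∣
        C≤∣C∣ with ≤-total 0ℚ C
        ... | inj₁ p = ≤-reflexive (sym (0≤p⇒∣p∣≡p p))
        ... | inj₂ p = ≤-trans p (0≤∣p∣ C)
      bound : ∀ x → 0ℚ ≤ x → x < δ → C * x < ε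
      bound x 0≤x x<δ = begin-strict
        C * x            ≤⟨ *-monoʳ x 0≤x C≤c ⟩
        c * x            <⟨ *-monoʳ-<-pos c x<δ ⟩
        c * (ε * 1/ c)   ≡⟨ ring₃ c ε (1/ c) ⟩
        ε * (c * 1/ c)   ≡⟨ cong (ε *_) (*-inverseʳ c) ⟩
        ε * 1ℚ           ≡⟨ *-identityʳ ε ⟩
        ε                ∎

  opaque
    null⇒cauchy : ∀ {a} → Null a → Cauchy a
    null⇒cauchy {a} nul ε 0<ε with nul (half ε) (half-pos 0<ε)
    ... | N , f = N , λ m n N≤m N≤n → begin-strict
      ∣ a m - a n ∣      ≤⟨ ∣p-q∣≤∣p∣+∣q∣ (a m) (a n) ⟩
      ∣ a m ∣ + ∣ a n ∣  <⟨ +-mono-< (f m N≤m) (f n N≤n) ⟩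
      half ε + half ε    ≡⟨ half+half ε ⟩
      ε                  ∎

  opaque
    null-squeeze : ∀ {a b} → (∀ n → ∣ a n ∣ ≤ b n) → Null b → Null a
    null-squeeze {a} {b} a≤b nul ε 0<ε with nul ε 0<ε
    ... | N , f = N , λ n N≤n → ≤-<-trans (a≤b n)
      (≤-<-trans (≤-reflexive (sym (0≤p⇒∣p∣≡p (≤-trans (0≤∣p∣ (a n)) (a≤b n))))) (f n N≤n))

  opaque
    null-scale : ∀ C {a} → 0ℚ ≤ C → Null a → Null (λ n → C * a n)
    null-scale C {a} 0≤C nul ε 0<ε with shrink C ε 0<ε
    ... | δ , 0<δ , g with nul δ 0<δ
    ... | N , f = N , λ n N≤n → ≤-<-trans
      (≤-reflexive (trans (∣p*q∣≡∣p∣*∣q∣ C (a n)) (cong (_* ∣ a n ∣) (0≤p⇒∣p∣≡p 0≤C))))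
      (g ∣ a n ∣ (0≤∣p∣ (a n)) (f n N≤n))

  opaque
    null-+ : ∀ {a b} → Null a → Null b → Null (λ n → a n + b n)
    null-+ {a} {b} p q ε 0<ε with p (half ε) (half-pos 0<ε) | q (half ε) (half-pos 0<ε)
    ... | M , f | N , g = M ℕ.⊔ N , λ n le → begin-strict
      ∣ a n + b n ∣      ≤⟨ ∣p+q∣≤∣p∣+∣q∣ (a n) (b n) ⟩
      ∣ a n ∣ + ∣ b n ∣  <⟨ +-mono-< (f n (ℕ.≤-trans (ℕ.m≤m⊔n M N) le))
                                     (g n (ℕ.≤-trans (ℕ.m≤n⊔m M N) le)) ⟩
      half ε + half ε    ≡⟨ half+half ε ⟩
      ε                  ∎

  opaque
    cauchy-const : ∀ q → Cauchy (λ _ → q)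
    cauchy-const q ε 0<ε = 0 , λ _ _ _ _ →
      ≤-<-trans (≤-reflexive (cong ∣_∣ (+-inverseʳ q))) 0<ε

  opaque
    cauchy-+ : ∀ {a b} → Cauchy a → Cauchy b → Cauchy (λ n → a n + b n)
    cauchy-+ {a} {b} p q ε 0<ε with p (half ε) (half-pos 0<ε) | q (half ε) (half-pos 0<ε)
    ... | M , f | N , g = M ℕ.⊔ N , λ m n M≤m N≤n → begin-strict
      ∣ (a m + b m) - (a n + b n) ∣
        ≡⟨ cong ∣_∣ (ring₄ (a m) (b m) (a n) (b n)) ⟩
      ∣ (a m - a n) + (b m - b n) ∣
        ≤⟨ ∣p+q∣≤∣p∣+∣q∣ (a m - a n) (b m - b n) ⟩
      ∣ a m - a n ∣ + ∣ b m - b n ∣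
        <⟨ +-mono-< (f m n (ℕ.≤-trans (ℕ.m≤m⊔n M N) M≤m) (ℕ.≤-trans (ℕ.m≤m⊔n M N) N≤n))
                    (g m n (ℕ.≤-trans (ℕ.m≤n⊔m M N) M≤m) (ℕ.≤-trans (ℕ.m≤n⊔m M N) N≤n)) ⟩
      half ε + half ε
        ≡⟨ half+half ε ⟩
      ε ∎

  opaque
    cauchy-neg : ∀ {a} → Cauchy a → Cauchy (λ n → - a n)
    cauchy-neg {a} p ε 0<ε with p ε 0<ε
    ... | N , f = N , λ m n N≤m N≤n → ≤-<-trans (≤-reflexive (trans
      (cong ∣_∣ (ring₅ (a m) (a n)))
      (∣-p∣≡∣p∣ (a m - a n)))) (f m n N≤m N≤n)

  opaque
    cauchy-cong : ∀ {a b} → (∀ n → a n ≡ b n) → Cauchy a → Cauchy b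
    cauchy-cong e p ε 0<ε with p ε 0<ε
    ... | N , f = N , λ m n N≤m N≤n →
      subst₂ (λ x y → ∣ x - y ∣ < ε) (e m) (e n) (f m n N≤m N≤n)

  opaque
    cauchy-unshift : ∀ {a} → Cauchy (λ n → a (suc n)) → Cauchy a
    cauchy-unshift p ε 0<ε with p ε 0<ε
    ... | N , f = suc N , λ { (suc m) (suc n) (ℕ.s≤s N≤m) (ℕ.s≤s N≤n) → f m n N≤m N≤n }

  opaque
    cauchy-bounded : ∀ {a} → Cauchy a → ∃ λ B → ∀ n → ∣ a n ∣ ≤ B
    cauchy-bounded {a} p with p 1ℚ (positive⁻¹ 1ℚ)
    ... | N , f = bnd N + 1ℚ , bound
      where
      bnd : ℕ → ℚ
      bnd zero    = ∣ a zero ∣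
      bnd (suc n) = bnd n + ∣ a (suc n) ∣
      0≤bnd : ∀ n → 0ℚ ≤ bnd n
      0≤bnd zero    = 0≤∣p∣ (a zero)
      0≤bnd (suc n) = 0≤-+ (0≤bnd n) (0≤∣p∣ (a (suc n)))
      last : ∀ n → ∣ a n ∣ ≤ bnd n
      last zero    = ≤-refl
      last (suc n) = ≤-trans (≤-reflexive (sym (+-identityˡ ∣ a (suc n) ∣)))
        (+-monoˡ-≤ ∣ a (suc n) ∣ (0≤bnd n))
      mono : ∀ {m n} → m ℕ.≤′ n → bnd m ≤ bnd n
      mono ℕ.≤′-refl = ≤-refl
      mono {n = suc n} (ℕ.≤′-step q) = ≤-trans (mono q)
        (≤-trans (≤-reflexive (sym (+-identityʳ (bnd n)))) (+-monoʳ-≤ (bnd n) (0≤∣p∣ (a (suc n)))))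
      bound : ∀ n → ∣ a n ∣ ≤ bnd N + 1ℚ
      bound n with ℕ.≤-total n N
      ... | inj₁ n≤N = begin
        ∣ a n ∣     ≤⟨ last n ⟩
        bnd n       ≤⟨ mono (ℕ.≤⇒≤′ n≤N) ⟩
        bnd N       ≡⟨ +-identityʳ (bnd N) ⟨
        bnd N + 0ℚ  ≤⟨ +-monoʳ-≤ (bnd N) (<⇒≤ (positive⁻¹ 1ℚ)) ⟩
        bnd N + 1ℚ  ∎
      ... | inj₂ N≤n = begin
        ∣ a n ∣                  ≡⟨ cong ∣_∣ (sym (ring₁ (a N) (a n))) ⟩
        ∣ a N + (a n - a N) ∣    ≤⟨ ∣p+q∣≤∣p∣+∣q∣ (a N) (a n - a N) ⟩
        ∣ a N ∣ + ∣ a n - a N ∣  ≤⟨ +-mono-≤ (last N) (<⇒≤ (f n N N≤n ℕ.≤-refl)) ⟩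
        bnd N + 1ℚ               ∎

  opaque
    cauchy-* : ∀ {a b} → Cauchy a → Cauchy b → Cauchy (λ n → a n * b n)
    cauchy-* {a} {b} p q ε 0<ε with cauchy-bounded {a} p | cauchy-bounded {b} q
    ... | A , a≤A | B , b≤B
      with shrink A (half ε) (half-pos 0<ε) | shrink B (half ε) (half-pos 0<ε)
    ... | δ , 0<δ , g | δ′ , 0<δ′ , g′ with q δ 0<δ | p δ′ 0<δ′
    ... | M , f | N , f′ = M ℕ.⊔ N , λ m n M≤m N≤n → begin-strict
      ∣ a m * b m - a n * b n ∣
        ≡⟨ cong ∣_∣ (ring₆ (a m) (b m) (a n) (b n)) ⟩
      ∣ a m * (b m - b n) + b n * (a m - a n) ∣
        ≤⟨ ∣p+q∣≤∣p∣+∣q∣ (a m * (b m - b n)) (b n * (a m - a n)) ⟩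
      ∣ a m * (b m - b n) ∣ + ∣ b n * (a m - a n) ∣
        ≡⟨ cong₂ _+_ (∣p*q∣≡∣p∣*∣q∣ (a m) (b m - b n)) (∣p*q∣≡∣p∣*∣q∣ (b n) (a m - a n)) ⟩
      ∣ a m ∣ * ∣ b m - b n ∣ + ∣ b n ∣ * ∣ a m - a n ∣
        ≤⟨ +-mono-≤ (*-monoʳ ∣ b m - b n ∣ (0≤∣p∣ (b m - b n)) (a≤A m))
                    (*-monoʳ ∣ a m - a n ∣ (0≤∣p∣ (a m - a n)) (b≤B n)) ⟩
      A * ∣ b m - b n ∣ + B * ∣ a m - a n ∣
        <⟨ +-mono-< (g ∣ b m - b n ∣ (0≤∣p∣ (b m - b n))
                       (f m n (ℕ.≤-trans (ℕ.m≤m⊔n M N) M≤m) (ℕ.≤-trans (ℕ.m≤m⊔n M N) N≤n)))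
                    (g′ ∣ a m - a n ∣ (0≤∣p∣ (a m - a n))
                       (f′ m n (ℕ.≤-trans (ℕ.m≤n⊔m M N) M≤m) (ℕ.≤-trans (ℕ.m≤n⊔m M N) N≤n))) ⟩
      half ε + half ε
        ≡⟨ half+half ε ⟩
      ε ∎

  opaque
    cauchy-telescope : ∀ {S b} → (∀ n → ∣ S (suc n) - S n ∣ ≤ b n - b (suc n)) →
                       Cauchy b → Cauchy S
    cauchy-telescope {S} {b} step cb ε 0<ε with cb ε 0<ε
    ... | N , f = N , bound
      where
      tele : ∀ {m n} → m ℕ.≤′ n → ∣ S n - S m ∣ ≤ b m - b n
      tele {m} ℕ.≤′-refl = ≤-reflexive (trans (cong ∣_∣ (+-inverseʳ (S m))) (sym (+-inverseʳ (b m))))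
      tele {m} {suc n} (ℕ.≤′-step q) = begin
        ∣ S (suc n) - S m ∣
          ≡⟨ cong ∣_∣ (ring₇ (S (suc n)) (S n) (S m)) ⟩
        ∣ (S (suc n) - S n) + (S n - S m) ∣
          ≤⟨ ∣p+q∣≤∣p∣+∣q∣ (S (suc n) - S n) (S n - S m) ⟩
        ∣ S (suc n) - S n ∣ + ∣ S n - S m ∣
          ≤⟨ +-mono-≤ (step n) (tele q) ⟩
        (b n - b (suc n)) + (b m - b n)
          ≡⟨ ring₈ (b (suc n)) (b n) (b m) ⟩
        b m - b (suc n) ∎
      ≤∣∣ : ∀ x → x ≤ ∣ x ∣
      ≤∣∣ x with ≤-total 0ℚ x
      ... | inj₁ p = ≤-reflexive (sym (0≤p⇒∣p∣≡p p))
      ... | inj₂ p = ≤-trans p (0≤∣p∣ x)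
      bound : ∀ m n → N ℕ.≤ m → N ℕ.≤ n → ∣ S m - S n ∣ < ε
      bound m n N≤m N≤n with ℕ.≤-total m n
      ... | inj₁ m≤n = begin-strict
        ∣ S m - S n ∣  ≡⟨ ∣-∣-swap (S m) (S n) ⟩
        ∣ S n - S m ∣  ≤⟨ tele (ℕ.≤⇒≤′ m≤n) ⟩
        b m - b n      ≤⟨ ≤∣∣ (b m - b n) ⟩
        ∣ b m - b n ∣  <⟨ f m n N≤m N≤n ⟩
        ε              ∎
      ... | inj₂ n≤m = begin-strict
        ∣ S m - S n ∣  ≤⟨ tele (ℕ.≤⇒≤′ n≤m) ⟩
        b n - b m      ≤⟨ ≤∣∣ (b n - b m) ⟩
        ∣ b n - b m ∣  <⟨ f n m N≤n N≤m ⟩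
        ε              ∎

  opaque
    cauchy-alternating : ∀ {S c b τ : ℕ → ℚ} →
      (∀ k → ∣ τ k ∣ ≡ 1ℚ) → (∀ k → τ (suc k) ≡ - τ k) →
      (∀ k → S (suc k) ≡ S k + τ k * c k) →
      Null c → (∀ k → ∣ c (suc k) - c k ∣ ≤ b k - b (suc k)) → Cauchy b →
      Cauchy S
    cauchy-alternating {S} {c} {b} {τ} ∣τ∣ τ-suc S-suc nul vary cb =
      cauchy-unshift {S} (cauchy-cong {λ k → ½ * (U k + τ k * c k)} eq
        (cauchy-* {λ _ → ½} {λ k → U k + τ k * c k} (cauchy-const ½)
          (cauchy-+ {U} {λ k → τ k * c k} U-cauchy (null⇒cauchy {λ k → τ k * c k} τc-null))))
      where
      U : ℕ → ℚ
      U k = (S (suc k) + S (suc k)) - τ k * c k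
      ∣τx∣ : ∀ k x → ∣ τ k * x ∣ ≡ ∣ x ∣
      ∣τx∣ k x = trans (∣p*q∣≡∣p∣*∣q∣ (τ k) x)
        (trans (cong (_* ∣ x ∣) (∣τ∣ k)) (*-identityˡ ∣ x ∣))
      τc-null : Null (λ k → τ k * c k)
      τc-null ε 0<ε with nul ε 0<ε
      ... | N , f = N , λ n N≤n → ≤-<-trans (≤-reflexive (∣τx∣ n (c n))) (f n N≤n)
      ΔU : ∀ k → U (suc k) - U k ≡ τ (suc k) * (c (suc k) - c k)
      ΔU k = trans
        (cong (λ x → ((x + x) - τ (suc k) * c (suc k)) - U k) (S-suc (suc k)))
        (trans
        (cong (λ t → (((S (suc k) + t * c (suc k)) + (S (suc k) + t * c (suc k))) - t * c (suc k)) - U k)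
              (τ-suc k))
        (trans
        (ring₉ (S (suc k)) (τ k) (c k) (c (suc k)))
        (cong (_* (c (suc k) - c k)) (sym (τ-suc k)))))
      U-cauchy : Cauchy U
      U-cauchy = cauchy-telescope {U} {b} (λ k → begin
        ∣ U (suc k) - U k ∣                  ≡⟨ cong ∣_∣ (ΔU k) ⟩
        ∣ τ (suc k) * (c (suc k) - c k) ∣    ≡⟨ ∣τx∣ (suc k) (c (suc k) - c k) ⟩
        ∣ c (suc k) - c k ∣                  ≤⟨ vary k ⟩
        b k - b (suc k)                      ∎) cb
      eq : ∀ k → ½ * (U k + τ k * c k) ≡ S (suc k)
      eq k = ring₁₀ (S (suc k)) (τ k) (c k)

  opaque
    /-* : ∀ z w m n → .{{_ : NonZero m}} → .{{_ : NonZero n}} → .{{_ : NonZero (m ℕ.* n)}} →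
          (z ℤ.* w) ℚ./ (m ℕ.* n) ≡ (z ℚ./ m) * (w ℚ./ n)
    /-* z w (suc m) (suc n) = toℚᵘ-injective (ℚᵘ.≃-trans
      (toℚᵘ-fromℚᵘ (ℚᵘ.mkℚᵘ z m ℚᵘ.* ℚᵘ.mkℚᵘ w n))
      (ℚᵘ.≃-trans
        (ℚᵘ.≃-sym (ℚᵘ.*-cong (toℚᵘ-fromℚᵘ (ℚᵘ.mkℚᵘ z m)) (toℚᵘ-fromℚᵘ (ℚᵘ.mkℚᵘ w n))))
        (ℚᵘ.≃-sym (toℚᵘ-homo-* (z ℚ./ suc m) (w ℚ./ suc n)))))

  u : ℕ → ℚ
  u k = 1ℤ ℚ./ suc k

  ι : ℕ → ℚ
  ι n = (+ n) ℚ./ 1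

  opaque
    ι-suc : ∀ n → ι (suc n) ≡ 1ℚ + ι n
    ι-suc n = toℚᵘ-injective (ℚᵘ.≃-trans
      (toℚᵘ-fromℚᵘ (ℚᵘ.mkℚᵘ (+ suc n) 0))
      (ℚᵘ.≃-trans (ℚᵘ.*≡* (eq n))
      (ℚᵘ.≃-trans
        (ℚᵘ.≃-sym (ℚᵘ.+-cong (toℚᵘ-fromℚᵘ (ℚᵘ.mkℚᵘ 1ℤ 0)) (toℚᵘ-fromℚᵘ (ℚᵘ.mkℚᵘ (+ n) 0))))
        (ℚᵘ.≃-sym (toℚᵘ-homo-+ 1ℚ (ι n))))))
      where
      eq : ∀ n → (+ suc n) ℤ.* 1ℤ ≡ (1ℤ ℤ.* 1ℤ ℤ.+ (+ n) ℤ.* 1ℤ) ℤ.* 1ℤ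
      eq n = cong (ℤ._* 1ℤ) (cong (λ z → 1ℤ ℤ.+ z) (sym (ℤ.*-identityʳ (+ n))))

  opaque
    ι*u : ∀ k → ι (suc k) * u k ≡ 1ℚ
    ι*u k = trans (sym (/-* (+ suc k) 1ℤ 1 (suc k)))
      (fromℚᵘ-cong {ℚᵘ.mkℚᵘ ((+ suc k) ℤ.* 1ℤ) (k ℕ.+ 0)} {ℚᵘ.mkℚᵘ 1ℤ 0} (ℚᵘ.*≡* eq))
      where
      eq : ((+ suc k) ℤ.* 1ℤ) ℤ.* 1ℤ ≡ 1ℤ ℤ.* (+ suc (k ℕ.+ 0))
      eq = trans (ℤ.*-identityʳ ((+ suc k) ℤ.* 1ℤ)) (trans (ℤ.*-identityʳ (+ suc k))
        (trans (cong (λ n → + suc n) (sym (ℕ.+-identityʳ k))) (sym (ℤ.*-identityˡ (+ suc (k ℕ.+ 0))))))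

  opaque
    0≤ι : ∀ n → 0ℚ ≤ ι n
    0≤ι n = nonNegative⁻¹ (ι n) {{normalize-nonNeg n 1}}

  opaque
    0<u : ∀ k → 0ℚ < u k
    0<u k = positive⁻¹ (u k) {{normalize-pos 1 (suc k)}}

  opaque
    0≤u : ∀ k → 0ℚ ≤ u k
    0≤u k = <⇒≤ (0<u k)

  opaque
    u≡u′+uu′ : ∀ k → u k ≡ u (suc k) + u k * u (suc k)
    u≡u′+uu′ k = begin-equality
      u k                                             ≡⟨ *-identityʳ (u k) ⟨
      u k * 1ℚ                                        ≡⟨ cong (u k *_) (ι*u (suc k)) ⟨
      u k * (ι (suc (suc k)) * u (suc k))             ≡⟨ cong (λ x → u k * (x * u (suc k))) (ι-suc (suc k)) ⟩
      u k * ((1ℚ + ι (suc k)) * u (suc k))            ≡⟨ ring₁₁ (u k) (ι (suc k)) (u (suc k)) ⟩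
      (ι (suc k) * u k) * u (suc k) + u k * u (suc k) ≡⟨ cong (λ x → x * u (suc k) + u k * u (suc k)) (ι*u k) ⟩
      1ℚ * u (suc k) + u k * u (suc k)                ≡⟨ cong (_+ u k * u (suc k)) (*-identityˡ (u (suc k))) ⟩
      u (suc k) + u k * u (suc k)                     ∎

  opaque
    ≤-+ : ∀ {a b} → 0ℚ ≤ b → a ≤ a + b
    ≤-+ {a} {b} 0≤b = ≤-trans (≤-reflexive (sym (+-identityʳ a))) (+-monoʳ-≤ a 0≤b)

  opaque
    u-suc : ∀ k → u (suc k) ≤ u k
    u-suc k = ≤-trans (≤-+ (0≤-* (0≤u k) (0≤u (suc k)))) (≤-reflexive (sym (u≡u′+uu′ k)))

  opaque
    u-mono : ∀ {m n} → m ℕ.≤′ n → u n ≤ u m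
    u-mono ℕ.≤′-refl = ≤-refl
    u-mono {n = suc n} (ℕ.≤′-step p) = ≤-trans (u-suc n) (u-mono p)

  opaque
    u≤1 : ∀ k → u k ≤ 1ℚ
    u≤1 k = u-mono (ℕ.≤⇒≤′ (ℕ.z≤n {k}))

  opaque
    u≤2u : ∀ k → u k ≤ u (suc k) + u (suc k)
    u≤2u k = begin
      u k                          ≡⟨ u≡u′+uu′ k ⟩
      u (suc k) + u k * u (suc k)  ≤⟨ +-monoʳ-≤ (u (suc k)) (*-monoʳ (u (suc k)) (0≤u (suc k)) (u≤1 k)) ⟩
      u (suc k) + 1ℚ * u (suc k)   ≡⟨ cong (λ x → u (suc k) + x) (*-identityˡ (u (suc k))) ⟩
      u (suc k) + u (suc k)        ∎

  opaque
    archimedean : ∀ ε → 0ℚ < ε → ∃ λ k → u k < ε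
    archimedean ε 0<ε = go ε (positive 0<ε)
      where
      go : ∀ ε → Positive ε → ∃ λ k → u k < ε
      go (mkℚ (ℤ.+[1+ n ]) d c) _ = suc d , toℚᵘ-cancel-<
        (ℚᵘ.<-respˡ-≃ (ℚᵘ.≃-sym (toℚᵘ-fromℚᵘ (ℚᵘ.mkℚᵘ 1ℤ (suc d))))
          (ℚᵘ.*<* (subst (ℤ._< ((+ suc n) ℤ.* (+ suc (suc d)))) (sym (ℤ.*-identityˡ (+ suc d)))
            (ℤ.+<+ (ℕ.≤-trans ℕ.≤-refl (ℕ.m≤m+n (suc (suc d)) (n ℕ.* suc (suc d))))))))

  opaque
    null-u : Null u
    null-u ε 0<ε with archimedean ε 0<ε
    ... | N , u<ε = N , λ n N≤n →
      ≤-<-trans (≤-reflexive (0≤p⇒∣p∣≡p (0≤u n))) (≤-<-trans (u-mono (ℕ.≤⇒≤′ N≤n)) u<ε)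

  -- h k is the harmonic number H (k + 1)
  h : ℕ → ℚ
  h k = H (suc k)

  opaque
    0≤H : ∀ n → 0ℚ ≤ H n
    0≤H zero    = ≤-refl
    0≤H (suc n) = 0≤-+ (0≤H n) (0≤u n)

  opaque
    1≤h : ∀ k → 1ℚ ≤ h k
    1≤h zero    = ≤-refl
    1≤h (suc k) = ≤-trans (1≤h k) (≤-+ (0≤u (suc k)))

  opaque
    H-bound : ∀ K n → H n ≤ ι (suc K) + ι n * u K
    H-bound K zero    = 0≤-+ (0≤ι (suc K)) (0≤-* (0≤ι zero) (0≤u K))
    H-bound K (suc n) with ℕ.≤-total n K
    ... | inj₁ n≤K = ≤-trans (≤-trans (H≤ι (suc n)) (ι-mono (ℕ.≤⇒≤′ (ℕ.s≤s n≤K))))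
                       (≤-+ (0≤-* (0≤ι (suc n)) (0≤u K)))
      where
      H≤ι : ∀ n → H n ≤ ι n
      H≤ι zero    = ≤-refl
      H≤ι (suc n) = begin
        H n + u n  ≤⟨ +-mono-≤ (H≤ι n) (u≤1 n) ⟩
        ι n + 1ℚ   ≡⟨ +-comm (ι n) 1ℚ ⟩
        1ℚ + ι n   ≡⟨ ι-suc n ⟨
        ι (suc n)  ∎
      ι-mono : ∀ {m n} → m ℕ.≤′ n → ι m ≤ ι n
      ι-mono ℕ.≤′-refl = ≤-refl
      ι-mono {n = suc n} (ℕ.≤′-step p) = begin
        _          ≤⟨ ι-mono p ⟩
        ι n        ≤⟨ ≤-+ (<⇒≤ (positive⁻¹ 1ℚ)) ⟩
        ι n + 1ℚ   ≡⟨ +-comm (ι n) 1ℚ ⟩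
        1ℚ + ι n   ≡⟨ ι-suc n ⟨
        ι (suc n)  ∎
    ... | inj₂ K≤n = begin
      H n + u n                       ≤⟨ +-mono-≤ (H-bound K n) (u-mono (ℕ.≤⇒≤′ K≤n)) ⟩
      (ι (suc K) + ι n * u K) + u K   ≡⟨ ring₁₂ (ι (suc K)) (ι n) (u K) ⟩
      ι (suc K) + (1ℚ + ι n) * u K    ≡⟨ cong (λ x → ι (suc K) + x * u K) (ι-suc n) ⟨
      ι (suc K) + ι (suc n) * u K     ∎

  g : ℕ → ℚ
  g k = (h k + 1ℚ) * u k

  opaque
    0≤g : ∀ k → 0ℚ ≤ g k
    0≤g k = 0≤-* (0≤-+ (0≤H (suc k)) (<⇒≤ (positive⁻¹ 1ℚ))) (0≤u k)

  opaque
    null-g : Null g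
    null-g ε 0<ε with archimedean (half ε) (half-pos 0<ε)
    ... | K , u<ε with null-scale (ι (suc K) + 1ℚ) {u}
                         (0≤-+ (0≤ι (suc K)) (<⇒≤ (positive⁻¹ 1ℚ))) null-u (half ε) (half-pos 0<ε)
    ... | N , f = N , λ n N≤n → begin-strict
      ∣ g n ∣
        ≡⟨ 0≤p⇒∣p∣≡p (0≤g n) ⟩
      (h n + 1ℚ) * u n
        ≤⟨ *-monoʳ (u n) (0≤u n) (+-monoˡ-≤ 1ℚ (H-bound K (suc n))) ⟩
      ((ι (suc K) + ι (suc n) * u K) + 1ℚ) * u n
        ≡⟨ ring₁₃ (ι (suc K)) (ι (suc n)) (u K) (u n) ⟩
      (ι (suc K) + 1ℚ) * u n + (ι (suc n) * u n) * u K
        ≡⟨ cong (λ x → (ι (suc K) + 1ℚ) * u n + x * u K) (ι*u n) ⟩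
      (ι (suc K) + 1ℚ) * u n + 1ℚ * u K
        ≡⟨ cong (λ x → (ι (suc K) + 1ℚ) * u n + x) (*-identityˡ (u K)) ⟩
      (ι (suc K) + 1ℚ) * u n + u K
        ≤⟨ +-monoˡ-≤ (u K) (≤-reflexive (sym (0≤p⇒∣p∣≡p
             (0≤-* (0≤-+ (0≤ι (suc K)) (<⇒≤ (positive⁻¹ 1ℚ))) (0≤u n))))) ⟩
      ∣ (ι (suc K) + 1ℚ) * u n ∣ + u K
        <⟨ +-mono-< (f n N≤n) u<ε ⟩
      half ε + half ε
        ≡⟨ half+half ε ⟩
      ε ∎

  opaque
    -- In fact g k - g (k + 1) = H (k + 2) / ((k + 1) (k + 2)).
    g-step : ∀ k → h k * (u k * u k) ≤ (g k + g k) - (g (suc k) + g (suc k))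
    g-step k = begin
      h k * (u k * u k)
        ≤⟨ *-monoˡ (h k) (0≤H (suc k)) (*-monoˡ (u k) (0≤u k) (u≤2u k)) ⟩
      h k * (u k * (u′ + u′))
        ≤⟨ *-monoʳ {h k} {h k + u′} (u k * (u′ + u′)) (0≤-* (0≤u k) (0≤-+ (0≤u (suc k)) (0≤u (suc k)))) (≤-+ (0≤u (suc k))) ⟩
      (h k + u′) * (u k * (u′ + u′))
        ≡⟨ ring₁₄ (h k) (u k) u′ ⟩
      (h k + u′) * (e + e)
        ≡⟨ ring₁₅ (h k) u′ e ⟩
      G (u′ + e) - ((e - (u′ + e) * u′) + (e - (u′ + e) * u′))
        ≡⟨ cong (λ x → G x - ((e - x * u′) + (e - x * u′))) (sym (u≡u′+uu′ k)) ⟩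
      G (u k) - ((e - e) + (e - e))
        ≡⟨ cong (λ x → G (u k) - (x + x)) (+-inverseʳ e) ⟩
      G (u k) - (0ℚ + 0ℚ)
        ≡⟨ +-identityʳ (G (u k)) ⟩
      (g k + g k) - (g (suc k) + g (suc k)) ∎
      where
      u′ : ℚ
      u′ = u (suc k)
      e : ℚ
      e = u k * u′
      G : ℚ → ℚ
      G x = ((h k + 1ℚ) * x + (h k + 1ℚ) * x) - (g (suc k) + g (suc k))

  d : ℕ → ℕ → ℚ
  d k s = 1ℤ / suc k ^ s

  σ : ℕ → ℚ
  σ n = (-1ℤ ℤ.^ n) ℚ./ 1

  opaque
    d-suc : ∀ k s → d k (suc s) ≡ u k * d k s
    d-suc k s = /-* 1ℤ 1ℤ (suc k) (suc k ℕ.^ s)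
      {{_}} {{ℕ.m^n≢0 (suc k) s}} {{ℕ.m^n≢0 (suc k) (suc s)}}

    /-^ : ∀ z k s → z / suc k ^ s ≡ (z ℚ./ 1) * d k s
    /-^ z k s = trans
      (/-cong {{ℕ.m^n≢0 (suc k) s}} {{ℕ.m*n≢0 1 (suc k ℕ.^ s) {{_}} {{ℕ.m^n≢0 (suc k) s}}}}
        (sym (ℤ.*-identityʳ z)) (sym (ℕ.*-identityˡ (suc k ℕ.^ s))))
      (/-* z 1ℤ 1 (suc k ℕ.^ s) {{_}} {{ℕ.m^n≢0 (suc k) s}}
        {{ℕ.m*n≢0 1 (suc k ℕ.^ s) {{_}} {{ℕ.m^n≢0 (suc k) s}}}})

    0≤d : ∀ k s → 0ℚ ≤ d k s
    0≤d k s = nonNegative⁻¹ (d k s)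
      {{normalize-nonNeg 1 (suc k ℕ.^ s) {{ℕ.m^n≢0 (suc k) s}}}}

    σ-suc : ∀ n → σ (suc n) ≡ - σ n
    σ-suc n = trans (/-* -1ℤ (-1ℤ ℤ.^ n) 1 1)
      (trans (sym (neg-distribˡ-* 1ℚ (σ n))) (cong -_ (*-identityˡ (σ n))))

    ∣σ∣ : ∀ n → ∣ σ n ∣ ≡ 1ℚ
    ∣σ∣ zero    = refl
    ∣σ∣ (suc n) = trans (cong ∣_∣ (σ-suc n)) (trans (∣-p∣≡∣p∣ (σ n)) (∣σ∣ n))

  opaque
    d≤1 : ∀ k s → d k s ≤ 1ℚ
    d≤1 k zero    = ≤-refl
    d≤1 k (suc s) = begin
      d k (suc s)  ≡⟨ d-suc k s ⟩
      u k * d k s  ≤⟨ *-mono (0≤u k) (<⇒≤ (positive⁻¹ 1ℚ)) (u≤1 k) (d≤1 k s) ⟩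
      1ℚ * 1ℚ      ≡⟨ *-identityˡ 1ℚ ⟩
      1ℚ           ∎

    d-mono : ∀ k s → d (suc k) s ≤ d k s
    d-mono k zero    = ≤-refl
    d-mono k (suc s) = begin
      d (suc k) (suc s)        ≡⟨ d-suc (suc k) s ⟩
      u (suc k) * d (suc k) s  ≤⟨ *-mono (0≤u (suc k)) (0≤d k s) (u-suc k) (d-mono k s) ⟩
      u k * d k s              ≡⟨ d-suc k s ⟨
      d k (suc s)              ∎

    d≤u : ∀ k s → .{{NonZero s}} → d k s ≤ u k
    d≤u k (suc s) = begin
      d k (suc s)  ≡⟨ d-suc k s ⟩
      u k * d k s  ≤⟨ *-monoˡ (u k) (0≤u k) (d≤1 k s) ⟩
      u k * 1ℚ     ≡⟨ *-identityʳ (u k) ⟩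
      u k          ∎

    d≤u² : ∀ k s → .{{NonZero (s ∸ 1)}} → d k s ≤ u k * u k
    d≤u² k (suc s) = begin
      d k (suc s)  ≡⟨ d-suc k s ⟩
      u k * d k s  ≤⟨ *-monoˡ (u k) (0≤u k) (d≤u k s) ⟩
      u k * u k    ∎

    ∣σd∣ : ∀ n k s → ∣ (-1ℤ ℤ.^ n) / suc k ^ s ∣ ≡ d k s
    ∣σd∣ n k s = begin-equality
      ∣ (-1ℤ ℤ.^ n) / suc k ^ s ∣  ≡⟨ cong ∣_∣ (/-^ (-1ℤ ℤ.^ n) k s) ⟩
      ∣ σ n * d k s ∣              ≡⟨ ∣p*q∣≡∣p∣*∣q∣ (σ n) (d k s) ⟩
      ∣ σ n ∣ * ∣ d k s ∣          ≡⟨ cong₂ _*_ (∣σ∣ n) (0≤p⇒∣p∣≡p (0≤d k s)) ⟩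
      1ℚ * d k s                   ≡⟨ *-identityˡ (d k s) ⟩
      d k s                        ∎

    ∣factor∣ : ∀ t k → ∣ factor t (suc k) ∣ ≤ u k
    ∣factor∣ (plain s) k = ≤-trans (≤-reflexive (0≤p⇒∣p∣≡p (0≤d k s))) (d≤u k s)
    ∣factor∣ (bar s)   k = ≤-trans (≤-reflexive (∣σd∣ (suc k) k s)) (d≤u k s)

    ∣S⋆∣ : ∀ t n → ∣ S⋆ (t ∷ []) n ∣ ≤ H n
    ∣S⋆∣ t zero    = ≤-refl
    ∣S⋆∣ t (suc n) = begin
      ∣ S⋆ (t ∷ []) n + factor t (suc n) * 1ℚ ∣
        ≡⟨ cong (λ x → ∣ S⋆ (t ∷ []) n + x ∣) (*-identityʳ (factor t (suc n))) ⟩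
      ∣ S⋆ (t ∷ []) n + factor t (suc n) ∣
        ≤⟨ ∣p+q∣≤∣p∣+∣q∣ (S⋆ (t ∷ []) n) (factor t (suc n)) ⟩
      ∣ S⋆ (t ∷ []) n ∣ + ∣ factor t (suc n) ∣
        ≤⟨ +-mono-≤ (∣S⋆∣ t n) (∣factor∣ t n) ⟩
      H n + u n ∎

  opaque
    cauchy-dominated : ∀ {S a : ℕ → ℚ} C → 0ℚ ≤ C → (∀ k → S (suc k) ≡ S k + a k) →
      (∀ k → ∣ a k ∣ ≤ C * (h k * (u k * u k))) → Cauchy S
    cauchy-dominated {S} {a} C 0≤C S-suc bound =
      cauchy-telescope {S} {λ k → C * (g k + g k)} step
        (null⇒cauchy {λ k → C * (g k + g k)}
          (null-scale C {λ k → g k + g k} 0≤C (null-+ {g} {g} null-g null-g)))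
      where
      step : ∀ k → ∣ S (suc k) - S k ∣ ≤ C * (g k + g k) - C * (g (suc k) + g (suc k))
      step k = begin
        ∣ S (suc k) - S k ∣      ≡⟨ cong (λ x → ∣ x - S k ∣) (S-suc k) ⟩
        ∣ (S k + a k) - S k ∣    ≡⟨ cong ∣_∣ (ring₁₆ (S k) (a k)) ⟩
        ∣ a k ∣                  ≤⟨ bound k ⟩
        C * (h k * (u k * u k))  ≤⟨ *-monoˡ C 0≤C (g-step k) ⟩
        C * ((g k + g k) - (g (suc k) + g (suc k)))
          ≡⟨ ring₁₇ C (g k + g k) (g (suc k) + g (suc k)) ⟩
        C * (g k + g k) - C * (g (suc k) + g (suc k)) ∎

  opaque
    0≤1 : 0ℚ ≤ 1ℚ
    0≤1 = <⇒≤ (positive⁻¹ 1ℚ)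

    *-≤h : ∀ {x} k → 0ℚ ≤ x → x ≤ h k * x
    *-≤h {x} k 0≤x = ≤-trans (≤-reflexive (sym (*-identityˡ x))) (*-monoʳ x 0≤x (1≤h k))

    ζ-converges : ∀ s → .{{NonZero (s ∸ 1)}} → Converges (λ n → 1ℤ / n ^ s)
    ζ-converges s = cauchy-dominated {λ N → ∑[ n ≤ N ] (1ℤ / n ^ s)} {λ k → d k s}
      1ℚ 0≤1 (λ _ → refl) λ k → begin
        ∣ d k s ∣                 ≡⟨ 0≤p⇒∣p∣≡p (0≤d k s) ⟩
        d k s                     ≤⟨ d≤u² k s ⟩
        u k * u k                 ≤⟨ *-≤h k (0≤-* (0≤u k) (0≤u k)) ⟩
        h k * (u k * u k)         ≡⟨ *-identityˡ (h k * (u k * u k)) ⟨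
        1ℚ * (h k * (u k * u k))  ∎

    ζ̄-converges : ∀ s → .{{NonZero s}} → Converges (λ n → (-1ℤ ℤ.^ (n ∸ 1)) / n ^ s)
    ζ̄-converges s = cauchy-alternating
      {λ N → ∑[ n ≤ N ] ((-1ℤ ℤ.^ (n ∸ 1)) / n ^ s)} {c} {c} {σ} ∣σ∣ σ-suc
      (λ k → cong (λ x → L k s + x) (/-^ (-1ℤ ℤ.^ k) k s))
      c-null vary (null⇒cauchy {c} c-null)
      where
      c : ℕ → ℚ
      c k = d k s
      c-null : Null c
      c-null = null-squeeze {c} {u}
        (λ k → ≤-trans (≤-reflexive (0≤p⇒∣p∣≡p (0≤d k s))) (d≤u k s)) null-u
      vary : ∀ k → ∣ c (suc k) - c k ∣ ≤ c k - c (suc k)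
      vary k = ≤-reflexive (trans (∣-∣-swap (c (suc k)) (c k))
        (0≤p⇒∣p∣≡p (-≤⇒0≤ (d-mono k s))))

    L-bounded : ∃ λ B → (0ℚ ≤ B) × (∀ n → ∣ L n 1 ∣ ≤ B)
    L-bounded with cauchy-bounded {λ n → L n 1} (ζ̄-converges 1)
    ... | B , f = B , ≤-trans (0≤∣p∣ (L 0 1)) (f 0) , f

    ∣xd∣ : ∀ {C} x k s → .{{NonZero (s ∸ 1)}} → ∣ x ∣ ≤ C → ∣ x * d k s ∣ ≤ C * (u k * u k)
    ∣xd∣ {C} x k s x≤C = begin
      ∣ x * d k s ∣      ≡⟨ ∣p*q∣≡∣p∣*∣q∣ x (d k s) ⟩
      ∣ x ∣ * ∣ d k s ∣  ≡⟨ cong (∣ x ∣ *_) (0≤p⇒∣p∣≡p (0≤d k s)) ⟩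
      ∣ x ∣ * d k s      ≤⟨ *-mono (0≤∣p∣ x) (0≤-* (0≤u k) (0≤u k)) x≤C (d≤u² k s) ⟩
      C * (u k * u k)    ∎

    L²-converges : ∀ s → .{{NonZero (s ∸ 1)}} →
                   Converges (λ n → (L n 1 * L n 1) * (1ℤ / n ^ s))
    L²-converges s = go L-bounded
      where
      go : ∃ (λ B → (0ℚ ≤ B) × (∀ n → ∣ L n 1 ∣ ≤ B)) →
           Converges (λ n → (L n 1 * L n 1) * (1ℤ / n ^ s))
      go (B , 0≤B , L≤B) = cauchy-dominated
        {λ N → ∑[ n ≤ N ] ((L n 1 * L n 1) * (1ℤ / n ^ s))}
        {λ k → (L (suc k) 1 * L (suc k) 1) * d k s}
        (B * B) (0≤-* 0≤B 0≤B) (λ _ → refl) λ k → begin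
          ∣ (L (suc k) 1 * L (suc k) 1) * d k s ∣
            ≤⟨ ∣xd∣ (L (suc k) 1 * L (suc k) 1) k s
                 (≤-trans (≤-reflexive (∣p*q∣≡∣p∣*∣q∣ (L (suc k) 1) (L (suc k) 1)))
                   (*-mono (0≤∣p∣ (L (suc k) 1)) 0≤B (L≤B (suc k)) (L≤B (suc k)))) ⟩
          (B * B) * (u k * u k)
            ≤⟨ *-monoˡ (B * B) (0≤-* 0≤B 0≤B) (*-≤h k (0≤-* (0≤u k) (0≤u k))) ⟩
          (B * B) * (h k * (u k * u k)) ∎

    HL-converges : ∀ s → .{{NonZero (s ∸ 1)}} →
                   Converges (λ n → (H n * L n 1) * (1ℤ / n ^ s))
    HL-converges s = go L-bounded
      where
      go : ∃ (λ B → (0ℚ ≤ B) × (∀ n → ∣ L n 1 ∣ ≤ B)) →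
           Converges (λ n → (H n * L n 1) * (1ℤ / n ^ s))
      go (B , 0≤B , L≤B) = cauchy-dominated
        {λ N → ∑[ n ≤ N ] ((H n * L n 1) * (1ℤ / n ^ s))}
        {λ k → (H (suc k) * L (suc k) 1) * d k s}
        B 0≤B (λ _ → refl) λ k → begin
          ∣ (H (suc k) * L (suc k) 1) * d k s ∣
            ≤⟨ ∣xd∣ (H (suc k) * L (suc k) 1) k s
                 (≤-trans (≤-reflexive (∣p*q∣≡∣p∣*∣q∣ (H (suc k)) (L (suc k) 1)))
                   (*-mono (0≤∣p∣ (H (suc k))) 0≤B
                     (≤-reflexive (0≤p⇒∣p∣≡p (0≤H (suc k)))) (L≤B (suc k)))) ⟩
          (h k * B) * (u k * u k)
            ≡⟨ ring₁₈ (h k) B (u k * u k) ⟩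
          B * (h k * (u k * u k)) ∎

    ζ⋆-plain : ∀ s t → .{{_ : NonZero s}} → .{{_ : NonZero (s ∸ 1)}} →
               Cauchy (S⋆ (plain s ∷ t ∷ []))
    ζ⋆-plain s t = cauchy-dominated {S⋆ (plain s ∷ t ∷ [])}
      {λ k → d k s * S⋆ (t ∷ []) (suc k)} 1ℚ 0≤1 (λ _ → refl) λ k → begin
        ∣ d k s * S⋆ (t ∷ []) (suc k) ∣
          ≡⟨ cong ∣_∣ (*-comm (d k s) (S⋆ (t ∷ []) (suc k))) ⟩
        ∣ S⋆ (t ∷ []) (suc k) * d k s ∣
          ≤⟨ ∣xd∣ (S⋆ (t ∷ []) (suc k)) k s (∣S⋆∣ t (suc k)) ⟩
        h k * (u k * u k)
          ≡⟨ *-identityˡ (h k * (u k * u k)) ⟨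
        1ℚ * (h k * (u k * u k)) ∎

    ζ⋆-bar : ∀ s t → .{{_ : NonZero s}} → Cauchy (S⋆ (bar s ∷ t ∷ []))
    ζ⋆-bar s t = cauchy-alternating {S⋆ (bar s ∷ t ∷ [])} {c} {b} {λ k → σ (suc k)}
      (λ k → ∣σ∣ (suc k)) (λ k → σ-suc (suc k))
      (λ k → cong (λ x → S⋆ (bar s ∷ t ∷ []) k + x)
        (trans (cong (_* T (suc k)) (/-^ (-1ℤ ℤ.^ suc k) k s))
               (*-assoc (σ (suc k)) (d k s) (T (suc k)))))
      (null-squeeze {c} {g} c≤g null-g) vary
      (null⇒cauchy {b} (null-+ {λ k → d k s * h k} {λ k → u k + u k}
        (null-squeeze {λ k → d k s * h k} {g}
          (λ k → ≤-trans (≤-reflexive (0≤p⇒∣p∣≡p (0≤-* (0≤d k s) (0≤H (suc k))))) (dh≤g k)) null-g)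
        (null-+ {u} {u} null-u null-u)))
      where
      T : ℕ → ℚ
      T = S⋆ (t ∷ [])
      c b : ℕ → ℚ
      c k = d k s * T (suc k)
      b k = d k s * h k + (u k + u k)
      dh≤g : ∀ k → d k s * h k ≤ g k
      dh≤g k = begin
        d k s * h k       ≤⟨ *-monoʳ (h k) (0≤H (suc k)) (d≤u k s) ⟩
        u k * h k         ≡⟨ *-comm (u k) (h k) ⟩
        h k * u k         ≤⟨ *-monoʳ {h k} {h k + 1ℚ} (u k) (0≤u k) (≤-+ 0≤1) ⟩
        (h k + 1ℚ) * u k  ∎
      c≤g : ∀ k → ∣ c k ∣ ≤ g k
      c≤g k = begin
        ∣ d k s * T (suc k) ∣      ≡⟨ ∣p*q∣≡∣p∣*∣q∣ (d k s) (T (suc k)) ⟩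
        ∣ d k s ∣ * ∣ T (suc k) ∣  ≡⟨ cong (_* ∣ T (suc k) ∣) (0≤p⇒∣p∣≡p (0≤d k s)) ⟩
        d k s * ∣ T (suc k) ∣      ≤⟨ *-monoˡ (d k s) (0≤d k s) (∣S⋆∣ t (suc k)) ⟩
        d k s * h k                ≤⟨ dh≤g k ⟩
        g k                        ∎
      vary : ∀ k → ∣ c (suc k) - c k ∣ ≤ b k - b (suc k)
      vary k = begin
        ∣ d′ * (T (suc k) + f * 1ℚ) - d k s * T (suc k) ∣
          ≡⟨ cong ∣_∣ (ring₁₉ d′ (T (suc k)) f (d k s)) ⟩
        ∣ d′ * f - (d k s - d′) * T (suc k) ∣
          ≤⟨ ∣p-q∣≤∣p∣+∣q∣ (d′ * f) ((d k s - d′) * T (suc k)) ⟩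
        ∣ d′ * f ∣ + ∣ (d k s - d′) * T (suc k) ∣
          ≡⟨ cong₂ _+_ (∣p*q∣≡∣p∣*∣q∣ d′ f) (∣p*q∣≡∣p∣*∣q∣ (d k s - d′) (T (suc k))) ⟩
        ∣ d′ ∣ * ∣ f ∣ + ∣ d k s - d′ ∣ * ∣ T (suc k) ∣
          ≡⟨ cong₂ (λ x y → x * ∣ f ∣ + y * ∣ T (suc k) ∣)
               (0≤p⇒∣p∣≡p (0≤d (suc k) s)) (0≤p⇒∣p∣≡p 0≤d-d′) ⟩
        d′ * ∣ f ∣ + (d k s - d′) * ∣ T (suc k) ∣
          ≤⟨ +-mono-≤ (*-monoˡ d′ (0≤d (suc k) s) (∣factor∣ t (suc k)))
                      (*-monoˡ (d k s - d′) 0≤d-d′ (∣S⋆∣ t (suc k))) ⟩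
        d′ * u′ + (d k s - d′) * h k
          ≡⟨ ring₂₀ d′ u′ (d k s) (h k) ⟩
        (d k s * h k - d′ * (h k + u′)) + (d′ * u′ + d′ * u′)
          ≤⟨ +-monoʳ-≤ (d k s * h k - d′ * (h k + u′)) (+-mono-≤ d′u′≤ d′u′≤) ⟩
        (d k s * h k - d′ * (h k + u′)) + ((u k - u′) + (u k - u′))
          ≡⟨ ring₂₁ (d k s * h k) (d′ * (h k + u′)) (u k) u′ ⟩
        b k - b (suc k) ∎
        where
        d′ u′ f : ℚ
        d′ = d (suc k) s
        u′ = u (suc k)
        f = factor t (suc (suc k))
        0≤d-d′ : 0ℚ ≤ d k s - d′
        0≤d-d′ = -≤⇒0≤ (d-mono k s)
        d′u′≤ : d′ * u′ ≤ u k - u′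
        d′u′≤ = begin
          d′ * u′                 ≤⟨ *-monoʳ u′ (0≤u (suc k)) (≤-trans (d≤u (suc k) s) (u-suc k)) ⟩
          u k * u′                ≡⟨ ring₁₆ u′ (u k * u′) ⟨
          (u′ + u k * u′) - u′    ≡⟨ cong (_- u′) (u≡u′+uu′ k) ⟨
          u k - u′                ∎

  opaque
    ι-double : ∀ n → ι (n ℕ.+ n) ≡ ι n + ι n
    ι-double n = go n n
      where
      go : ∀ m n → ι (m ℕ.+ n) ≡ ι m + ι n
      go zero    n = sym (+-identityˡ (ι n))
      go (suc m) n = begin-equality
        ι (suc (m ℕ.+ n))  ≡⟨ ι-suc (m ℕ.+ n) ⟩
        1ℚ + ι (m ℕ.+ n)   ≡⟨ cong (λ x → 1ℚ + x) (go m n) ⟩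
        1ℚ + (ι m + ι n)   ≡⟨ +-assoc 1ℚ (ι m) (ι n) ⟨
        (1ℚ + ι m) + ι n   ≡⟨ cong (_+ ι n) (ι-suc m) ⟨
        ι (suc m) + ι n    ∎

    u-double : ∀ n → u n ≡ u (suc (n ℕ.+ n)) + u (suc (n ℕ.+ n))
    u-double n = begin-equality
      u n                          ≡⟨ *-identityʳ (u n) ⟨
      u n * 1ℚ                     ≡⟨ cong (u n *_) (ι*u (suc (n ℕ.+ n))) ⟨
      u n * (ι (2 ℕ.+ (n ℕ.+ n)) * b)
        ≡⟨ cong (λ m → u n * (ι m * b)) (cong suc (sym (ℕ.+-suc n n))) ⟩
      u n * (ι (suc n ℕ.+ suc n) * b)
        ≡⟨ cong (λ x → u n * (x * b)) (ι-double (suc n)) ⟩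
      u n * ((ι (suc n) + ι (suc n)) * b)
        ≡⟨ ring₂₄ (ι (suc n)) (u n) b ⟩
      (ι (suc n) * u n) * b + (ι (suc n) * u n) * b
        ≡⟨ cong (λ x → x * b + x * b) (ι*u n) ⟩
      1ℚ * b + 1ℚ * b              ≡⟨ cong (λ x → x + x) (*-identityˡ b) ⟩
      b + b                        ∎
      where
      b : ℚ
      b = u (suc (n ℕ.+ n))

  P : ℕ → ℕ → ℚ
  P n m = ∑[ j ≤ m ] ((1ℤ ℚ./ (n ℕ.+ j)) {{n+j≢0 n j}})

  opaque
    1/-cong : ∀ {m n} → .{{_ : NonZero m}} → .{{_ : NonZero n}} → m ≡ n → 1ℤ ℚ./ m ≡ 1ℤ ℚ./ n
    1/-cong {m} {n} e = /-cong {1ℤ} {m} {1ℤ} {n} refl e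

    P-shift : ∀ n m → P (suc n) m + u n ≡ P n (suc m)
    P-shift n zero    = cong (λ x → 0ℚ + x) (1/-cong {suc n} {n ℕ.+ 1} {{_}} {{n+j≢0 n 1}} (ℕ.+-comm 1 n))
    P-shift n (suc m) = begin-equality
      (P (suc n) m + x) + u n  ≡⟨ +-assoc (P (suc n) m) x (u n) ⟩
      P (suc n) m + (x + u n)  ≡⟨ cong (λ y → P (suc n) m + y) (+-comm x (u n)) ⟩
      P (suc n) m + (u n + x)  ≡⟨ +-assoc (P (suc n) m) (u n) x ⟨
      (P (suc n) m + u n) + x  ≡⟨ cong₂ _+_ (P-shift n m)
                                    (1/-cong {suc n ℕ.+ suc m} {n ℕ.+ suc (suc m)} {{_}} {{n+j≢0 n (suc (suc m))}}
                                      (sym (ℕ.+-suc n (suc m)))) ⟩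
      P n (suc (suc m))        ∎
      where
      x : ℚ
      x = 1ℤ ℚ./ (suc n ℕ.+ suc m)

    P-step : ∀ n → P (suc n) (suc n) - P n n ≡ u (n ℕ.+ n) - u (suc (n ℕ.+ n))
    P-step n = begin-equality
      P (suc n) (suc n) - P n n
        ≡⟨ cong (_- P n n) (ring₂₂ (P (suc n) (suc n)) (u n)) ⟩
      ((P (suc n) (suc n) + u n) - u n) - P n n
        ≡⟨ cong (λ x → (x - u n) - P n n) (P-shift n (suc n)) ⟩
      (P n (suc (suc n)) - u n) - P n n
        ≡⟨ cong₂ (λ x y → (((P n n + x) + y) - u n) - P n n)
             (1/-cong {n ℕ.+ suc n} {suc (n ℕ.+ n)} {{n+j≢0 n (suc n)}} (ℕ.+-suc n n))
             (1/-cong {n ℕ.+ suc (suc n)} {suc (suc (n ℕ.+ n))} {{n+j≢0 n (suc (suc n))}}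
               (trans (ℕ.+-suc n (suc n)) (cong suc (ℕ.+-suc n n)))) ⟩
      (((P n n + a) + b) - u n) - P n n
        ≡⟨ cong (λ x → (((P n n + a) + b) - x) - P n n) (u-double n) ⟩
      (((P n n + a) + b) - (b + b)) - P n n
        ≡⟨ ring₂₃ (P n n) a b ⟩
      a - b ∎
      where
      a b : ℚ
      a = u (n ℕ.+ n)
      b = u (suc (n ℕ.+ n))

    ln2-converges : Cauchy ln2-riemann
    ln2-converges = cauchy-telescope {ln2-riemann} {u} step (null⇒cauchy {u} null-u)
      where
      u-diff : ∀ k → u k - u (suc k) ≡ u k * u (suc k)
      u-diff k = trans (cong (_- u (suc k)) (u≡u′+uu′ k)) (ring₁₆ (u (suc k)) (u k * u (suc k)))
      step : ∀ n → ∣ ln2-riemann (suc n) - ln2-riemann n ∣ ≤ u n - u (suc n)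
      step n = begin
        ∣ ln2-riemann (suc n) - ln2-riemann n ∣    ≡⟨ cong ∣_∣ (P-step n) ⟩
        ∣ u (n ℕ.+ n) - u (suc (n ℕ.+ n)) ∣        ≡⟨ 0≤p⇒∣p∣≡p (-≤⇒0≤ (u-suc (n ℕ.+ n))) ⟩
        u (n ℕ.+ n) - u (suc (n ℕ.+ n))            ≡⟨ u-diff (n ℕ.+ n) ⟩
        u (n ℕ.+ n) * u (suc (n ℕ.+ n))
          ≤⟨ *-mono (0≤u (n ℕ.+ n)) (0≤u (suc n)) (u-mono (ℕ.≤⇒≤′ (ℕ.m≤m+n n n)))
               (u-mono (ℕ.≤⇒≤′ (ℕ.s≤s (ℕ.m≤m+n n n)))) ⟩
        u n * u (suc n)                            ≡⟨ u-diff n ⟨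
        u n - u (suc n)                            ∎

-- Cauchy completion of ℚ: a real number is presented by a Cauchy sequence of
-- rationals, and two presentations are equal when their difference tends to 0.

infix 4 _≈_
infixl 6 _+_ _-_
infixl 7 _*_
infix 9 [-1]^_

record ℝ : Set where
  constructor mkℝ
  field
    seq    : ℕ → ℚ
    cauchy : Cauchy seq

open ℝ public

_≈_ : ℝ → ℝ → Set
x ≈ y = Null (λ n → seq x n ℚ.- seq y n)

ι : ℚ → ℝ
ι q = mkℝ (λ _ → q) (CauchyProperties.cauchy-const q)

_+_ : ℝ → ℝ → ℝ
x + y = mkℝ (λ n → seq x n ℚ.+ seq y n)
            (CauchyProperties.cauchy-+ {seq x} {seq y} (cauchy x) (cauchy y))

_-_ : ℝ → ℝ → ℝ
x - y = mkℝ (λ n → seq x n ℚ.- seq y n)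
            (CauchyProperties.cauchy-+ {seq x} {λ n → ℚ.- seq y n} (cauchy x)
              (CauchyProperties.cauchy-neg {seq y} (cauchy y)))

_*_ : ℝ → ℝ → ℝ
x * y = mkℝ (λ n → seq x n ℚ.* seq y n)
            (CauchyProperties.cauchy-* {seq x} {seq y} (cauchy x) (cauchy y))

[-1]^_ : ℕ → ℝ
[-1]^ n = ι ((-1ℤ ℤ.^ n) ℚ./ 1)

fromℕ : ℕ → ℝ
fromℕ n = ι ((+ n) ℚ./ 1)

sumℝ : ℕ → (∀ i → .{{NonZero i}} → ℝ) → ℝ
sumℝ zero    f = ι 0ℚ
sumℝ (suc N) f = sumℝ N f + f (suc N)

syntax sumℝ N (λ i → e) = ∑ℝ[ i ≤ N ] e

-- The sum of a convergent series of rationals: the class of its partial sums.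
∑∞ : (a : ∀ n → .{{NonZero n}} → ℚ) → Converges a → ℝ
∑∞ a c = mkℝ (λ N → ∑[ n ≤ N ] a n) c

ln2 : ℝ
ln2 = mkℝ ln2-riemann CauchyProperties.ln2-converges

-- NonZero (s ∸ 1) says s ≥ 2.
ζ : (s : ℕ) → .{{NonZero (s ∸ 1)}} → ℝ
ζ s = ∑∞ (λ n → 1ℤ / n ^ s) (CauchyProperties.ζ-converges s)

ζ̄ : (s : ℕ) → .{{NonZero s}} → ℝ
ζ̄ s = ∑∞ (λ n → (-1ℤ ℤ.^ (n ∸ 1)) / n ^ s) (CauchyProperties.ζ̄-converges s)

-- An unbarred 1 may not come first; ζ⋆(1̄, t) converges conditionally.
Admissible : Exponent → Set
Admissible (plain s) = NonZero (s ∸ 1)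
Admissible (bar s)   = ⊤

ζ⋆-converges : ∀ s t → .{{Admissible s}} → Cauchy (S⋆ (s ∷ t ∷ []))
ζ⋆-converges (plain s) t = CauchyProperties.ζ⋆-plain s t
ζ⋆-converges (bar s)   t = CauchyProperties.ζ⋆-bar s t

-- The class of the partial sums over n₁ of the finite inner sums.
ζ⋆ : (s t : Exponent) → .{{Admissible s}} → ℝ
ζ⋆ s t = mkℝ (S⋆ (s ∷ t ∷ [])) (ζ⋆-converges s t)

module Submission where

-- Truncate every series at N and put s = p + 1.  The geometric sum
-- ∑ᵢ n⁻ⁱ m^(i−s−1) = (n⁻ˢ − m⁻ˢ) / (m − n) turns ∑ᵢ ζ⋆(ī, 1̄) ζ̄(s + 1 − i) into a double
-- sum over n ≠ m whose inner sum over m satisfies a first-order recurrence in n;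
-- solving it brings in H, L and the numbers ∑uL n = ∑_{k ≤ n} L k / k.  With alternating
-- signs the kernel is 1 / (k + m) instead, and the sum of the products
-- ζ̄(p + 1 − i) (ζ⋆(i+1 barred, 1) + ζ̄(i + 2)) is reduced in the same way.  The triple
-- sums ∑ ∑uL n / nˢ from the two reductions cancel, and what the truncation neglects
-- is O(H N / N).

import Defs as ℝ
import Algebra.Solver.Ring as RingSolver
open import Algebra.Bundles using (CommutativeRing)
open import Algebra.Solver.Ring.AlmostCommutativeRing
  using (AlmostCommutativeRing; fromCommutativeRing; _-Raw-AlmostCommutative⟶_)
open import Algebra.Structures using (IsCommutativeRing)
open import Data.Integer.Base as ℤ using (1ℤ; -1ℤ)
open import Data.List.Base using ([]; _∷_)
open import Data.Maybe.Base using (Maybe)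
open import Data.Nat.Base as ℕ using (ℕ; zero; suc; _∸_; NonZero)
import Data.Nat.Properties as ℕ
open import Data.Product.Base using (_×_; _,_; proj₁; proj₂)
open import Data.Rational.Base as ℚ using (ℚ; 0ℚ; 1ℚ; ½; _≤_)
import Data.Rational.Properties as ℚ
open import Data.Unit.Base using (tt)
open import Relation.Binary.PropositionalEquality
open import Relation.Nullary.Decidable using (dec⇒maybe)
open ℝ.CauchyProperties using (L²-converges; HL-converges)

-- Some of the factors, such as ζ⋆(1̄, 1̄) and ζ̄(1), converge only conditionally, so the infinite
-- double sums cannot simply be rearranged. On the finite square n, m ≤ N every interchange is free,
-- and the analysis moves into explicit remainders. Each inner sum has a first-order recurrence
-- because the L or H inside it grows by ±1/(m + 1): moving n by one costs only a rational sum,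
-- which partial fractions evaluate. The remainders are not uniformly small. With the pole at n, the
-- truncated kernel leaves L at the distance from n to N where L N is wanted, and for n close to N
-- these differ by a fixed amount. The weight n⁻ˢ with s ≥ 2 repairs this: one factor 1/n pays for
-- the n steps of the recurrence, the other is joined to the reciprocal of the distance to N by
-- partial fractions, which produces a factor 1/(N + 1).

module Sums where

  open ℝ using (module CauchyProperties)

  -- Rational arithmetic, finite sums and partial fractions.

  infixl 6 _+_ _-_
  infixl 7 _*_
  infix  8 -_

  -- Opaque, because unfolding ℚ arithmetic makes type checking explode.
  opaque
    _+_ _*_ : ℚ → ℚ → ℚ
    _+_ = ℚ._+_
    _*_ = ℚ._*_

    -_ ∣_∣ : ℚ → ℚ
    -_  = ℚ.-_
    ∣_∣ = ℚ.∣_∣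

  _-_ : ℚ → ℚ → ℚ
  x - y = x + - y

  opaque
    unfolding _+_
    isCommutativeRing : IsCommutativeRing _≡_ _+_ _*_ -_ 0ℚ 1ℚ
    isCommutativeRing = ℚ.+-*-isCommutativeRing

  almostCommutativeRing : AlmostCommutativeRing _ _
  almostCommutativeRing = fromCommutativeRing record { isCommutativeRing = isCommutativeRing }

  opaque
    unfolding _+_
    +-homo : ∀ x y → x ℚ.+ y ≡ x + y
    +-homo _ _ = refl

    *-homo : ∀ x y → x ℚ.* y ≡ x * y
    *-homo _ _ = refl

    -‿homo : ∀ x → ℚ.- x ≡ - x
    -‿homo _ = refl

  -- The identity map from ℚ with computing operations to the same ring with opaque ones: constants
  -- are evaluated on the computing side, so ½ + ½ becomes 1 there.
  coefficients : CommutativeRing.rawRing ℚ.+-*-commutativeRing -Raw-AlmostCommutative⟶ almostCommutativeRing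
  coefficients = record
    { ⟦_⟧    = λ x → x
    ; +-homo = +-homo
    ; *-homo = *-homo
    ; -‿homo = -‿homo
    ; 0-homo = refl
    ; 1-homo = refl
    }

  _≟_ : ∀ x y → Maybe (x ≡ y)
  x ≟ y = dec⇒maybe (x ℚ.≟ y)

  open RingSolver (CommutativeRing.rawRing ℚ.+-*-commutativeRing) almostCommutativeRing coefficients _≟_
    using (solve; con; _:=_; _:+_; _:*_; _:-_; :-_) public

  open IsCommutativeRing isCommutativeRing
    using (+-comm; +-assoc; *-comm; *-assoc; +-identityˡ; +-identityʳ; *-identityˡ; *-identityʳ; zeroˡ; zeroʳ) public

  -- All indices are shifted by one: the index k < N stands for the summation
  -- variable k + 1 ≤ N, and u k = 1 / (k + 1), d k s = 1 / (k + 1)^s, σ k = (-1)^k.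
  sum : ℕ → (ℕ → ℚ) → ℚ
  sum zero    f = 0ℚ
  sum (suc N) f = sum N f + f N

  syntax sum N (λ k → e) = Σ[ k < N ] e

  open ≡-Reasoning

  sum-cong< : ∀ N {f g : ℕ → ℚ} → (∀ k → k ℕ.< N → f k ≡ g k) → sum N f ≡ sum N g
  sum-cong< zero    e = refl
  sum-cong< (suc N) e = cong₂ _+_ (sum-cong< N (λ k k<N → e k (ℕ.m≤n⇒m≤1+n k<N))) (e N ℕ.≤-refl)

  sum-cong : ∀ N {f g : ℕ → ℚ} → (∀ k → f k ≡ g k) → sum N f ≡ sum N g
  sum-cong N e = sum-cong< N (λ k _ → e k)

  sum-+ : ∀ N f g → sum N (λ k → f k + g k) ≡ sum N f + sum N g
  sum-+ zero    f g = sym (+-identityˡ 0ℚ)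
  sum-+ (suc N) f g = trans (cong (_+ (f N + g N)) (sum-+ N f g))
    (solve 4 (λ a b c d → a :+ b :+ (c :+ d) := a :+ c :+ (b :+ d)) refl (sum N f) (sum N g) (f N) (g N))

  sum-*ˡ : ∀ N c f → sum N (λ k → c * f k) ≡ c * sum N f
  sum-*ˡ zero    c f = sym (zeroʳ c)
  sum-*ˡ (suc N) c f = trans (cong (_+ c * f N) (sum-*ˡ N c f))
    (solve 3 (λ c a b → c :* a :+ c :* b := c :* (a :+ b)) refl c (sum N f) (f N))

  sum-*ʳ : ∀ N f c → sum N (λ k → f k * c) ≡ sum N f * c
  sum-*ʳ N f c = trans (sum-cong N (λ k → *-comm (f k) c)) (trans (sum-*ˡ N c f) (*-comm c (sum N f)))

  sum-neg : ∀ N f → sum N (λ k → - f k) ≡ - sum N f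
  sum-neg N f = trans (sum-cong N (λ k → solve 1 (λ a → :- a := :- con 1ℚ :* a) refl (f k)))
    (trans (sum-*ˡ N (- 1ℚ) f) (solve 1 (λ a → :- con 1ℚ :* a := :- a) refl (sum N f)))

  sum-head : ∀ N f → sum (suc N) f ≡ f 0 + Σ[ k < N ] f (suc k)
  sum-head zero    f = +-comm 0ℚ (f 0)
  sum-head (suc N) f = trans (cong (_+ f (suc N)) (sum-head N f))
    (+-assoc (f 0) (Σ[ k < N ] f (suc k)) (f (suc N)))

  sum-0 : ∀ N → Σ[ k < N ] 0ℚ ≡ 0ℚ
  sum-0 zero    = refl
  sum-0 (suc N) = trans (+-identityʳ _) (sum-0 N)

  sum-swap : ∀ M N (f : ℕ → ℕ → ℚ) →
    Σ[ m < M ] Σ[ n < N ] f m n ≡ Σ[ n < N ] Σ[ m < M ] f m n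
  sum-swap zero    N f = sym (sum-0 N)
  sum-swap (suc M) N f = trans (cong (_+ Σ[ n < N ] f M n) (sum-swap M N f))
    (sym (sum-+ N (λ n → Σ[ m < M ] f m n) (f M)))

  sum-* : ∀ M N f g → sum M f * sum N g ≡ Σ[ m < M ] Σ[ n < N ] (f m * g n)
  sum-* M N f g = trans (sym (sum-*ʳ M f (sum N g))) (sum-cong M (λ m → sym (sum-*ˡ N (f m) g)))

  -- Recursive, so that literals and the step from p to p + 1 are ring expressions by mere
  -- computation.
  num : ℕ → ℚ
  num zero    = 0ℚ
  num (suc n) = 1ℚ + num n

  num-+ : ∀ m n → num (m ℕ.+ n) ≡ num m + num n
  num-+ zero    n = sym (+-identityˡ (num n))
  num-+ (suc m) n = trans (cong (1ℚ +_) (num-+ m n)) (sym (+-assoc 1ℚ (num m) (num n)))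

  opaque
    u : ℕ → ℚ
    u = CauchyProperties.u

  opaque
    unfolding u _+_
    num≡ι : ∀ n → num n ≡ CauchyProperties.ι n
    num≡ι zero    = refl
    num≡ι (suc n) = trans (cong (1ℚ +_) (num≡ι n)) (sym (CauchyProperties.ι-suc n))

    num*u : ∀ k → num (suc k) * u k ≡ 1ℚ
    num*u k = trans (cong (_* u k) (num≡ι (suc k))) (CauchyProperties.ι*u k)

  -- Partial fractions: the denominators m + 1 and n + 1 add up to m + n + 2. It serves both as the
  -- kernel of the alternating sums and, when m + n + 2 = N + 1, as the source of the factor `u N`
  -- in the estimate of `Q-error`.
  u*u : ∀ m n → u m * u n ≡ (u m + u n) * u (suc (m ℕ.+ n))
  u*u m n = begin
    u m * u n
      ≡⟨ *-identityʳ (u m * u n) ⟨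
    u m * u n * 1ℚ
      ≡⟨ cong (u m * u n *_) (num*u (suc (m ℕ.+ n))) ⟨
    u m * u n * (num (2 ℕ.+ (m ℕ.+ n)) * v)
      ≡⟨ cong (λ x → u m * u n * (x * v)) (trans (cong (λ k → num (suc k)) (sym (ℕ.+-suc m n))) (num-+ (suc m) (suc n))) ⟩
    u m * u n * ((num (suc m) + num (suc n)) * v)
      ≡⟨ solve 5 (λ a b x y v → a :* b :* ((x :+ y) :* v) := (b :* (x :* a) :+ a :* (y :* b)) :* v) refl
           (u m) (u n) (num (suc m)) (num (suc n)) v ⟩
    (u n * (num (suc m) * u m) + u m * (num (suc n) * u n)) * v
      ≡⟨ cong₂ (λ x y → (u n * x + u m * y) * v) (num*u m) (num*u n) ⟩
    (u n * 1ℚ + u m * 1ℚ) * v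
      ≡⟨ solve 3 (λ a b v → (b :* con 1ℚ :+ a :* con 1ℚ) :* v := (a :+ b) :* v) refl (u m) (u n) v ⟩
    (u m + u n) * v ∎
    where
    v : ℚ
    v = u (suc (m ℕ.+ n))

  σ : ℕ → ℚ
  σ zero    = 1ℚ
  σ (suc n) = - σ n

  σ*σ : ∀ n → σ n * σ n ≡ 1ℚ
  σ*σ zero    = *-identityˡ 1ℚ
  σ*σ (suc n) = trans (solve 1 (λ a → :- a :* :- a := a :* a) refl (σ n)) (σ*σ n)

  d : ℕ → ℕ → ℚ
  d k zero    = 1ℚ
  d k (suc s) = u k * d k s

  -- ρ m n = 1 / (m − n), with 0 on the diagonal; δ is the Kronecker symbol.
  ρ δ : ℕ → ℕ → ℚ
  ρ zero    zero    = 0ℚ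
  ρ zero    (suc n) = - u n
  ρ (suc m) zero    = u m
  ρ (suc m) (suc n) = ρ m n

  δ zero    zero    = 1ℚ
  δ zero    (suc n) = 0ℚ
  δ (suc m) zero    = 0ℚ
  δ (suc m) (suc n) = δ m n

  ρ-antisym : ∀ m n → ρ n m ≡ - ρ m n
  ρ-antisym zero    zero    = solve 0 (con 0ℚ := :- con 0ℚ) refl
  ρ-antisym zero    (suc n) = solve 1 (λ a → a := :- (:- a)) refl (u n)
  ρ-antisym (suc m) zero    = refl
  ρ-antisym (suc m) (suc n) = ρ-antisym m n

  δ-subst : ∀ m n (f : ℕ → ℚ) → δ m n * f m ≡ δ m n * f n
  δ-subst zero    zero    f = refl
  δ-subst zero    (suc n) f = trans (zeroˡ (f 0)) (sym (zeroˡ (f (suc n))))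
  δ-subst (suc m) zero    f = trans (zeroˡ (f (suc m))) (sym (zeroˡ (f 0)))
  δ-subst (suc m) (suc n) f = δ-subst m n (λ k → f (suc k))

  sum-δ : ∀ {n N} → n ℕ.< N → Σ[ m < N ] δ m n ≡ 1ℚ
  sum-δ {zero}  {suc N} _           = trans (sum-head N (λ m → δ m 0))
    (trans (cong (1ℚ +_) (sum-0 N)) (+-identityʳ 1ℚ))
  sum-δ {suc n} {suc N} (ℕ.s≤s n<N) = trans (sum-head N (λ m → δ m (suc n)))
    (trans (+-identityˡ _) (sum-δ n<N))

  num-ρ : ∀ m n → (num m - num n) * ρ m n ≡ 1ℚ - δ m n
  num-ρ zero    zero    = solve 0 ((con 0ℚ :- con 0ℚ) :* con 0ℚ := con 1ℚ :- con 1ℚ) refl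
  num-ρ zero    (suc n) = trans
    (solve 2 (λ a b → (con 0ℚ :- a) :* (:- b) := a :* b) refl (num (suc n)) (u n))
    (trans (num*u n) (solve 0 (con 1ℚ := con 1ℚ :- con 0ℚ) refl))
  num-ρ (suc m) zero    = trans
    (solve 2 (λ a b → (a :- con 0ℚ) :* b := a :* b) refl (num (suc m)) (u m))
    (trans (num*u m) (solve 0 (con 1ℚ := con 1ℚ :- con 0ℚ) refl))
  num-ρ (suc m) (suc n) = trans
    (cong (_* ρ m n) (solve 2 (λ a b → con 1ℚ :+ a :- (con 1ℚ :+ b) := a :- b) refl (num m) (num n)))
    (num-ρ m n)

  -- The counterpart of `u*u` for the difference of two denominators. On the diagonal, where `ρ` is
  -- 0, the `δ` term restores the square.
  u*u-ρ : ∀ m n → u m * u n ≡ (u n - u m) * ρ m n + δ m n * (u n * u n)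
  u*u-ρ m n = sym (begin
    (u n - u m) * ρ m n + δ m n * (u n * u n)
      ≡⟨ cong₂ (λ x y → x * ρ m n + y) u-u (trans (sym (δ-subst m n (λ k → u n * u k)))
           (solve 3 (λ z b a → z :* (b :* a) := a :* b :* z) refl (δ m n) (u n) (u m))) ⟩
    u m * u n * (num m - num n) * ρ m n + u m * u n * δ m n
      ≡⟨ cong (_+ u m * u n * δ m n) (*-assoc (u m * u n) (num m - num n) (ρ m n)) ⟩
    u m * u n * ((num m - num n) * ρ m n) + u m * u n * δ m n
      ≡⟨ cong (λ x → u m * u n * x + u m * u n * δ m n) (num-ρ m n) ⟩
    u m * u n * (1ℚ - δ m n) + u m * u n * δ m n
      ≡⟨ solve 2 (λ x y → x :* (con 1ℚ :- y) :+ x :* y := x) refl (u m * u n) (δ m n) ⟩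
    u m * u n ∎)
    where
    u-u : u n - u m ≡ u m * u n * (num m - num n)
    u-u = begin
      u n - u m
        ≡⟨ solve 2 (λ a b → b :- a := b :* con 1ℚ :- a :* con 1ℚ) refl (u m) (u n) ⟩
      u n * 1ℚ - u m * 1ℚ
        ≡⟨ cong₂ (λ x y → u n * x - u m * y) (num*u m) (num*u n) ⟨
      u n * (num (suc m) * u m) - u m * (num (suc n) * u n)
        ≡⟨ solve 4 (λ a b x y → b :* ((con 1ℚ :+ x) :* a) :- a :* ((con 1ℚ :+ y) :* b) := a :* b :* (x :- y)) refl
             (u m) (u n) (num m) (num n) ⟩
      u m * u n * (num m - num n) ∎

-- Exact finite identities, beginning with the kernel 1 / (m - n).

module Identities where

  open Sums
  open ≡-Reasoning

  H L L₂ : ℕ → ℚ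
  H n  = Σ[ k < n ] u k
  L n  = Σ[ k < n ] (σ k * u k)
  L₂ n = Σ[ k < n ] (σ k * d k 2)

  -- The pole m = n has n terms on its left, which give - H n, and r on its right, which give H r.
  -- The induction on n removes the leftmost term, `ρ` being invariant under translation.
  sum-ρ : ∀ n r → Σ[ m < n ℕ.+ suc r ] ρ m n ≡ H r - H n
  sum-ρ zero    r = trans (sum-head r (λ m → ρ m 0))
    (solve 1 (λ a → con 0ℚ :+ a := a :- con 0ℚ) refl (H r))
  sum-ρ (suc n) r = begin
    Σ[ m < suc n ℕ.+ suc r ] ρ m (suc n)     ≡⟨ sum-head (n ℕ.+ suc r) (λ m → ρ m (suc n)) ⟩
    - u n + Σ[ m < n ℕ.+ suc r ] ρ m n       ≡⟨ cong (- u n +_) (sum-ρ n r) ⟩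
    - u n + (H r - H n)                      ≡⟨ solve 3 (λ a b c → :- a :+ (b :- c) := b :- (c :+ a)) refl (u n) (H r) (H n) ⟩
    H r - H (suc n)                          ∎

  sum-σρ : ∀ n r → Σ[ m < n ℕ.+ suc r ] (σ m * ρ m n) ≡ σ n * (L n - L r)
  sum-σρ zero    r = begin
    Σ[ m < suc r ] (σ m * ρ m 0)             ≡⟨ sum-head r (λ m → σ m * ρ m 0) ⟩
    1ℚ * 0ℚ + Σ[ m < r ] (- σ m * u m)       ≡⟨ cong (1ℚ * 0ℚ +_) (sum-cong r λ m →
                                                   solve 2 (λ a b → :- a :* b := :- (a :* b)) refl (σ m) (u m)) ⟩
    1ℚ * 0ℚ + Σ[ m < r ] (- (σ m * u m))     ≡⟨ cong (1ℚ * 0ℚ +_) (sum-neg r (λ m → σ m * u m)) ⟩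
    1ℚ * 0ℚ + - L r                          ≡⟨ solve 1 (λ a → con 1ℚ :* con 0ℚ :+ :- a := con 1ℚ :* (con 0ℚ :- a)) refl (L r) ⟩
    1ℚ * (0ℚ - L r)                          ∎
  sum-σρ (suc n) r = begin
    Σ[ m < suc n ℕ.+ suc r ] (σ m * ρ m (suc n))
      ≡⟨ sum-head (n ℕ.+ suc r) (λ m → σ m * ρ m (suc n)) ⟩
    1ℚ * - u n + Σ[ m < n ℕ.+ suc r ] (- σ m * ρ m n)
      ≡⟨ cong₂ _+_ (cong (_* - u n) (sym (σ*σ n)))
           (trans (sum-cong (n ℕ.+ suc r) λ m → solve 2 (λ a b → :- a :* b := :- (a :* b)) refl (σ m) (ρ m n))
             (sum-neg (n ℕ.+ suc r) (λ m → σ m * ρ m n))) ⟩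
    σ n * σ n * - u n + - (Σ[ m < n ℕ.+ suc r ] (σ m * ρ m n))
      ≡⟨ cong (λ x → σ n * σ n * - u n + - x) (sum-σρ n r) ⟩
    σ n * σ n * - u n + - (σ n * (L n - L r))
      ≡⟨ solve 4 (λ s v a b → s :* s :* :- v :+ :- (s :* (a :- b)) := :- s :* (a :+ s :* v :- b)) refl
           (σ n) (u n) (L n) (L r) ⟩
    σ (suc n) * (L (suc n) - L r) ∎

  -- φ N ν is the sum of (-1)^(m−ν) L m / (m − ν) over 0 ≤ m ≤ N, m ≠ ν; here, and in
  -- γ N n below, the second argument is not shifted.
  φ : ℕ → ℕ → ℚ
  φ N ν = σ ν * Σ[ m < suc N ] (ρ m ν * (σ m * L m))

  -- The first term is the summand m = N, which leaves the range when the index is shifted. The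
  -- second is the upper end of `sum-ρ*u`, where H N and H (N - ν - 1) fail to cancel.
  φ-error : ℕ → ℕ → ℚ
  φ-error N ν = - (σ ν * (ρ N ν * (σ N * L N))) - σ ν * (u ν * (H N - H (N ∸ suc ν)))

  -- Off the diagonal, 1 / ((m - n)(m + 1)) is 1 / (n + 1) times 1 / (m - n) - 1 / (m + 1). At m = n
  -- the left side is 0 while the right side is -(u n)², whence the added square.
  sum-ρ*u : ∀ n r → let N = n ℕ.+ suc r in
    Σ[ m < N ] (ρ m n * u m) ≡ u n * (H r - H n) - u n * H N + u n * u n
  sum-ρ*u n r = begin
    Σ[ m < N ] (ρ m n * u m)
      ≡⟨ sum-cong N (λ m → ρ*u m) ⟩
    Σ[ m < N ] (u n * ρ m n + (- u n) * u m + (u n * u n) * δ m n)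
      ≡⟨ sum-+ N (λ m → u n * ρ m n + (- u n) * u m) (λ m → (u n * u n) * δ m n) ⟩
    Σ[ m < N ] (u n * ρ m n + (- u n) * u m) + Σ[ m < N ] ((u n * u n) * δ m n)
      ≡⟨ cong₂ _+_ (sum-+ N (λ m → u n * ρ m n) (λ m → (- u n) * u m)) (sum-*ˡ N (u n * u n) (λ m → δ m n)) ⟩
    Σ[ m < N ] (u n * ρ m n) + Σ[ m < N ] ((- u n) * u m) + (u n * u n) * Σ[ m < N ] δ m n
      ≡⟨ cong₂ (λ x y → x + y + (u n * u n) * Σ[ m < N ] δ m n)
           (trans (sum-*ˡ N (u n) (λ m → ρ m n)) (cong (u n *_) (sum-ρ n r)))
           (sum-*ˡ N (- u n) u) ⟩
    u n * (H r - H n) + (- u n) * H N + (u n * u n) * Σ[ m < N ] δ m n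
      ≡⟨ cong (λ x → u n * (H r - H n) + (- u n) * H N + (u n * u n) * x) (sum-δ (ℕ.m<m+n n ℕ.z<s)) ⟩
    u n * (H r - H n) + (- u n) * H N + (u n * u n) * 1ℚ
      ≡⟨ solve 3 (λ a b c → b :+ (:- a) :* c :+ (a :* a) :* con 1ℚ := b :- a :* c :+ a :* a) refl
           (u n) (u n * (H r - H n)) (H N) ⟩
    u n * (H r - H n) - u n * H N + u n * u n ∎
    where
    N : ℕ
    N = n ℕ.+ suc r
    ρ*u : ∀ m → ρ m n * u m ≡ u n * ρ m n + (- u n) * u m + (u n * u n) * δ m n
    ρ*u m = begin
      ρ m n * u m
        ≡⟨ solve 4 (λ r a b x → r :* a := b :* r :- ((b :- a) :* r :+ x :* (b :* b)) :+ x :* (b :* b)) refl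
             (ρ m n) (u m) (u n) (δ m n) ⟩
      u n * ρ m n - ((u n - u m) * ρ m n + δ m n * (u n * u n)) + δ m n * (u n * u n)
        ≡⟨ cong (λ y → u n * ρ m n - y + δ m n * (u n * u n)) (u*u-ρ m n) ⟨
      u n * ρ m n - u m * u n + δ m n * (u n * u n)
        ≡⟨ solve 4 (λ r a b x → r :- a :* b :+ x :* (b :* b) := r :+ (:- b) :* a :+ (b :* b) :* x) refl
             (u n * ρ m n) (u m) (u n) (δ m n) ⟩
      u n * ρ m n + (- u n) * u m + (u n * u n) * δ m n ∎

  -- Moving ν and m together leaves `ρ` unchanged, the two sign changes cancel, and the summand m =
  -- 0 vanishes because L 0 = 0. This is also the shape in which φ occurs as an inner sum in `Q-φ`.
  φ-shift : ∀ N ν → φ N (suc ν) ≡ σ ν * Σ[ m < N ] (ρ m ν * (σ m * L (suc m)))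
  φ-shift N ν = begin
    - σ ν * Σ[ m < suc N ] (ρ m (suc ν) * (σ m * L m))
      ≡⟨ cong (- σ ν *_) (sum-head N (λ m → ρ m (suc ν) * (σ m * L m))) ⟩
    - σ ν * (- u ν * (1ℚ * 0ℚ) + Σ[ m < N ] (ρ m ν * (- σ m * L (suc m))))
      ≡⟨ cong (λ x → - σ ν * (- u ν * (1ℚ * 0ℚ) + x)) (trans (sum-cong N λ m →
           solve 3 (λ a b c → a :* (:- b :* c) := :- (a :* (b :* c))) refl (ρ m ν) (σ m) (L (suc m)))
           (sum-neg N (λ m → ρ m ν * (σ m * L (suc m))))) ⟩
    - σ ν * (- u ν * (1ℚ * 0ℚ) + - Σ[ m < N ] (ρ m ν * (σ m * L (suc m))))
      ≡⟨ solve 3 (λ s v x → :- s :* (:- v :* (con 1ℚ :* con 0ℚ) :+ :- x) := s :* x) refl (σ ν) (u ν) _ ⟩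
    σ ν * Σ[ m < N ] (ρ m ν * (σ m * L (suc m))) ∎

  -- After the shift, L (m + 1) exceeds L m by (-1)^m / (m + 1). The weight (-1)^m in φ squares this
  -- sign away, so the increment is the rational sum `sum-ρ*u`.
  φ-suc : ∀ ν r → let N = ν ℕ.+ suc r in
    φ N (suc ν) ≡ φ N ν + σ ν * ((d ν 2 + d ν 2) - u ν * H (suc ν)) + φ-error N ν
  φ-suc ν r = begin
    φ N (suc ν)
      ≡⟨ φ-shift N ν ⟩
    σ ν * Σ[ m < N ] (ρ m ν * (σ m * L (suc m)))
      ≡⟨ cong (σ ν *_) (trans (sum-cong N split) (sum-+ N (λ m → ρ m ν * (σ m * L m)) (λ m → ρ m ν * u m))) ⟩
    σ ν * (S + Σ[ m < N ] (ρ m ν * u m))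
      ≡⟨ cong (λ x → σ ν * (S + x)) (sum-ρ*u ν r) ⟩
    σ ν * (S + (u ν * (H r - H ν) - u ν * H N + u ν * u ν))
      ≡⟨ solve 7 (λ s S v a b c t →
           s :* (S :+ (v :* (a :- b) :- v :* c :+ v :* v)) :=
           s :* (S :+ t) :+ s :* ((v :* (v :* con 1ℚ) :+ v :* (v :* con 1ℚ)) :- v :* (b :+ v))
             :+ (:- (s :* t) :- s :* (v :* (c :- a)))) refl
           (σ ν) S (u ν) (H r) (H ν) (H N) (ρ N ν * (σ N * L N)) ⟩
    φ N ν + σ ν * ((d ν 2 + d ν 2) - u ν * H (suc ν))
      + (- (σ ν * (ρ N ν * (σ N * L N))) - σ ν * (u ν * (H N - H r)))
      ≡⟨ cong (λ k → φ N ν + σ ν * ((d ν 2 + d ν 2) - u ν * H (suc ν))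
           + (- (σ ν * (ρ N ν * (σ N * L N))) - σ ν * (u ν * (H N - H k)))) N∸sν ⟨
    φ N ν + σ ν * ((d ν 2 + d ν 2) - u ν * H (suc ν)) + φ-error N ν ∎
    where
    N : ℕ
    N = ν ℕ.+ suc r
    S : ℚ
    S = Σ[ m < N ] (ρ m ν * (σ m * L m))
    N∸sν : N ∸ suc ν ≡ r
    N∸sν = trans (cong (_∸ suc ν) (ℕ.+-suc ν r)) (ℕ.m+n∸m≡n (suc ν) r)
    split : ∀ m → ρ m ν * (σ m * L (suc m)) ≡ ρ m ν * (σ m * L m) + ρ m ν * u m
    split m = begin
      ρ m ν * (σ m * (L m + σ m * u m))
        ≡⟨ solve 4 (λ r s l v → r :* (s :* (l :+ s :* v)) := r :* (s :* l) :+ r :* (s :* s :* v)) refl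
             (ρ m ν) (σ m) (L m) (u m) ⟩
      ρ m ν * (σ m * L m) + ρ m ν * (σ m * σ m * u m)
        ≡⟨ cong (λ x → ρ m ν * (σ m * L m) + ρ m ν * (x * u m)) (σ*σ m) ⟩
      ρ m ν * (σ m * L m) + ρ m ν * (1ℚ * u m)
        ≡⟨ cong (λ x → ρ m ν * (σ m * L m) + ρ m ν * x) (*-identityˡ (u m)) ⟩
      ρ m ν * (σ m * L m) + ρ m ν * u m ∎

  ∑uL : ℕ → ℚ
  ∑uL n = Σ[ k < n ] (u k * L (suc k))

  -- Summation by parts: the increment of H n * L n is the sum of the terms with H and with L, less
  -- σ n (u n)², which both contain.
  sum-σuH : ∀ n → Σ[ k < n ] (σ k * (u k * H (suc k))) ≡ H n * L n + L₂ n - ∑uL n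
  sum-σuH zero    = solve 0 (con 0ℚ := con 0ℚ :* con 0ℚ :+ con 0ℚ :- con 0ℚ) refl
  sum-σuH (suc n) = trans (cong (_+ σ n * (u n * H (suc n))) (sum-σuH n))
    (solve 6 (λ h l l₂ b s v →
      h :* l :+ l₂ :- b :+ s :* (v :* (h :+ v)) :=
      (h :+ v) :* (l :+ s :* v) :+ (l₂ :+ s :* (v :* (v :* con 1ℚ))) :- (b :+ v :* (l :+ s :* v))) refl
      (H n) (L n) (L₂ n) (∑uL n) (σ n) (u n))

  -- The square of L n is split along the larger index. Both halves contain the diagonal, whose
  -- terms are 1/k² because the signs square to 1.
  sum-σuL : ∀ n → L n * L n + Σ[ k < n ] d k 2 ≡ Σ[ k < n ] (σ k * (u k * L (suc k))) + Σ[ k < n ] (σ k * (u k * L (suc k)))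
  sum-σuL zero    = solve 0 (con 0ℚ :* con 0ℚ :+ con 0ℚ := con 0ℚ :+ con 0ℚ) refl
  sum-σuL (suc n) = begin
    (l + σ n * u n) * (l + σ n * u n) + (z₂ + u n * (u n * 1ℚ))
      ≡⟨ solve 5 (λ l z s v S → (l :+ s :* v) :* (l :+ s :* v) :+ (z :+ v :* (v :* con 1ℚ)) :=
           l :* l :+ z :+ (con 1ℚ :- s :* s) :* (v :* v) :+ (s :* (v :* (l :+ s :* v)) :+ s :* (v :* (l :+ s :* v)))) refl
           l z₂ (σ n) (u n) S ⟩
    l * l + z₂ + (1ℚ - σ n * σ n) * (u n * u n) + (t + t)
      ≡⟨ cong₂ (λ x y → x + (1ℚ - y) * (u n * u n) + (t + t)) (sum-σuL n) (σ*σ n) ⟩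
    S + S + (1ℚ - 1ℚ) * (u n * u n) + (t + t)
      ≡⟨ solve 3 (λ S v t → S :+ S :+ (con 1ℚ :- con 1ℚ) :* v :+ (t :+ t) := S :+ t :+ (S :+ t)) refl S (u n * u n) t ⟩
    S + t + (S + t) ∎
    where
    l z₂ S t : ℚ
    l = L n
    z₂ = Σ[ k < n ] d k 2
    S = Σ[ k < n ] (σ k * (u k * L (suc k)))
    t = σ n * (u n * L (suc n))

  Z : ℕ → ℕ → ℚ
  Z s n = Σ[ k < n ] d k s

  -- Its `Z 2` part accounts for ½ ζ(2) ζ(p + 1) in the theorem, its L² part for one of the two ζ(p
  -- + 1) beside ½ ln² 2. The other one and ζ̄(p + 1) come from `γ-zero`.
  φ-zero : ∀ N → φ N 0 ≡ - (½ * (L N * L N + Z 2 N))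
  φ-zero N = begin
    φ N 0
      ≡⟨ cong (1ℚ *_) (sum-head N (λ m → ρ m 0 * (σ m * L m))) ⟩
    1ℚ * (0ℚ * (1ℚ * 0ℚ) + Σ[ m < N ] (u m * (- σ m * L (suc m))))
      ≡⟨ cong (λ x → 1ℚ * (0ℚ * (1ℚ * 0ℚ) + x)) (trans (sum-cong N λ m →
           solve 3 (λ v s l → v :* (:- s :* l) := :- (s :* (v :* l))) refl (u m) (σ m) (L (suc m)))
           (sum-neg N (λ m → σ m * (u m * L (suc m))))) ⟩
    1ℚ * (0ℚ * (1ℚ * 0ℚ) + - S)
      ≡⟨ solve 1 (λ S → con 1ℚ :* (con 0ℚ :* (con 1ℚ :* con 0ℚ) :+ :- S) := :- (con ½ :* (S :+ S))) refl S ⟩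
    - (½ * (S + S))
      ≡⟨ cong (λ x → - (½ * x)) (sum-σuL N) ⟨
    - (½ * (L N * L N + Z 2 N)) ∎
    where
    S : ℚ
    S = Σ[ m < N ] (σ m * (u m * L (suc m)))

  -- Apart from the errors, the increments sum to 2 L₂ - (H L + L₂ - ∑uL), the bracket being the
  -- summation by parts of `sum-σuH`. The bound n ≤ N keeps every pole passed on the way inside the
  -- range.
  φ-closed : ∀ N n → n ℕ.≤ N →
    φ N n ≡ φ N 0 + (L₂ n - H n * L n + ∑uL n) + Σ[ ν < n ] φ-error N ν
  φ-closed N zero    _   = solve 1 (λ a → a := a :+ (con 0ℚ :- con 0ℚ :* con 0ℚ :+ con 0ℚ) :+ con 0ℚ) refl (φ N 0)
  φ-closed N (suc n) n<N = begin
    φ N (suc n)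
      ≡⟨ subst (λ M → φ M (suc n) ≡ φ M n + g + φ-error M n) N≡ (φ-suc n (N ∸ suc n)) ⟩
    φ N n + g + φ-error N n
      ≡⟨ cong (λ x → x + g + φ-error N n) (φ-closed N n (ℕ.<⇒≤ n<N)) ⟩
    φ N 0 + (L₂ n - H n * L n + ∑uL n) + E + g + φ-error N n
      ≡⟨ solve 9 (λ a l₂ h l b E s v e →
           a :+ (l₂ :- h :* l :+ b) :+ E :+ s :* ((v :* (v :* con 1ℚ) :+ v :* (v :* con 1ℚ)) :- v :* (h :+ v)) :+ e :=
           a :+ ((l₂ :+ s :* (v :* (v :* con 1ℚ))) :- (h :+ v) :* (l :+ s :* v) :+ (b :+ v :* (l :+ s :* v)))
             :+ (E :+ e)) refl
           (φ N 0) (L₂ n) (H n) (L n) (∑uL n) E (σ n) (u n) (φ-error N n) ⟩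
    φ N 0 + (L₂ (suc n) - H (suc n) * L (suc n) + ∑uL (suc n)) + (E + φ-error N n) ∎
    where
    E g : ℚ
    E = Σ[ ν < n ] φ-error N ν
    g = σ n * ((d n 2 + d n 2) - u n * H (suc n))
    N≡ : n ℕ.+ suc (N ∸ suc n) ≡ N
    N≡ = trans (ℕ.+-suc n (N ∸ suc n)) (ℕ.m+[n∸m]≡n n<N)

  -- The products ζ⋆(ī, 1̄) ζ̄(p + 2 - i).

  K : ℕ → ℕ → ℕ → ℚ
  K p n m = Σ[ i < suc p ] (d n (suc i) * d m (suc (p ∸ i)))

  -- On the diagonal the geometric sum degenerates to p + 1 equal terms: this is the origin of the
  -- coefficient p + 1 of ζ⋆(p + 2, 1̄). The induction splits off the last exponent, and `u*u-ρ`
  -- absorbs it.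
  K-closed : ∀ p n m →
    K p n m ≡ (d n (suc p) - d m (suc p)) * ρ m n + δ m n * (num (suc p) * d n (2 ℕ.+ p))
  K-closed zero    n m = begin
    0ℚ + (u n * 1ℚ) * (u m * 1ℚ)
      ≡⟨ solve 2 (λ a b → con 0ℚ :+ (a :* con 1ℚ) :* (b :* con 1ℚ) := b :* a) refl (u n) (u m) ⟩
    u m * u n
      ≡⟨ u*u-ρ m n ⟩
    (u n - u m) * ρ m n + δ m n * (u n * u n)
      ≡⟨ solve 4 (λ a b r x → (a :- b) :* r :+ x :* (a :* a) :=
           (a :* con 1ℚ :- b :* con 1ℚ) :* r :+ x :* ((con 1ℚ :+ con 0ℚ) :* (a :* (a :* con 1ℚ)))) refl
           (u n) (u m) (ρ m n) (δ m n) ⟩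
    (d n 1 - d m 1) * ρ m n + δ m n * (num 1 * d n 2) ∎
  K-closed (suc p) n m = begin
    K (suc p) n m
      ≡⟨ cong₂ _+_
           (trans (sum-cong< (suc p) λ i i<sp → trans
             (cong (λ q → d n (suc i) * d m (suc q)) (ℕ.+-∸-assoc 1 (ℕ.≤-pred i<sp)))
             (solve 3 (λ a b c → a :* (b :* c) := b :* (a :* c)) refl (d n (suc i)) (u m) (d m (suc (p ∸ i)))))
             (sum-*ˡ (suc p) (u m) (λ i → d n (suc i) * d m (suc (p ∸ i)))))
           (cong (λ q → d n (2 ℕ.+ p) * d m (suc q)) (ℕ.n∸n≡0 p)) ⟩
    u m * K p n m + d n (2 ℕ.+ p) * (u m * 1ℚ)
      ≡⟨ cong (λ x → u m * x + d n (2 ℕ.+ p) * (u m * 1ℚ)) (K-closed p n m) ⟩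
    u m * ((a - b) * r + δ m n * (c * (u n * a))) + u n * a * (u m * 1ℚ)
      ≡⟨ solve 7 (λ um un a b r x c →
           um :* ((a :- b) :* r :+ x :* (c :* (un :* a))) :+ un :* a :* (um :* con 1ℚ) :=
           um :* ((a :- b) :* r) :+ (x :* um) :* (c :* (un :* a)) :+ a :* (um :* un)) refl
           (u m) (u n) a b r (δ m n) c ⟩
    u m * ((a - b) * r) + (δ m n * u m) * (c * (u n * a)) + a * (u m * u n)
      ≡⟨ cong₂ (λ x y → u m * ((a - b) * r) + x * (c * (u n * a)) + a * y)
           (δ-subst m n u) (u*u-ρ m n) ⟩
    u m * ((a - b) * r) + (δ m n * u n) * (c * (u n * a)) + a * ((u n - u m) * r + δ m n * (u n * u n))
      ≡⟨ solve 7 (λ um un a b r x c →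
           um :* ((a :- b) :* r) :+ (x :* un) :* (c :* (un :* a)) :+ a :* ((un :- um) :* r :+ x :* (un :* un)) :=
           (un :* a :- um :* b) :* r :+ x :* ((con 1ℚ :+ c) :* (un :* (un :* a)))) refl
           (u m) (u n) a b r (δ m n) c ⟩
    (d n (2 ℕ.+ p) - d m (2 ℕ.+ p)) * r + δ m n * (num (2 ℕ.+ p) * d n (3 ℕ.+ p)) ∎
    where
    a b c r : ℚ
    a = d n (suc p)
    b = d m (suc p)
    c = num (suc p)
    r = ρ m n

  Q : ℕ → ℕ → ℚ
  Q p N = Σ[ i < suc p ]
    (Σ[ n < N ] (σ n * d n (suc i) * L (suc n)) * Σ[ m < N ] (σ m * d m (suc (p ∸ i))))

  sum-swap₃ : ∀ I M N (f : ℕ → ℕ → ℕ → ℚ) →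
    Σ[ i < I ] Σ[ m < M ] Σ[ n < N ] f i m n ≡ Σ[ m < M ] Σ[ n < N ] Σ[ i < I ] f i m n
  sum-swap₃ I M N f = trans (sum-swap I M (λ i m → Σ[ n < N ] f i m n))
    (sum-cong M λ m → sum-swap I N (λ i n → f i m n))

  Q-kernel : ∀ p N → Q p N ≡ Σ[ n < N ] Σ[ m < N ] (σ n * σ m * L (suc n) * K p n m)
  Q-kernel p N = begin
    Q p N
      ≡⟨ sum-cong (suc p) (λ i → sum-* N N (λ n → σ n * d n (suc i) * L (suc n)) (λ m → σ m * d m (suc (p ∸ i)))) ⟩
    Σ[ i < suc p ] Σ[ n < N ] Σ[ m < N ] ((σ n * d n (suc i) * L (suc n)) * (σ m * d m (suc (p ∸ i))))
      ≡⟨ sum-swap₃ (suc p) N N (λ i n m → (σ n * d n (suc i) * L (suc n)) * (σ m * d m (suc (p ∸ i)))) ⟩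
    Σ[ n < N ] Σ[ m < N ] Σ[ i < suc p ] ((σ n * d n (suc i) * L (suc n)) * (σ m * d m (suc (p ∸ i))))
      ≡⟨ sum-cong N (λ n → sum-cong N λ m → trans
           (sum-cong (suc p) λ i →
             solve 5 (λ s x l t y → s :* x :* l :* (t :* y) := s :* t :* l :* (x :* y)) refl
               (σ n) (d n (suc i)) (L (suc n)) (σ m) (d m (suc (p ∸ i))))
           (sum-*ˡ (suc p) (σ n * σ m * L (suc n)) (λ i → d n (suc i) * d m (suc (p ∸ i))))) ⟩
    Σ[ n < N ] Σ[ m < N ] (σ n * σ m * L (suc n) * K p n m) ∎

  -- The half of the kernel with weight `d n` keeps its outer sum over n and is summed over m by
  -- `sum-σρ`. In the half with weight `d m` the names n and m are exchanged. The antisymmetry of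
  -- `ρ` then turns its minus sign into a plus, so both halves carry `d n`, and the inner sum of the
  -- second is φ.
  Q-φ : ∀ p N → Q p N ≡ Σ[ n < N ]
    (num (suc p) * (d n (2 ℕ.+ p) * L (suc n))
     + d n (suc p) * (L (suc n) * (L n - L (N ∸ suc n)) + φ N (suc n)))
  Q-φ p N = begin
    Q p N
      ≡⟨ Q-kernel p N ⟩
    Σ[ n < N ] Σ[ m < N ] (σ n * σ m * L (suc n) * K p n m)
      ≡⟨ sum-cong N (λ n → trans (sum-cong N (term n)) (trans
           (sum-+ N (λ m → D n m + A n m) (B n))
           (cong (_+ Σ[ m < N ] B n m) (sum-+ N (D n) (A n))))) ⟩
    Σ[ n < N ] (Σ[ m < N ] D n m + Σ[ m < N ] A n m + Σ[ m < N ] B n m)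
      ≡⟨ sum-+ N (λ n → Σ[ m < N ] D n m + Σ[ m < N ] A n m) (λ n → Σ[ m < N ] B n m) ⟩
    Σ[ n < N ] (Σ[ m < N ] D n m + Σ[ m < N ] A n m) + Σ[ n < N ] Σ[ m < N ] B n m
      ≡⟨ cong (Σ[ n < N ] (Σ[ m < N ] D n m + Σ[ m < N ] A n m) +_) (trans (sum-swap N N B)
           (sum-cong N λ n → sum-cong N λ m → B-antisym n m)) ⟩
    Σ[ n < N ] (Σ[ m < N ] D n m + Σ[ m < N ] A n m) + Σ[ n < N ] Σ[ m < N ] C n m
      ≡⟨ sum-+ N (λ n → Σ[ m < N ] D n m + Σ[ m < N ] A n m) (λ n → Σ[ m < N ] C n m) ⟨
    Σ[ n < N ] (Σ[ m < N ] D n m + Σ[ m < N ] A n m + Σ[ m < N ] C n m)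
      ≡⟨ sum-cong< N inner ⟩
    Σ[ n < N ] (num (suc p) * (d n (2 ℕ.+ p) * L (suc n))
     + d n (suc p) * (L (suc n) * (L n - L (N ∸ suc n)) + φ N (suc n))) ∎
    where
    A B C D : ℕ → ℕ → ℚ
    D n m = num (suc p) * (d n (2 ℕ.+ p) * L (suc n)) * δ m n
    A n m = d n (suc p) * (L (suc n) * σ n) * (σ m * ρ m n)
    B n m = - (σ n * σ m * L (suc n) * d m (suc p) * ρ m n)
    C n m = d n (suc p) * σ n * (ρ m n * (σ m * L (suc m)))

    term : ∀ n m → σ n * σ m * L (suc n) * K p n m ≡ D n m + A n m + B n m
    term n m = begin
      σ n * σ m * L (suc n) * K p n m
        ≡⟨ cong (σ n * σ m * L (suc n) *_) (K-closed p n m) ⟩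
      σ n * σ m * L (suc n) * ((a - b) * ρ m n + δ m n * (c * e))
        ≡⟨ solve 8 (λ s t l a b r x ce → s :* t :* l :* ((a :- b) :* r :+ x :* ce) :=
             x :* (s :* t) :* (l :* ce) :+ a :* (l :* s) :* (t :* r) :+ :- (s :* t :* l :* b :* r)) refl
             (σ n) (σ m) (L (suc n)) a b (ρ m n) (δ m n) (c * e) ⟩
      δ m n * (σ n * σ m) * (L (suc n) * (c * e)) + A n m + B n m
        ≡⟨ cong (λ x → x * (L (suc n) * (c * e)) + A n m + B n m)
             (trans (δ-subst m n (λ k → σ n * σ k)) (cong (δ m n *_) (σ*σ n))) ⟩
      δ m n * 1ℚ * (L (suc n) * (c * e)) + A n m + B n m
        ≡⟨ cong (λ x → x + A n m + B n m)
             (solve 4 (λ x l c e → x :* con 1ℚ :* (l :* (c :* e)) := c :* (e :* l) :* x) refl (δ m n) (L (suc n)) c e) ⟩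
      D n m + A n m + B n m ∎
      where
      a b c e : ℚ
      a = d n (suc p)
      b = d m (suc p)
      c = num (suc p)
      e = d n (2 ℕ.+ p)

    B-antisym : ∀ n m → B m n ≡ C n m
    B-antisym n m = begin
      - (σ m * σ n * L (suc m) * d n (suc p) * ρ n m)
        ≡⟨ cong (λ x → - (σ m * σ n * L (suc m) * d n (suc p) * x)) (ρ-antisym m n) ⟩
      - (σ m * σ n * L (suc m) * d n (suc p) * - ρ m n)
        ≡⟨ solve 5 (λ t s l a r → :- (t :* s :* l :* a :* :- r) := a :* s :* (r :* (t :* l))) refl
             (σ m) (σ n) (L (suc m)) (d n (suc p)) (ρ m n) ⟩
      C n m ∎

    inner : ∀ n → n ℕ.< N → Σ[ m < N ] D n m + Σ[ m < N ] A n m + Σ[ m < N ] C n m ≡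
      num (suc p) * (d n (2 ℕ.+ p) * L (suc n))
      + d n (suc p) * (L (suc n) * (L n - L (N ∸ suc n)) + φ N (suc n))
    inner n n<N = begin
      Σ[ m < N ] D n m + Σ[ m < N ] A n m + Σ[ m < N ] C n m
        ≡⟨ cong₂ _+_
             (cong₂ _+_
               (trans (sum-*ˡ N c (λ m → δ m n)) (cong (c *_) (sum-δ n<N)))
               (trans (sum-*ˡ N (a * (l * σ n)) (λ m → σ m * ρ m n))
                 (cong (a * (l * σ n) *_) (subst (λ M → Σ[ m < M ] (σ m * ρ m n) ≡ σ n * (L n - L (N ∸ suc n)))
                   N≡ (sum-σρ n (N ∸ suc n))))))
             (sum-*ˡ N (a * σ n) (λ m → ρ m n * (σ m * L (suc m)))) ⟩
      c * 1ℚ + a * (l * σ n) * (σ n * (L n - L (N ∸ suc n))) + a * σ n * R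
        ≡⟨ solve 7 (λ c a l s x y R → c :* con 1ℚ :+ a :* (l :* s) :* (s :* (x :- y)) :+ a :* s :* R :=
             c :+ a :* (s :* s :* (l :* (x :- y)) :+ s :* R)) refl
             c a l (σ n) (L n) (L (N ∸ suc n)) R ⟩
      c + a * (σ n * σ n * (l * (L n - L (N ∸ suc n))) + σ n * R)
        ≡⟨ cong₂ (λ x y → c + a * (x + y))
             (trans (cong (_* (l * (L n - L (N ∸ suc n)))) (σ*σ n)) (*-identityˡ _))
             (sym (φ-shift N n)) ⟩
      c + a * (l * (L n - L (N ∸ suc n)) + φ N (suc n)) ∎
      where
      a c l R : ℚ
      a = d n (suc p)
      c = num (suc p) * (d n (2 ℕ.+ p) * L (suc n))
      l = L (suc n)
      R = Σ[ m < N ] (ρ m n * (σ m * L (suc m)))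
      N≡ : n ℕ.+ suc (N ∸ suc n) ≡ N
      N≡ = trans (ℕ.+-suc n (N ∸ suc n)) (ℕ.m+[n∸m]≡n n<N)

  Z̄ : ℕ → ℕ → ℚ
  Z̄ s n = Σ[ k < n ] (σ k * d k s)

  S S̄ : ℕ → (ℕ → ℚ) → ℕ → ℚ
  S s f N = Σ[ k < N ] (d k s * f (suc k))
  S̄ s f N = Σ[ k < N ] (σ k * d k s * f (suc k))

  L² HL : ℕ → ℚ
  L² n = L n * L n
  HL n = H n * L n

  module Termwise (N : ℕ) where

    infixl 6 _⟨+⟩_

    _⟨+⟩_ : ∀ {f g x y} → sum N f ≡ x → sum N g ≡ y → Σ[ k < N ] (f k + g k) ≡ x + y
    _⟨+⟩_ {f} {g} p q = trans (sum-+ N f g) (cong₂ _+_ p q)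

  -- The price of writing L N for L (N - n - 1), together with the errors of the n + 1 steps that
  -- lead to φ N (n + 1).
  Q-error : ℕ → ℕ → ℚ
  Q-error s N = Σ[ n < N ]
    (d n s * (L (suc n) * (L N - L (N ∸ suc n)) + Σ[ ν < suc n ] φ-error N ν))

  -- The quadratic sum of the theorem arises from L (n + 1) L n = L (n + 1)² - (-1)^n L (n + 1) / (n
  -- + 1), whose last term gives ζ⋆ with p + 2 and 1 both barred. The rest is `φ-closed` weighted
  -- with `d n s`.
  Q-closed : ∀ p N → let s = suc p in
    Q p N ≡ num s * S (suc s) L N + S s L² N + - S̄ (suc s) L N + (- L N) * S s L N
            + - (½ * (L N * L N + Z 2 N)) * Z s N
            + S s L₂ N + - S s HL N + S s ∑uL N + Q-error s N
  Q-closed p N = begin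
    Q p N
      ≡⟨ Q-φ p N ⟩
    Σ[ n < N ]
      (num s * (d n (suc s) * L (suc n)) + d n s * (L (suc n) * (L n - L (N ∸ suc n)) + φ N (suc n)))
      ≡⟨ sum-cong< N (λ n n<N → trans
           (cong (λ x → num s * (d n (suc s) * L (suc n)) + d n s * (L (suc n) * (L n - L (N ∸ suc n)) + x))
             (trans (φ-closed N (suc n) n<N)
               (cong (λ x → x + (L₂ (suc n) - H (suc n) * L (suc n) + ∑uL (suc n)) + Σ[ ν < suc n ] φ-error N ν) (φ-zero N))))
           (term (num s) (σ n) (u n) (d n s) (L n) (L (N ∸ suc n)) (L₂ (suc n)) (H (suc n)) (∑uL (suc n))
             (Σ[ ν < suc n ] φ-error N ν))) ⟩
    Σ[ n < N ]
      (num s * (d n (suc s) * L (suc n)) + d n s * L² (suc n) + - (σ n * d n (suc s) * L (suc n))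
        + (- L N) * (d n s * L (suc n)) + f₀ * d n s + d n s * L₂ (suc n) + - (d n s * HL (suc n))
        + d n s * ∑uL (suc n) + e n)
      ≡⟨ sum-*ˡ N (num s) (λ n → d n (suc s) * L (suc n)) ⟨+⟩ refl ⟨+⟩ sum-neg N (λ n → σ n * d n (suc s) * L (suc n))
           ⟨+⟩ sum-*ˡ N (- L N) (λ n → d n s * L (suc n)) ⟨+⟩ sum-*ˡ N f₀ (λ n → d n s) ⟨+⟩ refl
           ⟨+⟩ sum-neg N (λ n → d n s * HL (suc n)) ⟨+⟩ refl ⟨+⟩ refl ⟩
    num s * S (suc s) L N + S s L² N + - S̄ (suc s) L N + (- L N) * S s L N + f₀ * Z s N
      + S s L₂ N + - S s HL N + S s ∑uL N + Q-error s N ∎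
    where
    open Termwise N
    s : ℕ
    s = suc p
    f₀ : ℚ
    f₀ = - (½ * (L N * L N + Z 2 N))
    e : ℕ → ℚ
    e n = d n s * (L (suc n) * (L N - L (N ∸ suc n)) + Σ[ ν < suc n ] φ-error N ν)
    term : ∀ c t v a l lr l₂ h b E → let l′ = l + t * v in
      c * ((v * a) * l′) + a * (l′ * (l - lr) + (f₀ + (l₂ - h * l′ + b) + E)) ≡
      c * ((v * a) * l′) + a * (l′ * l′) + - (t * (v * a) * l′) + (- L N) * (a * l′) + f₀ * a
        + a * l₂ + - (a * (h * l′)) + a * b + a * (l′ * (L N - lr) + E)
    term c t v a l lr l₂ h b E =
      solve 12 (λ c t v a l lr l₂ h b E f₀ ℓ → let l′ = l :+ t :* v in
        c :* ((v :* a) :* l′) :+ a :* (l′ :* (l :- lr) :+ (f₀ :+ (l₂ :- h :* l′ :+ b) :+ E)) :=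
        c :* ((v :* a) :* l′) :+ a :* (l′ :* l′) :+ :- (t :* (v :* a) :* l′) :+ (:- ℓ) :* (a :* l′) :+ f₀ :* a
          :+ a :* l₂ :+ :- (a :* (h :* l′)) :+ a :* b :+ a :* (l′ :* (ℓ :- lr) :+ E)) refl
        c t v a l lr l₂ h b E f₀ (L N)

  -- The alternating kernel 1 / (k + m) and its inner sum γ.

  σ-+ : ∀ m n → σ (m ℕ.+ n) ≡ σ m * σ n
  σ-+ zero    n = sym (*-identityˡ (σ n))
  σ-+ (suc m) n = trans (cong -_ (σ-+ m n))
    (solve 2 (λ a b → :- (a :* b) := :- a :* b) refl (σ m) (σ n))

  sum-σu-shift : ∀ n M → Σ[ m < M ] (σ m * u (n ℕ.+ m)) ≡ σ n * (L (n ℕ.+ M) - L n)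
  sum-σu-shift n zero    = begin
    0ℚ                      ≡⟨ solve 2 (λ s l → con 0ℚ := s :* (l :- l)) refl (σ n) (L n) ⟩
    σ n * (L n - L n)       ≡⟨ cong (λ k → σ n * (L k - L n)) (ℕ.+-identityʳ n) ⟨
    σ n * (L (n ℕ.+ 0) - L n) ∎
  sum-σu-shift n (suc M) = begin
    Σ[ m < M ] (σ m * u (n ℕ.+ m)) + σ M * u (n ℕ.+ M)
      ≡⟨ cong₂ _+_ (sum-σu-shift n M) (cong (_* u (n ℕ.+ M)) (sym σM)) ⟩
    σ n * (L (n ℕ.+ M) - L n) + σ n * σ (n ℕ.+ M) * u (n ℕ.+ M)
      ≡⟨ solve 5 (λ s t a b v → s :* (a :- b) :+ s :* t :* v := s :* (a :+ t :* v :- b)) refl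
           (σ n) (σ (n ℕ.+ M)) (L (n ℕ.+ M)) (L n) (u (n ℕ.+ M)) ⟩
    σ n * (L (suc (n ℕ.+ M)) - L n)
      ≡⟨ cong (λ k → σ n * (L k - L n)) (ℕ.+-suc n M) ⟨
    σ n * (L (n ℕ.+ suc M) - L n) ∎
    where
    σM : σ n * σ (n ℕ.+ M) ≡ σ M
    σM = begin
      σ n * σ (n ℕ.+ M)    ≡⟨ cong (σ n *_) (σ-+ n M) ⟩
      σ n * (σ n * σ M)    ≡⟨ *-assoc (σ n) (σ n) (σ M) ⟨
      σ n * σ n * σ M      ≡⟨ cong (_* σ M) (σ*σ n) ⟩
      1ℚ * σ M             ≡⟨ *-identityˡ (σ M) ⟩
      σ M                  ∎

  u*v : ∀ k m → u m * u (suc (k ℕ.+ m)) ≡ u k * (u m - u (suc (k ℕ.+ m)))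
  u*v k m = begin
    u m * v                         ≡⟨ solve 3 (λ a b v → b :* v := (a :+ b) :* v :- a :* v) refl (u k) (u m) v ⟩
    (u k + u m) * v - u k * v       ≡⟨ cong (_- u k * v) (u*u k m) ⟨
    u k * u m - u k * v             ≡⟨ solve 3 (λ a b v → a :* b :- a :* v := a :* (b :- v)) refl (u k) (u m) v ⟩
    u k * (u m - v)                 ∎
    where
    v : ℚ
    v = u (suc (k ℕ.+ m))

  sum-σuv : ∀ N n → Σ[ m < N ] (σ m * (u m * u (suc (n ℕ.+ m))))
                    ≡ u n * (L N + σ n * (L (suc n ℕ.+ N) - L (suc n)))
  sum-σuv N n = begin
    Σ[ m < N ] (σ m * (u m * u (suc (n ℕ.+ m))))
      ≡⟨ sum-cong N (λ m → trans (cong (σ m *_) (u*v n m))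
           (solve 4 (λ s a b v → s :* (a :* (b :- v)) := a :* (s :* b) :+ (:- a) :* (s :* v)) refl
             (σ m) (u n) (u m) (u (suc (n ℕ.+ m))))) ⟩
    Σ[ m < N ] (u n * (σ m * u m) + (- u n) * (σ m * u (suc (n ℕ.+ m))))
      ≡⟨ sum-*ˡ N (u n) (λ m → σ m * u m) ⟨+⟩
         trans (sum-*ˡ N (- u n) (λ m → σ m * u (suc (n ℕ.+ m)))) (cong (- u n *_) (sum-σu-shift (suc n) N)) ⟩
    u n * L N + (- u n) * (- σ n * (L (suc n ℕ.+ N) - L (suc n)))
      ≡⟨ solve 4 (λ a b s x → a :* b :+ (:- a) :* ((:- s) :* x) := a :* (b :+ s :* x)) refl
           (u n) (L N) (σ n) (L (suc n ℕ.+ N) - L (suc n)) ⟩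
    u n * (L N + σ n * (L (suc n ℕ.+ N) - L (suc n))) ∎
    where open Termwise N

  -- In unshifted indices, γ N n is (-1)^(n+1) times the sum of (-1)^m H (m − 1) / (m + n)
  -- over 1 ≤ m ≤ N.
  γ : ℕ → ℕ → ℚ
  γ N n = σ n * Σ[ m < N ] (σ m * (H m * u (n ℕ.+ m)))

  -- Shifting m by one replaces H m by H m + u m. The added part is evaluated by `sum-σuv`, and the
  -- new last summand gives the term with H N.
  γ-suc : ∀ N n → γ N (suc n) ≡
    γ N n + H N * (σ (n ℕ.+ N) * u (n ℕ.+ N)) + u n * (σ n * L N + (L (suc n ℕ.+ N) - L (suc n)))
  γ-suc N n = begin
    - σ n * G′
      ≡⟨ cong (- σ n *_) G′≡ ⟩
    - σ n * (- (G + σ N * (H N * v)) - Y)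
      ≡⟨ solve 6 (λ s G t h v Y → :- s :* (:- (G :+ t :* (h :* v)) :- Y) :=
           s :* G :+ h :* (s :* t :* v) :+ s :* Y) refl (σ n) G (σ N) (H N) v Y ⟩
    γ N n + H N * (σ n * σ N * v) + σ n * Y
      ≡⟨ cong₂ (λ x y → γ N n + H N * (x * v) + y) (sym (σ-+ n N)) σY ⟩
    γ N n + H N * (σ (n ℕ.+ N) * v) + u n * (σ n * L N + (L (suc n ℕ.+ N) - L (suc n))) ∎
    where
    open Termwise N
    G G′ Y v : ℚ
    G  = Σ[ m < N ] (σ m * (H m * u (n ℕ.+ m)))
    G′ = Σ[ m < N ] (σ m * (H m * u (suc n ℕ.+ m)))
    Y  = Σ[ m < N ] (σ m * (u m * u (suc (n ℕ.+ m))))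
    v  = u (n ℕ.+ N)
    G′≡ : G′ ≡ - (G + σ N * (H N * v)) - Y
    G′≡ = begin
      G′
        -- The vanishing summand m = 0 is written out, so that `sum-head` can be applied from right
        -- to left.
        ≡⟨ solve 3 (λ a h Y → a := :- (con 1ℚ :* (con 0ℚ :* h) :+ (:- a :+ :- Y)) :- Y) refl G′ (u (n ℕ.+ 0)) Y ⟩
      - (1ℚ * (0ℚ * u (n ℕ.+ 0)) + (- G′ + - Y)) - Y
        ≡⟨ cong (λ x → - (1ℚ * (0ℚ * u (n ℕ.+ 0)) + x) - Y)
             (sum-neg N (λ m → σ m * (H m * u (suc n ℕ.+ m))) ⟨+⟩ sum-neg N (λ m → σ m * (u m * u (suc (n ℕ.+ m))))) ⟨
      - (1ℚ * (0ℚ * u (n ℕ.+ 0)) + Σ[ m < N ] (- (σ m * (H m * u (suc (n ℕ.+ m)))) + - (σ m * (u m * u (suc (n ℕ.+ m)))))) - Y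
        ≡⟨ cong (λ x → - (1ℚ * (0ℚ * u (n ℕ.+ 0)) + x) - Y) (sum-cong N λ m → trans
             (solve 4 (λ s h v w → :- (s :* (h :* w)) :+ :- (s :* (v :* w)) := :- s :* ((h :+ v) :* w)) refl
               (σ m) (H m) (u m) (u (suc (n ℕ.+ m))))
             (cong (λ k → - σ m * (H (suc m) * u k)) (sym (ℕ.+-suc n m)))) ⟩
      - (1ℚ * (0ℚ * u (n ℕ.+ 0)) + Σ[ m < N ] (σ (suc m) * (H (suc m) * u (n ℕ.+ suc m)))) - Y
        ≡⟨ cong (λ x → - x - Y) (sum-head N (λ m → σ m * (H m * u (n ℕ.+ m)))) ⟨
      - (G + σ N * (H N * v)) - Y ∎
    σY : σ n * Y ≡ u n * (σ n * L N + (L (suc n ℕ.+ N) - L (suc n)))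
    σY = begin
      σ n * Y
        ≡⟨ cong (σ n *_) (sum-σuv N n) ⟩
      σ n * (u n * (L N + σ n * (L (suc n ℕ.+ N) - L (suc n))))
        ≡⟨ solve 4 (λ s v l x → s :* (v :* (l :+ s :* x)) := v :* (s :* l :+ s :* s :* x)) refl
             (σ n) (u n) (L N) (L (suc n ℕ.+ N) - L (suc n)) ⟩
      u n * (σ n * L N + σ n * σ n * (L (suc n ℕ.+ N) - L (suc n)))
        ≡⟨ cong (λ x → u n * (σ n * L N + x)) (trans (cong (_* (L (suc n ℕ.+ N) - L (suc n))) (σ*σ n)) (*-identityˡ _)) ⟩
      u n * (σ n * L N + (L (suc n ℕ.+ N) - L (suc n))) ∎

  tail-sum : ℕ → ℕ → ℚ
  tail-sum N n = Σ[ k < n ] (u k * (L (suc k ℕ.+ N) - L N))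

  -- The boundary terms of `γ-suc`, which telescope, and the cost of writing L N for L (k + 1 + N)
  -- in its increments.
  γ-remainder : ℕ → ℕ → ℚ
  γ-remainder N n = H N * (L (n ℕ.+ N) - L N) + tail-sum N n

  γ-closed : ∀ N n → γ N n ≡ γ N 0 + L N * L n + L N * H n - ∑uL n + γ-remainder N n
  γ-closed N zero    = solve 3 (λ g l h → g := g :+ l :* con 0ℚ :+ l :* con 0ℚ :- con 0ℚ :+ (h :* (l :- l) :+ con 0ℚ)) refl
    (γ N 0) (L N) (H N)
  γ-closed N (suc n) = begin
    γ N (suc n)
      ≡⟨ γ-suc N n ⟩
    γ N n + H N * (σ (n ℕ.+ N) * u (n ℕ.+ N)) + u n * (σ n * ℓ + (L (suc n ℕ.+ N) - L (suc n)))
      ≡⟨ cong (λ x → x + H N * (σ (n ℕ.+ N) * u (n ℕ.+ N)) + u n * (σ n * ℓ + (L (suc n ℕ.+ N) - L (suc n)))) (γ-closed N n) ⟩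
    γ N 0 + ℓ * L n + ℓ * H n - ∑uL n + (H N * (L (n ℕ.+ N) - ℓ) + tail-sum N n)
      + H N * (σ (n ℕ.+ N) * u (n ℕ.+ N)) + u n * (σ n * ℓ + (L (suc n ℕ.+ N) - L (suc n)))
      ≡⟨ solve 11 (λ g ℓ l h b hN a t c s v →
           g :+ ℓ :* l :+ ℓ :* h :- b :+ (hN :* (a :- ℓ) :+ t) :+ hN :* c :+ v :* (s :* ℓ :+ (a :+ c :- (l :+ s :* v))) :=
           g :+ ℓ :* (l :+ s :* v) :+ ℓ :* (h :+ v) :- (b :+ v :* (l :+ s :* v))
             :+ (hN :* (a :+ c :- ℓ) :+ (t :+ v :* (a :+ c :- ℓ)))) refl
           (γ N 0) ℓ (L n) (H n) (∑uL n) (H N) (L (n ℕ.+ N)) (tail-sum N n) (σ (n ℕ.+ N) * u (n ℕ.+ N)) (σ n) (u n) ⟩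
    γ N 0 + ℓ * L (suc n) + ℓ * H (suc n) - ∑uL (suc n) + γ-remainder N (suc n) ∎
    where
    ℓ : ℚ
    ℓ = L N

  -- Two evaluations meet here. Summation by parts gives γ N 0 = H N * L N - ∑uL N. Expanding L N *
  -- L N over the square with `u*u`, whose two halves agree by symmetry, gives twice the negative of
  -- that difference, up to `tail-sum`. Eliminating the two quantities that diverge separately
  -- leaves -½ (L N)².
  γ-zero : ∀ N → γ N 0 ≡ - (½ * (L N * L N)) - tail-sum N N
  γ-zero N = begin
    γ N 0
      ≡⟨ solve 6 (λ g h l b l₂ t → g := :- (con ½ :* ((b :- h :* l :- t) :+ (b :- h :* l :- t))) :- t
            :+ (g :- (h :* l :- b))) refl (γ N 0) (H N) ℓ (∑uL N) (L₂ N) t ⟩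
    - (½ * ((∑uL N - H N * ℓ - t) + (∑uL N - H N * ℓ - t))) - t + (γ N 0 - (H N * ℓ - ∑uL N))
      ≡⟨ cong₂ (λ x y → - (½ * x) - t + (y - (H N * ℓ - ∑uL N))) (sym ℓ²) γ₀ ⟩
    - (½ * (ℓ * ℓ)) - t + (H N * ℓ - ∑uL N - (H N * ℓ - ∑uL N))
      ≡⟨ solve 2 (λ x y → x :+ (y :- y) := x) refl (- (½ * (ℓ * ℓ)) - t) (H N * ℓ - ∑uL N) ⟩
    - (½ * (ℓ * ℓ)) - t ∎
    where
    open Termwise N
    ℓ t : ℚ
    ℓ = L N
    t = tail-sum N N

    γ₀ : γ N 0 ≡ H N * ℓ - ∑uL N
    γ₀ = begin
      1ℚ * Σ[ m < N ] (σ m * (H m * u m))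
        ≡⟨ *-identityˡ _ ⟩
      Σ[ m < N ] (σ m * (H m * u m))
        ≡⟨ sum-cong N (λ m → solve 3 (λ s h v →
             s :* (h :* v) := s :* (v :* (h :+ v)) :+ :- (s :* (v :* (v :* con 1ℚ)))) refl (σ m) (H m) (u m)) ⟩
      Σ[ m < N ] (σ m * (u m * H (suc m)) + - (σ m * d m 2))
        ≡⟨ sum-σuH N ⟨+⟩ sum-neg N (λ m → σ m * d m 2) ⟩
      H N * ℓ + L₂ N - ∑uL N + - L₂ N
        ≡⟨ solve 3 (λ a b c → a :+ b :- c :+ :- b := a :- c) refl (H N * ℓ) (L₂ N) (∑uL N) ⟩
      H N * ℓ - ∑uL N ∎

    row : ∀ k → Σ[ m < N ] (σ k * u k * (σ m * u (suc (k ℕ.+ m)))) ≡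
                u k * L (suc k) + (- 1ℚ) * (u k * (L (suc k ℕ.+ N) - ℓ)) + (- ℓ) * u k
    row k = begin
      Σ[ m < N ] (σ k * u k * (σ m * u (suc (k ℕ.+ m))))
        ≡⟨ sum-*ˡ N (σ k * u k) (λ m → σ m * u (suc (k ℕ.+ m))) ⟩
      σ k * u k * Σ[ m < N ] (σ m * u (suc (k ℕ.+ m)))
        ≡⟨ cong (σ k * u k *_) (sum-σu-shift (suc k) N) ⟩
      σ k * u k * (- σ k * (L (suc k ℕ.+ N) - L (suc k)))
        ≡⟨ solve 4 (λ s v x y → s :* v :* (:- s :* (x :- y)) := s :* s :* (v :* (y :- x))) refl
             (σ k) (u k) (L (suc k ℕ.+ N)) (L (suc k)) ⟩
      σ k * σ k * (u k * (L (suc k) - L (suc k ℕ.+ N)))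
        ≡⟨ trans (cong (_* (u k * (L (suc k) - L (suc k ℕ.+ N)))) (σ*σ k)) (*-identityˡ _) ⟩
      u k * (L (suc k) - L (suc k ℕ.+ N))
        ≡⟨ solve 4 (λ v x y l → v :* (y :- x) := v :* y :+ (:- con 1ℚ) :* (v :* (x :- l)) :+ (:- l) :* v) refl
             (u k) (L (suc k ℕ.+ N)) (L (suc k)) ℓ ⟩
      u k * L (suc k) + (- 1ℚ) * (u k * (L (suc k ℕ.+ N) - ℓ)) + (- ℓ) * u k ∎

    rows : Σ[ k < N ] Σ[ m < N ] (σ k * u k * (σ m * u (suc (k ℕ.+ m)))) ≡ ∑uL N - H N * ℓ - t
    rows = begin
      Σ[ k < N ] Σ[ m < N ] (σ k * u k * (σ m * u (suc (k ℕ.+ m))))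
        ≡⟨ sum-cong N row ⟩
      Σ[ k < N ] (u k * L (suc k) + (- 1ℚ) * (u k * (L (suc k ℕ.+ N) - ℓ)) + (- ℓ) * u k)
        ≡⟨ refl ⟨+⟩ sum-*ˡ N (- 1ℚ) (λ k → u k * (L (suc k ℕ.+ N) - ℓ)) ⟨+⟩ sum-*ˡ N (- ℓ) u ⟩
      ∑uL N + (- 1ℚ) * t + (- ℓ) * H N
        ≡⟨ solve 4 (λ b t l h → b :+ (:- con 1ℚ) :* t :+ (:- l) :* h := b :- h :* l :- t) refl (∑uL N) t ℓ (H N) ⟩
      ∑uL N - H N * ℓ - t ∎

    ℓ² : ℓ * ℓ ≡ (∑uL N - H N * ℓ - t) + (∑uL N - H N * ℓ - t)
    ℓ² = begin
      ℓ * ℓ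
        ≡⟨ sum-* N N (λ k → σ k * u k) (λ m → σ m * u m) ⟩
      Σ[ k < N ] Σ[ m < N ] (σ k * u k * (σ m * u m))
        ≡⟨ sum-cong N (λ k → trans (sum-cong N λ m → trans
             (solve 4 (λ s a t b → s :* a :* (t :* b) := s :* t :* (a :* b)) refl (σ k) (u k) (σ m) (u m))
             (trans (cong (σ k * σ m *_) (u*u k m))
             (solve 5 (λ s t a b v → s :* t :* ((a :+ b) :* v) := s :* a :* (t :* v) :+ t :* b :* (s :* v)) refl
               (σ k) (σ m) (u k) (u m) (u (suc (k ℕ.+ m))))))
             (sum-+ N _ _)) ⟩
      Σ[ k < N ] (Σ[ m < N ] (σ k * u k * (σ m * u (suc (k ℕ.+ m)))) + Σ[ m < N ] (σ m * u m * (σ k * u (suc (k ℕ.+ m)))))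
        ≡⟨ rows ⟨+⟩ trans (sum-swap N N (λ k m → σ m * u m * (σ k * u (suc (k ℕ.+ m)))))
             (trans (sum-cong N λ m → sum-cong N λ k → cong (λ i → σ m * u m * (σ k * u (suc i))) (ℕ.+-comm k m)) rows) ⟩
      (∑uL N - H N * ℓ - t) + (∑uL N - H N * ℓ - t) ∎

  -- The products ζ̄(p + 1 - i) with ζ⋆ and ζ̄.

  K̄ : ℕ → ℕ → ℕ → ℚ
  K̄ q k m = Σ[ i < q ] (σ i * (d k (suc (q ∸ i)) * d m (2 ℕ.+ i)))

  -- Consecutive terms have ratio -(k + 1)/(m + 1), so the geometric sum has the denominator k + m +
  -- 2. It is never zero, and no diagonal has to be treated apart.
  K̄-closed : ∀ q k m →
    K̄ q k m ≡ (d k (suc q) * u m - σ q * (u k * d m (suc q))) * u (suc (k ℕ.+ m))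
  K̄-closed zero    k m = solve 3 (λ a b v → con 0ℚ := (a :* con 1ℚ :* b :- con 1ℚ :* (a :* (b :* con 1ℚ))) :* v) refl
    (u k) (u m) (u (suc (k ℕ.+ m)))
  K̄-closed (suc q) k m = begin
    K̄ (suc q) k m
      ≡⟨ cong₂ _+_
           (trans (sum-cong< q λ i i<q → trans
             (cong (λ j → σ i * (d k (suc j) * d m (2 ℕ.+ i))) (ℕ.+-∸-assoc 1 (ℕ.<⇒≤ i<q)))
             (solve 4 (λ s a b c → s :* (a :* b :* c) := a :* (s :* (b :* c))) refl
               (σ i) (u k) (d k (suc (q ∸ i))) (d m (2 ℕ.+ i))))
             (sum-*ˡ q (u k) (λ i → σ i * (d k (suc (q ∸ i)) * d m (2 ℕ.+ i)))))
           (cong (λ j → σ q * (d k (suc j) * d m (2 ℕ.+ q))) (ℕ.m+n∸n≡m 1 q)) ⟩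
    u k * K̄ q k m + σ q * (d k 2 * d m (2 ℕ.+ q))
      ≡⟨ cong (λ x → u k * x + σ q * (d k 2 * d m (2 ℕ.+ q))) (K̄-closed q k m) ⟩
    u k * ((a * u m - σ q * (u k * b)) * v) + σ q * ((u k * (u k * 1ℚ)) * (u m * b))
      ≡⟨ solve 6 (λ x y a s b v →
           x :* ((a :* y :- s :* (x :* b)) :* v) :+ s :* ((x :* (x :* con 1ℚ)) :* (y :* b)) :=
           x :* (a :* y) :* v :+ s :* x :* b :* (x :* y :- x :* v)) refl (u k) (u m) a (σ q) b v ⟩
    u k * (a * u m) * v + σ q * u k * b * (u k * u m - u k * v)
      ≡⟨ cong (λ x → u k * (a * u m) * v + σ q * u k * b * (x - u k * v)) (u*u k m) ⟩
    u k * (a * u m) * v + σ q * u k * b * ((u k + u m) * v - u k * v)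
      ≡⟨ solve 6 (λ x y a s b v →
           x :* (a :* y) :* v :+ s :* x :* b :* ((x :+ y) :* v :- x :* v) :=
           (x :* a :* y :- :- s :* (x :* (y :* b))) :* v) refl (u k) (u m) a (σ q) b v ⟩
    (u k * a * u m - - σ q * (u k * (u m * b))) * v ∎
    where
    a b v : ℚ
    a = d k (suc q)
    b = d m (suc q)
    v = u (suc (k ℕ.+ m))

  -- `H m` stops one below the summation variable m + 1. With H m = H (m + 1) - u m the inner sum is
  -- the truncation of -(ζ⋆(i + 1 barred, 1) + ζ̄(i + 2)) at the unshifted i, so the last two finite
  -- sums of the theorem combine into W.
  W : ℕ → ℕ → ℚ
  W q N = Σ[ i < q ] (σ i * (Z̄ (suc (q ∸ i)) N * Σ[ m < N ] (σ m * d m (2 ℕ.+ i) * H m)))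

  W-error γ-error : ℕ → ℕ → ℚ
  W-error s N = Σ[ m < N ] (H m * d m s * (L (suc m ℕ.+ N) - L N))
  γ-error s N = Σ[ k < N ] (d k s * γ-remainder N (suc k))

  W-kernel : ∀ q N → W q N ≡ Σ[ k < N ] Σ[ m < N ] (σ k * σ m * H m * K̄ q k m)
  W-kernel q N = begin
    W q N
      ≡⟨ sum-cong q (λ i → trans
           (cong (σ i *_) (sum-* N N (λ k → σ k * d k (suc (q ∸ i))) (λ m → σ m * d m (2 ℕ.+ i) * H m)))
           (trans (sym (sum-*ˡ N (σ i) _)) (sum-cong N λ k → sym (sum-*ˡ N (σ i) _)))) ⟩
    Σ[ i < q ] Σ[ k < N ] Σ[ m < N ] (σ i * ((σ k * d k (suc (q ∸ i))) * (σ m * d m (2 ℕ.+ i) * H m)))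
      ≡⟨ sum-swap₃ q N N (λ i k m → σ i * ((σ k * d k (suc (q ∸ i))) * (σ m * d m (2 ℕ.+ i) * H m))) ⟩
    Σ[ k < N ] Σ[ m < N ] Σ[ i < q ] (σ i * ((σ k * d k (suc (q ∸ i))) * (σ m * d m (2 ℕ.+ i) * H m)))
      ≡⟨ sum-cong N (λ k → sum-cong N λ m → trans
           (sum-cong q λ i →
             solve 6 (λ r s a t b h → r :* (s :* a :* (t :* b :* h)) := s :* t :* h :* (r :* (a :* b))) refl
               (σ i) (σ k) (d k (suc (q ∸ i))) (σ m) (d m (2 ℕ.+ i)) (H m))
           (sum-*ˡ q (σ k * σ m * H m) (λ i → σ i * (d k (suc (q ∸ i)) * d m (2 ℕ.+ i))))) ⟩
    Σ[ k < N ] Σ[ m < N ] (σ k * σ m * H m * K̄ q k m) ∎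

  -- The part A is summed over m first, where `u*v` turns the kernel into γ N 0 and γ N (k + 1). The
  -- part B is summed over k first, which `sum-σuv` does outright. B contributes the coefficient
  -- (-1)^(p-1) of the sum with H L; the -1 beside it is due to `Q-closed`.
  W-closed : ∀ q N → let s = 2 ℕ.+ q in
    W q N ≡
      (γ N 0 * Z̄ s N + (γ N 0 * Z s N + L N * S s L N + L N * S s H N + - S s ∑uL N + γ-error s N))
      + (- σ q) * (L N * (S̄ s H N + - Z̄ (suc s) N) + L N * (S s H N + - Z (suc s) N)
                   + - (S s HL N + - S (suc s) L N) + W-error s N)
  W-closed q N = begin
    W q N
      ≡⟨ W-kernel q N ⟩
    Σ[ k < N ] Σ[ m < N ] (σ k * σ m * H m * K̄ q k m)
      ≡⟨ sum-cong N (λ k → trans (sum-cong N (split k)) (sum-+ N (A k) (B k))) ⟩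
    Σ[ k < N ] (Σ[ m < N ] A k m + Σ[ m < N ] B k m)
      ≡⟨ trans (sum-cong N A-row) A-total ⟨+⟩
         trans (sum-swap N N B) (trans (sum-cong N B-column) (trans (sum-*ˡ N (- σ q) _) (cong (- σ q *_) B-total))) ⟩
    (γ N 0 * Z̄ s N + (γ N 0 * Z s N + ℓ * S s L N + ℓ * S s H N + - S s ∑uL N + γ-error s N))
      + (- σ q) * (ℓ * (S̄ s H N + - Z̄ (suc s) N) + ℓ * (S s H N + - Z (suc s) N)
                   + - (S s HL N + - S (suc s) L N) + W-error s N) ∎
    where
    open Termwise N
    s : ℕ
    s = 2 ℕ.+ q
    ℓ : ℚ
    ℓ = L N
    A B : ℕ → ℕ → ℚ
    A k m = σ k * d k (suc q) * (σ m * (H m * (u m * u (suc (k ℕ.+ m)))))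
    B k m = (- σ q) * ((H m * d m (suc q) * σ m) * (σ k * (u k * u (suc (m ℕ.+ k)))))

    split : ∀ k m → σ k * σ m * H m * K̄ q k m ≡ A k m + B k m
    split k m = begin
      σ k * σ m * H m * K̄ q k m
        ≡⟨ cong (σ k * σ m * H m *_) (K̄-closed q k m) ⟩
      σ k * σ m * H m * ((d k (suc q) * u m - σ q * (u k * d m (suc q))) * u (suc (k ℕ.+ m)))
        ≡⟨ solve 9 (λ s t h a y r x b v →
             s :* t :* h :* ((a :* y :- r :* (x :* b)) :* v) :=
             s :* a :* (t :* (h :* (y :* v))) :+ (:- r) :* ((h :* b :* t) :* (s :* (x :* v)))) refl
             (σ k) (σ m) (H m) (d k (suc q)) (u m) (σ q) (u k) (d m (suc q)) (u (suc (k ℕ.+ m))) ⟩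
      A k m + (- σ q) * ((H m * d m (suc q) * σ m) * (σ k * (u k * u (suc (k ℕ.+ m)))))
        ≡⟨ cong (λ i → A k m + (- σ q) * ((H m * d m (suc q) * σ m) * (σ k * (u k * u (suc i))))) (ℕ.+-comm k m) ⟩
      A k m + B k m ∎

    A-row : ∀ k → Σ[ m < N ] A k m ≡ σ k * d k s * γ N 0 + d k s * γ N (suc k)
    A-row k = begin
      Σ[ m < N ] A k m
        ≡⟨ sum-*ˡ N (σ k * d k (suc q)) (λ m → σ m * (H m * (u m * u (suc (k ℕ.+ m))))) ⟩
      σ k * d k (suc q) * Σ[ m < N ] (σ m * (H m * (u m * u (suc (k ℕ.+ m)))))
        ≡⟨ cong (σ k * d k (suc q) *_) (sum-cong N λ m → trans
             (cong (λ x → σ m * (H m * x)) (u*v k m))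
             (solve 5 (λ t h x y v → t :* (h :* (x :* (y :- v))) := x :* (t :* (h :* y)) :+ (:- x) :* (t :* (h :* v))) refl
               (σ m) (H m) (u k) (u m) (u (suc (k ℕ.+ m))))) ⟩
      σ k * d k (suc q) * Σ[ m < N ] (u k * (σ m * (H m * u m)) + (- u k) * (σ m * (H m * u (suc (k ℕ.+ m)))))
        ≡⟨ cong (σ k * d k (suc q) *_) (sum-*ˡ N (u k) (λ m → σ m * (H m * u m)) ⟨+⟩
             sum-*ˡ N (- u k) (λ m → σ m * (H m * u (suc (k ℕ.+ m))))) ⟩
      σ k * d k (suc q) * (u k * g + (- u k) * g′)
        ≡⟨ solve 5 (λ s a x g g′ → s :* a :* (x :* g :+ (:- x) :* g′) :=
             s :* (x :* a) :* (con 1ℚ :* g) :+ (x :* a) :* (:- s :* g′)) refl (σ k) (d k (suc q)) (u k) g g′ ⟩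
      σ k * d k s * γ N 0 + d k s * γ N (suc k) ∎
      where
      g g′ : ℚ
      g  = Σ[ m < N ] (σ m * (H m * u m))
      g′ = Σ[ m < N ] (σ m * (H m * u (suc (k ℕ.+ m))))

    A-total : Σ[ k < N ] (σ k * d k s * γ N 0 + d k s * γ N (suc k)) ≡
      γ N 0 * Z̄ s N + (γ N 0 * Z s N + ℓ * S s L N + ℓ * S s H N + - S s ∑uL N + γ-error s N)
    A-total = begin
      Σ[ k < N ] (σ k * d k s * γ N 0 + d k s * γ N (suc k))
        ≡⟨ sum-cong N (λ k → cong₂ _+_ (*-comm (σ k * d k s) (γ N 0)) (trans
             (cong (d k s *_) (γ-closed N (suc k)))
             (solve 7 (λ a g l x h b e → a :* (g :+ l :* x :+ l :* h :- b :+ e) :=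
               g :* a :+ l :* (a :* x) :+ l :* (a :* h) :+ :- (a :* b) :+ a :* e) refl
               (d k s) (γ N 0) ℓ (L (suc k)) (H (suc k)) (∑uL (suc k)) (γ-remainder N (suc k))))) ⟩
      Σ[ k < N ] (γ N 0 * (σ k * d k s) + (γ N 0 * d k s + ℓ * (d k s * L (suc k)) + ℓ * (d k s * H (suc k))
        + - (d k s * ∑uL (suc k)) + d k s * γ-remainder N (suc k)))
        ≡⟨ sum-*ˡ N (γ N 0) (λ k → σ k * d k s) ⟨+⟩
           (sum-*ˡ N (γ N 0) (λ k → d k s) ⟨+⟩ sum-*ˡ N ℓ (λ k → d k s * L (suc k)) ⟨+⟩ sum-*ˡ N ℓ (λ k → d k s * H (suc k))
             ⟨+⟩ sum-neg N (λ k → d k s * ∑uL (suc k)) ⟨+⟩ refl) ⟩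
      γ N 0 * Z̄ s N + (γ N 0 * Z s N + ℓ * S s L N + ℓ * S s H N + - S s ∑uL N + γ-error s N) ∎

    B-column : ∀ m → Σ[ k < N ] B k m ≡
      (- σ q) * (H m * d m s * (σ m * ℓ + (L (suc m ℕ.+ N) - L (suc m))))
    B-column m = begin
      Σ[ k < N ] B k m
        ≡⟨ trans (sum-*ˡ N (- σ q) _) (cong (- σ q *_) (trans
             (sum-*ˡ N (H m * d m (suc q) * σ m) (λ k → σ k * (u k * u (suc (m ℕ.+ k)))))
             (cong (H m * d m (suc q) * σ m *_) (sum-σuv N m)))) ⟩
      (- σ q) * (H m * d m (suc q) * σ m * (u m * (ℓ + σ m * x)))
        ≡⟨ cong (- σ q *_) (solve 6 (λ h a t v l x →
             h :* a :* t :* (v :* (l :+ t :* x)) := h :* (v :* a) :* (t :* l :+ t :* t :* x)) refl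
             (H m) (d m (suc q)) (σ m) (u m) ℓ x) ⟩
      (- σ q) * (H m * d m s * (σ m * ℓ + σ m * σ m * x))
        ≡⟨ cong (λ y → (- σ q) * (H m * d m s * (σ m * ℓ + y))) (trans (cong (_* x) (σ*σ m)) (*-identityˡ x)) ⟩
      (- σ q) * (H m * d m s * (σ m * ℓ + x)) ∎
      where
      x : ℚ
      x = L (suc m ℕ.+ N) - L (suc m)

    B-total : Σ[ m < N ] (H m * d m s * (σ m * ℓ + (L (suc m ℕ.+ N) - L (suc m)))) ≡
      ℓ * (S̄ s H N + - Z̄ (suc s) N) + ℓ * (S s H N + - Z (suc s) N) + - (S s HL N + - S (suc s) L N) + W-error s N
    B-total = begin
      Σ[ m < N ] (H m * d m s * (σ m * ℓ + (L (suc m ℕ.+ N) - L (suc m))))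
        ≡⟨ sum-cong N (λ m → solve 7 (λ h v a t l y x →
             h :* a :* (t :* l :+ (x :- y)) :=
             l :* (t :* a :* (h :+ v) :+ :- (t :* (v :* a))) :+ l :* (a :* (h :+ v) :+ :- (v :* a))
               :+ :- (a :* ((h :+ v) :* y) :+ :- (v :* a :* y)) :+ h :* a :* (x :- l)) refl
             (H m) (u m) (d m s) (σ m) ℓ (L (suc m)) (L (suc m ℕ.+ N))) ⟩
      Σ[ m < N ] (ℓ * (σ m * d m s * H (suc m) + - (σ m * d m (suc s))) + ℓ * (d m s * H (suc m) + - d m (suc s))
        + - (d m s * HL (suc m) + - (d m (suc s) * L (suc m))) + H m * d m s * (L (suc m ℕ.+ N) - ℓ))
        ≡⟨ trans (sum-*ˡ N ℓ _) (cong (ℓ *_) (refl ⟨+⟩ sum-neg N (λ m → σ m * d m (suc s)))) ⟨+⟩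
           trans (sum-*ˡ N ℓ _) (cong (ℓ *_) (refl ⟨+⟩ sum-neg N (λ m → d m (suc s)))) ⟨+⟩
           trans (sum-neg N _) (cong -_ (refl ⟨+⟩ sum-neg N (λ m → d m (suc s) * L (suc m)))) ⟨+⟩ refl ⟩
      ℓ * (S̄ s H N + - Z̄ (suc s) N) + ℓ * (S s H N + - Z (suc s) N) + - (S s HL N + - S (suc s) L N) + W-error s N ∎

  W₁ W₂ : ℕ → ℕ → ℚ
  W₁ q N = Σ[ i < q ] (σ i * Z̄ (suc (q ∸ i)) N * - S̄ (2 ℕ.+ i) H N)
  W₂ q N = Σ[ i < q ] (σ i * Z̄ (suc (q ∸ i)) N * Z̄ (3 ℕ.+ i) N)

  W₁+W₂ : ∀ q N → W₁ q N + W₂ q N ≡ - W q N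
  W₁+W₂ q N = begin
    W₁ q N + W₂ q N
      ≡⟨ sum-+ q (λ i → σ i * Z̄ (suc (q ∸ i)) N * - S̄ (2 ℕ.+ i) H N) (λ i → σ i * Z̄ (suc (q ∸ i)) N * Z̄ (3 ℕ.+ i) N) ⟨
    Σ[ i < q ] (σ i * Z̄ (suc (q ∸ i)) N * - S̄ (2 ℕ.+ i) H N + σ i * Z̄ (suc (q ∸ i)) N * Z̄ (3 ℕ.+ i) N)
      ≡⟨ sum-cong q (λ i → trans
           (solve 4 (λ s z a b → s :* z :* :- a :+ s :* z :* b := :- (s :* (z :* (a :+ :- b)))) refl
             (σ i) (Z̄ (suc (q ∸ i)) N) (S̄ (2 ℕ.+ i) H N) (Z̄ (3 ℕ.+ i) N))
           (cong (λ x → - (σ i * (Z̄ (suc (q ∸ i)) N * x))) (H-split i))) ⟩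
    Σ[ i < q ] (- (σ i * (Z̄ (suc (q ∸ i)) N * Σ[ m < N ] (σ m * d m (2 ℕ.+ i) * H m))))
      ≡⟨ sum-neg q (λ i → σ i * (Z̄ (suc (q ∸ i)) N * Σ[ m < N ] (σ m * d m (2 ℕ.+ i) * H m))) ⟩
    - W q N ∎
    where
    open Termwise N
    H-split : ∀ i → S̄ (2 ℕ.+ i) H N + - Z̄ (3 ℕ.+ i) N ≡ Σ[ m < N ] (σ m * d m (2 ℕ.+ i) * H m)
    H-split i = trans (sym (refl ⟨+⟩ sum-neg N (λ m → σ m * d m (3 ℕ.+ i)))) (sum-cong N λ m →
      solve 4 (λ s v a h → s :* a :* (h :+ v) :+ :- (s :* (v :* a)) := s :* a :* h) refl (σ m) (u m) (d m (2 ℕ.+ i)) (H m))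

  -- The identity at a finite truncation.

  lhs rhs error : ℕ → ℕ → ℚ
  lhs q N = let p = suc q; s = suc p in
    S s L² N + (σ q - num 1) * S s HL N
  rhs q N = let p = suc q; s = suc p in
    - S s L₂ N
    - L N * - S s L N
    + S̄ (suc s) L N
    + ½ * Z 2 N * Z s N
    + Q p N
    + (num s + σ p) * - S (suc s) L N
    + ½ * (L N * L N) * (num 2 * Z s N + Z̄ s N)
    + L N * σ q * (S s H N - - S̄ s H N)
    - W₁ q N
    - L N * (S s H N - - S s L N)
    - W₂ q N
    - L N * σ q * (Z (suc s) N + Z̄ (suc s) N)
  error q N = let s = 2 ℕ.+ q in
    (Z s N + Z̄ s N) * tail-sum N N + (σ q * W-error s N + (- Q-error s N + - γ-error s N))

  -- `lhs` and `rhs` copy the theorem at p = q + 1 with L N in the place of ln 2, in the shape that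
  -- the rules for `⇝` build. Once the closed forms are inserted, the equation is one between
  -- polynomials in the remaining sums.
  truncated-identity : ∀ q N → lhs q N - rhs q N ≡ error q N
  truncated-identity q N = begin
    lhs q N - rhs q N
      -- `W₁` and `W₂` are gathered first, because `W-closed` evaluates only their sum.
      ≡⟨ solve 21 (λ A B S₂ S₁ Sb Z₂ Zs Zb T SH SHb W₁ W₂ Z⁺ Zb⁺ ℓ ε c Q n₁ n₂ →
           A :+ (ε :- n₁) :* B :-
           (:- S₂ :- ℓ :* :- S₁ :+ Sb :+ con ½ :* Z₂ :* Zs :+ Q :+ (c :+ :- ε) :* :- T
             :+ con ½ :* (ℓ :* ℓ) :* (n₂ :* Zs :+ Zb) :+ ℓ :* ε :* (SH :- :- SHb) :- W₁ :- ℓ :* (SH :- :- S₁)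
             :- W₂ :- ℓ :* ε :* (Z⁺ :+ Zb⁺)) :=
           A :+ (ε :- n₁) :* B :-
           (:- S₂ :- ℓ :* :- S₁ :+ Sb :+ con ½ :* Z₂ :* Zs :+ Q :+ (c :+ :- ε) :* :- T
             :+ con ½ :* (ℓ :* ℓ) :* (n₂ :* Zs :+ Zb) :+ ℓ :* ε :* (SH :- :- SHb) :- ℓ :* (SH :- :- S₁)
             :- ℓ :* ε :* (Z⁺ :+ Zb⁺)) :+ (W₁ :+ W₂)) refl
           (S s L² N) (S s HL N) (S s L₂ N) (S s L N) (S̄ (suc s) L N) (Z 2 N) (Z s N) (Z̄ s N) (S (suc s) L N)
           (S s H N) (S̄ s H N) (W₁ q N) (W₂ q N) (Z (suc s) N) (Z̄ (suc s) N) (L N) (σ q) (num s) (Q p N) (num 1) (num 2) ⟩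
    rest (Q p N) + (W₁ q N + W₂ q N)
      ≡⟨ cong₂ (λ x y → rest x + y) (Q-closed p N) (trans (W₁+W₂ q N) (cong -_ (trans (W-closed q N) (cong W-of (γ-zero N))))) ⟩
    rest _ + - W-of (- (½ * (L N * L N)) - tail-sum N N)
      ≡⟨ solve 21 (λ A B D S₂ S₁ Sb Z₂ Zs Zb T SH SHb Z⁺ Zb⁺ ℓ ε c t E F G →
           A :+ (ε :- (con 1ℚ :+ con 0ℚ)) :* B :-
           (:- S₂ :- ℓ :* :- S₁ :+ Sb :+ con ½ :* Z₂ :* Zs
             :+ (c :* T :+ A :+ :- Sb :+ (:- ℓ) :* S₁ :+ (:- (con ½ :* (ℓ :* ℓ :+ Z₂))) :* Zs :+ S₂ :+ :- B :+ D :+ E)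
             :+ (c :+ :- ε) :* :- T
             :+ con ½ :* (ℓ :* ℓ) :* ((con 1ℚ :+ (con 1ℚ :+ con 0ℚ)) :* Zs :+ Zb) :+ ℓ :* ε :* (SH :- :- SHb) :- ℓ :* (SH :- :- S₁)
             :- ℓ :* ε :* (Z⁺ :+ Zb⁺))
           :+ :- (((:- (con ½ :* (ℓ :* ℓ)) :- t) :* Zb
               :+ ((:- (con ½ :* (ℓ :* ℓ)) :- t) :* Zs :+ ℓ :* S₁ :+ ℓ :* SH :+ :- D :+ F))
             :+ (:- ε) :* (ℓ :* (SHb :+ :- Zb⁺) :+ ℓ :* (SH :+ :- Z⁺) :+ :- (B :+ :- T) :+ G)) :=
           (Zs :+ Zb) :* t :+ (ε :* G :+ (:- E :+ :- F))) refl
           (S s L² N) (S s HL N) (S s ∑uL N) (S s L₂ N) (S s L N) (S̄ (suc s) L N) (Z 2 N) (Z s N) (Z̄ s N) (S (suc s) L N)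
           (S s H N) (S̄ s H N) (Z (suc s) N) (Z̄ (suc s) N) (L N) (σ q) (num s) (tail-sum N N)
           (Q-error s N) (γ-error s N) (W-error s N) ⟩
    error q N ∎
    where
    p s : ℕ
    p = suc q
    s = suc p
    rest W-of : ℚ → ℚ
    rest x =
      S s L² N + (σ q - num 1) * S s HL N
      - (- S s L₂ N - L N * - S s L N + S̄ (suc s) L N + ½ * Z 2 N * Z s N + x + (num s + σ p) * - S (suc s) L N
         + ½ * (L N * L N) * (num 2 * Z s N + Z̄ s N) + L N * σ q * (S s H N - - S̄ s H N)
         - L N * (S s H N - - S s L N) - L N * σ q * (Z (suc s) N + Z̄ (suc s) N))
    W-of x =
      (x * Z̄ s N + (x * Z s N + L N * S s L N + L N * S s H N + - S s ∑uL N + γ-error s N))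
      + (- σ q) * (L N * (S̄ s H N + - Z̄ (suc s) N) + L N * (S s H N + - Z (suc s) N)
                   + - (S s HL N + - S (suc s) L N) + W-error s N)

-- Bounds for the remainders.

module Estimates where

  open ℝ using (module CauchyProperties)
  open Sums
  open Identities

  private
    variable
      w x y z : ℚ

  opaque
    unfolding _+_ u
    +-mono : x ≤ y → w ≤ z → x + w ≤ y + z
    +-mono = ℚ.+-mono-≤

    *-mono : 0ℚ ≤ x → 0ℚ ≤ z → x ≤ y → w ≤ z → x * w ≤ y * z
    *-mono = CauchyProperties.*-mono

    0≤* : 0ℚ ≤ x → 0ℚ ≤ y → 0ℚ ≤ x * y
    0≤* = CauchyProperties.0≤-*

    -≤⇒0≤ : x ≤ y → 0ℚ ≤ y - x
    -≤⇒0≤ = CauchyProperties.-≤⇒0≤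

    0≤∣_∣ : ∀ x → 0ℚ ≤ ∣ x ∣
    0≤∣_∣ = ℚ.0≤∣p∣

    0≤⇒∣∣ : 0ℚ ≤ x → ∣ x ∣ ≡ x
    0≤⇒∣∣ = ℚ.0≤p⇒∣p∣≡p

    ∣+∣ : ∀ x y → ∣ x + y ∣ ≤ ∣ x ∣ + ∣ y ∣
    ∣+∣ = ℚ.∣p+q∣≤∣p∣+∣q∣

    ∣*∣ : ∀ x y → ∣ x * y ∣ ≡ ∣ x ∣ * ∣ y ∣
    ∣*∣ = ℚ.∣p*q∣≡∣p∣*∣q∣

    ∣-∣ : ∀ x → ∣ - x ∣ ≡ ∣ x ∣
    ∣-∣ = ℚ.∣-p∣≡∣p∣

    0≤u : ∀ k → 0ℚ ≤ u k
    0≤u = CauchyProperties.0≤u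

    u≤1 : ∀ k → u k ≤ 1ℚ
    u≤1 = CauchyProperties.u≤1

    u-antitone : ∀ {m n} → m ℕ.≤ n → u n ≤ u m
    u-antitone m≤n = CauchyProperties.u-mono (ℕ.≤⇒≤′ m≤n)

    0≤1 : 0ℚ ≤ 1ℚ
    0≤1 = CauchyProperties.0≤1

  open ℚ.≤-Reasoning

  +-mono-∣∣ : ∀ x y → ∣ x ∣ ≤ w → ∣ y ∣ ≤ z → ∣ x + y ∣ ≤ w + z
  +-mono-∣∣ x y p q = ℚ.≤-trans (∣+∣ x y) (+-mono p q)

  *-mono-∣∣ : ∀ x y → ∣ x ∣ ≤ w → ∣ y ∣ ≤ z → ∣ x * y ∣ ≤ w * z
  *-mono-∣∣ x y p q = ℚ.≤-trans (ℚ.≤-reflexive (∣*∣ x y))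
    (*-mono 0≤∣ x ∣ (ℚ.≤-trans 0≤∣ y ∣ q) p q)

  ∣σ*∣ : ∀ n x → ∣ σ n * x ∣ ≡ ∣ x ∣
  ∣σ*∣ zero    x = cong ∣_∣ (*-identityˡ x)
  ∣σ*∣ (suc n) x = trans (cong ∣_∣ (solve 2 (λ s x → :- s :* x := :- (s :* x)) refl (σ n) x))
    (trans (∣-∣ (σ n * x)) (∣σ*∣ n x))

  sum-mono : ∀ N {f g : ℕ → ℚ} → (∀ k → k ℕ.< N → f k ≤ g k) → sum N f ≤ sum N g
  sum-mono zero    p = ℚ.≤-refl
  sum-mono (suc N) p = +-mono (sum-mono N (λ k k<N → p k (ℕ.m≤n⇒m≤1+n k<N))) (p N ℕ.≤-refl)

  ∣sum∣ : ∀ N {f g : ℕ → ℚ} → (∀ k → k ℕ.< N → ∣ f k ∣ ≤ g k) → ∣ sum N f ∣ ≤ sum N g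
  ∣sum∣ zero    p = ℚ.≤-reflexive (0≤⇒∣∣ ℚ.≤-refl)
  ∣sum∣ (suc N) {f} p = +-mono-∣∣ (sum N f) (f N) (∣sum∣ N (λ k k<N → p k (ℕ.m≤n⇒m≤1+n k<N))) (p N ℕ.≤-refl)

  sum-const : ∀ N c → Σ[ k < N ] c ≡ num N * c
  sum-const zero    c = sym (zeroˡ c)
  sum-const (suc N) c = trans (cong (_+ c) (sum-const N c))
    (solve 2 (λ a c → a :* c :+ c := (con 1ℚ :+ a) :* c) refl (num N) c)

  sum-reverse : ∀ N f → Σ[ k < N ] f (N ∸ suc k) ≡ sum N f
  sum-reverse zero    f = refl
  sum-reverse (suc N) f = trans (sum-head N (λ k → f (N ∸ k)))
    (trans (cong (f N +_) (sum-reverse N f)) (+-comm (f N) (sum N f)))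

  0≤num : ∀ n → 0ℚ ≤ num n
  0≤num zero    = ℚ.≤-refl
  0≤num (suc n) = ℚ.≤-trans (ℚ.≤-reflexive (sym (+-identityˡ 0ℚ))) (+-mono 0≤1 (0≤num n))

  0≤d : ∀ k s → 0ℚ ≤ d k s
  0≤d k zero    = 0≤1
  0≤d k (suc s) = 0≤* (0≤u k) (0≤d k s)

  d≤1 : ∀ k s → d k s ≤ 1ℚ
  d≤1 k zero    = ℚ.≤-refl
  d≤1 k (suc s) = ℚ.≤-trans (*-mono (0≤u k) 0≤1 (u≤1 k) (d≤1 k s)) (ℚ.≤-reflexive (*-identityˡ 1ℚ))

  0≤H : ∀ n → 0ℚ ≤ H n
  0≤H n = ℚ.≤-trans (ℚ.≤-reflexive (sym (sum-0 n))) (sum-mono n (λ k _ → 0≤u k))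

  x≤x+ : 0ℚ ≤ y → x ≤ x + y
  x≤x+ {y} {x} p = ℚ.≤-trans (ℚ.≤-reflexive (sym (+-identityʳ x))) (+-mono ℚ.≤-refl p)

  H-mono : ∀ {m n} → m ℕ.≤ n → H m ≤ H n
  H-mono m≤n = go (ℕ.≤⇒≤′ m≤n)
    where
    go : ∀ {m n} → m ℕ.≤′ n → H m ≤ H n
    go ℕ.≤′-refl               = ℚ.≤-refl
    go {n = suc n} (ℕ.≤′-step p) = ℚ.≤-trans (go p) (x≤x+ (0≤u n))

  H-diff : ∀ r j → H (j ℕ.+ r) - H r ≤ num j * u r
  H-diff r zero    = ℚ.≤-reflexive (solve 2 (λ h v → h :- h := con 0ℚ :* v) refl (H r) (u r))
  H-diff r (suc j) = begin
    H (j ℕ.+ r) + u (j ℕ.+ r) - H r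
      ≡⟨ solve 3 (λ a v h → a :+ v :- h := v :+ (a :- h)) refl (H (j ℕ.+ r)) (u (j ℕ.+ r)) (H r) ⟩
    u (j ℕ.+ r) + (H (j ℕ.+ r) - H r)
      ≤⟨ +-mono (u-antitone (ℕ.m≤n+m r j)) (H-diff r j) ⟩
    u r + num j * u r
      ≡⟨ solve 2 (λ v n → v :+ n :* v := (con 1ℚ :+ n) :* v) refl (u r) (num j) ⟩
    num (suc j) * u r ∎

  -- Leibniz: the tail from n is `u n` minus the tail from n + 1. If the latter lies between 0 and
  -- `u (suc n)`, the former lies between 0 and `u n`.
  alternating-tail : ∀ n j → (0ℚ ≤ σ n * (L (n ℕ.+ j) - L n)) × (σ n * (L (n ℕ.+ j) - L n) ≤ u n)
  alternating-tail n zero    = ℚ.≤-reflexive (sym t≡0) , ℚ.≤-trans (ℚ.≤-reflexive t≡0) (0≤u n)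
    where
    t≡0 : σ n * (L (n ℕ.+ 0) - L n) ≡ 0ℚ
    t≡0 = trans (cong (λ k → σ n * (L k - L n)) (ℕ.+-identityʳ n))
      (solve 2 (λ s l → s :* (l :- l) := con 0ℚ) refl (σ n) (L n))
  alternating-tail n (suc j) =
      ℚ.≤-trans (-≤⇒0≤ (ℚ.≤-trans (proj₂ ih) (u-antitone (ℕ.n≤1+n n)))) (ℚ.≤-reflexive (sym t≡))
    , (begin
        σ n * (L (n ℕ.+ suc j) - L n)  ≡⟨ t≡ ⟩
        u n - t′                       ≤⟨ x≤x+ (proj₁ ih) ⟩
        u n - t′ + t′                  ≡⟨ solve 2 (λ a b → a :- b :+ b := a) refl (u n) t′ ⟩
        u n                            ∎)
    where
    t′ : ℚ
    t′ = σ (suc n) * (L (suc n ℕ.+ j) - L (suc n))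
    ih : (0ℚ ≤ t′) × (t′ ≤ u (suc n))
    ih = alternating-tail (suc n) j
    t≡ : σ n * (L (n ℕ.+ suc j) - L n) ≡ u n - t′
    t≡ = begin-equality
      σ n * (L (n ℕ.+ suc j) - L n)
        ≡⟨ cong (λ k → σ n * (L k - L n)) (ℕ.+-suc n j) ⟩
      σ n * (L (suc (n ℕ.+ j)) - L n)
        ≡⟨ solve 4 (λ s a l v → s :* (a :- l) := s :* s :* v :- (:- s :* (a :- (l :+ s :* v)))) refl
             (σ n) (L (suc (n ℕ.+ j))) (L n) (u n) ⟩
      σ n * σ n * u n - t′
        ≡⟨ cong (λ x → x - t′) (trans (cong (_* u n) (σ*σ n)) (*-identityˡ (u n))) ⟩
      u n - t′ ∎

  ∣L-L∣ : ∀ n j → ∣ L (j ℕ.+ n) - L n ∣ ≤ u n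
  ∣L-L∣ n j = begin
    ∣ L (j ℕ.+ n) - L n ∣            ≡⟨ cong (λ k → ∣ L k - L n ∣) (ℕ.+-comm j n) ⟩
    ∣ L (n ℕ.+ j) - L n ∣            ≡⟨ ∣σ*∣ n (L (n ℕ.+ j) - L n) ⟨
    ∣ σ n * (L (n ℕ.+ j) - L n) ∣    ≡⟨ 0≤⇒∣∣ (proj₁ (alternating-tail n j)) ⟩
    σ n * (L (n ℕ.+ j) - L n)        ≤⟨ proj₂ (alternating-tail n j) ⟩
    u n                              ∎

  ∣L∣≤1 : ∀ n → ∣ L n ∣ ≤ 1ℚ
  ∣L∣≤1 n = begin
    ∣ L n ∣                ≡⟨ cong ∣_∣ (solve 1 (λ l → l := l :- con 0ℚ) refl (L n)) ⟩
    ∣ L n - L 0 ∣          ≡⟨ cong (λ k → ∣ L k - L 0 ∣) (ℕ.+-identityʳ n) ⟨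
    ∣ L (n ℕ.+ 0) - L 0 ∣  ≤⟨ ∣L-L∣ 0 n ⟩
    u 0                    ≤⟨ u≤1 0 ⟩
    1ℚ                     ∎

  module _ {n N : ℕ} (n<N : n ℕ.< N) where

    private
      r : ℕ
      r = N ∸ suc n

      N≡ : suc n ℕ.+ r ≡ N
      N≡ = ℕ.m+[n∸m]≡n n<N

    ρ≡u : ρ N n ≡ u r
    ρ≡u = trans (cong (λ M → ρ M n) (sym (trans (ℕ.+-suc n r) N≡))) (go n)
      where
      go : ∀ n → ρ (n ℕ.+ suc r) n ≡ u r
      go zero    = refl
      go (suc n) = go n

    -- The difference H N - H r has n + 1 terms, each at most `u r`, and the factor `u n` cancels
    -- their number.
    ∣φ-error∣ : ∣ φ-error N n ∣ ≤ u r + u r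
    ∣φ-error∣ = +-mono-∣∣ (- (σ n * (ρ N n * (σ N * L N)))) (- (σ n * (u n * (H N - H r)))) first second
      where
      first : ∣ - (σ n * (ρ N n * (σ N * L N))) ∣ ≤ u r
      first = begin
        ∣ - (σ n * (ρ N n * (σ N * L N))) ∣  ≡⟨ trans (∣-∣ _) (∣σ*∣ n _) ⟩
        ∣ ρ N n * (σ N * L N) ∣              ≤⟨ *-mono-∣∣ (ρ N n) (σ N * L N)
                                                  (ℚ.≤-reflexive (trans (cong ∣_∣ ρ≡u) (0≤⇒∣∣ (0≤u r))))
                                                  (ℚ.≤-trans (ℚ.≤-reflexive (∣σ*∣ N (L N))) (∣L∣≤1 N)) ⟩
        u r * 1ℚ                             ≡⟨ *-identityʳ (u r) ⟩
        u r                                  ∎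
      second : ∣ - (σ n * (u n * (H N - H r))) ∣ ≤ u r
      second = begin
        ∣ - (σ n * (u n * (H N - H r))) ∣    ≡⟨ trans (∣-∣ _) (∣σ*∣ n _) ⟩
        ∣ u n * (H N - H r) ∣                ≡⟨ 0≤⇒∣∣ (0≤* (0≤u n) (-≤⇒0≤ (H-mono (ℕ.m∸n≤m N (suc n))))) ⟩
        u n * (H N - H r)                    ≤⟨ *-mono (0≤u n) (0≤* (0≤num (suc n)) (0≤u r)) ℚ.≤-refl
                                                  (subst (λ M → H M - H r ≤ num (suc n) * u r) N≡ (H-diff r (suc n))) ⟩
        u n * (num (suc n) * u r)            ≡⟨ solve 3 (λ v c w → v :* (c :* w) := c :* v :* w) refl (u n) (num (suc n)) (u r) ⟩
        num (suc n) * u n * u r              ≡⟨ trans (cong (_* u r) (num*u n)) (*-identityˡ (u r)) ⟩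
        u r                                  ∎

  ∣φ-errors∣ : ∀ {n N} → n ℕ.< N → let r = N ∸ suc n in
    ∣ Σ[ ν < suc n ] φ-error N ν ∣ ≤ num (suc n) * (u r + u r)
  ∣φ-errors∣ {n} {N} n<N = ℚ.≤-trans
    (∣sum∣ (suc n) λ ν ν≤n → ℚ.≤-trans (∣φ-error∣ (ℕ.≤-trans ν≤n n<N))
      (+-mono (u-antitone (ℕ.∸-monoʳ-≤ N ν≤n)) (u-antitone (ℕ.∸-monoʳ-≤ N ν≤n))))
    (ℚ.≤-reflexive (sum-const (suc n) _))

  -- The n-th summand is at most 3 `u n` `u r` with n + r + 1 = N, and `u*u` rewrites this as 3 (u n
  -- + u r) `u N`. Over all n, `u n` and, after reversal, `u r` each sum to H N, which makes 6.
  ∣Q-error∣ : ∀ q N → ∣ Q-error (2 ℕ.+ q) N ∣ ≤ num 6 * (H N * u N)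
  ∣Q-error∣ q N = begin
    ∣ Q-error s N ∣
      ≤⟨ ∣sum∣ N term ⟩
    Σ[ n < N ] (num 3 * u N * (u n + u (N ∸ suc n)))
      ≡⟨ trans (sum-*ˡ N (num 3 * u N) (λ n → u n + u (N ∸ suc n)))
           (cong (num 3 * u N *_) (refl ⟨+⟩ sum-reverse N u)) ⟩
    num 3 * u N * (H N + H N)
      ≡⟨ solve 2 (λ v h → (con 1ℚ :+ (con 1ℚ :+ (con 1ℚ :+ con 0ℚ))) :* v :* (h :+ h) :=
           (con 1ℚ :+ (con 1ℚ :+ (con 1ℚ :+ (con 1ℚ :+ (con 1ℚ :+ (con 1ℚ :+ con 0ℚ)))))) :* (h :* v)) refl (u N) (H N) ⟩
    num 6 * (H N * u N) ∎
    where
    open Termwise N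
    s : ℕ
    s = 2 ℕ.+ q
    term : ∀ n → n ℕ.< N →
      ∣ d n s * (L (suc n) * (L N - L (N ∸ suc n)) + Σ[ ν < suc n ] φ-error N ν) ∣ ≤ num 3 * u N * (u n + u (N ∸ suc n))
    term n n<N = begin
      ∣ d n s * (L (suc n) * (L N - L r) + Σ[ ν < suc n ] φ-error N ν) ∣
        ≤⟨ *-mono-∣∣ (d n s) (L (suc n) * (L N - L r) + Σ[ ν < suc n ] φ-error N ν)
             (ℚ.≤-reflexive (0≤⇒∣∣ (0≤d n s)))
             (+-mono-∣∣ (L (suc n) * (L N - L r)) (Σ[ ν < suc n ] φ-error N ν)
               (*-mono-∣∣ (L (suc n)) (L N - L r) (∣L∣≤1 (suc n))
                 (subst (λ M → ∣ L M - L r ∣ ≤ u r) (ℕ.m+[n∸m]≡n n<N) (∣L-L∣ r (suc n))))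
               (∣φ-errors∣ n<N)) ⟩
      d n s * (1ℚ * u r + c * (u r + u r))
        ≤⟨ *-mono (0≤d n s) (0≤* (0≤* (0≤num 3) (0≤num (suc n))) (0≤u r)) ℚ.≤-refl (begin
             1ℚ * u r + c * (u r + u r)
               -- The estimate 1 ≤ n + 1 merges the single `u r` with the 2 (n + 1) of the
               -- recurrence errors, hence the 3.
               ≤⟨ +-mono (*-mono 0≤1 (0≤u r) (x≤x+ (0≤num n)) ℚ.≤-refl) ℚ.≤-refl ⟩
             c * u r + c * (u r + u r)
               ≡⟨ solve 2 (λ c v → c :* v :+ c :* (v :+ v) := (con 1ℚ :+ (con 1ℚ :+ (con 1ℚ :+ con 0ℚ))) :* c :* v) refl c (u r) ⟩
             num 3 * c * u r ∎) ⟩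
      d n s * (num 3 * c * u r)
        -- Since s = q + 2, `d n s` has two factors `u n` to spare: one is set against c = n + 1,
        -- the other stays beside `u r`.
        ≡⟨ solve 5 (λ v a t c w → v :* (v :* a) :* (t :* c :* w) := t :* w :* (v :* a) :* (c :* v)) refl
             (u n) (d n q) (num 3) c (u r) ⟩
      num 3 * u r * (u n * d n q) * (c * u n)
        ≤⟨ *-mono (0≤* (0≤* (0≤num 3) (0≤u r)) (0≤d n (suc q))) 0≤1
             (*-mono (0≤* (0≤num 3) (0≤u r)) (0≤* (0≤u n) 0≤1) ℚ.≤-refl (*-mono (0≤u n) 0≤1 ℚ.≤-refl (d≤1 n q)))
             (ℚ.≤-reflexive (num*u n)) ⟩
      num 3 * u r * (u n * 1ℚ) * 1ℚ
        ≡⟨ solve 3 (λ t w v → t :* w :* (v :* con 1ℚ) :* con 1ℚ := t :* (v :* w)) refl (num 3) (u r) (u n) ⟩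
      num 3 * (u n * u r)
        ≡⟨ cong (num 3 *_) (u*u n r) ⟩
      num 3 * ((u n + u r) * u (suc n ℕ.+ r))
        ≡⟨ cong (λ M → num 3 * ((u n + u r) * u M)) (ℕ.m+[n∸m]≡n n<N) ⟩
      num 3 * ((u n + u r) * u N)
        ≡⟨ solve 3 (λ t a v → t :* (a :* v) := t :* v :* a) refl (num 3) (u n + u r) (u N) ⟩
      num 3 * u N * (u n + u r) ∎
      where
      r : ℕ
      r = N ∸ suc n
      c : ℚ
      c = num (suc n)

  ∣tail-sum∣ : ∀ N n → ∣ tail-sum N n ∣ ≤ H n * u N
  ∣tail-sum∣ N n = ℚ.≤-trans
    (∣sum∣ n λ k _ → *-mono-∣∣ (u k) _ (ℚ.≤-reflexive (0≤⇒∣∣ (0≤u k))) (∣L-L∣ N (suc k)))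
    (ℚ.≤-reflexive (sum-*ʳ n u (u N)))

  ∣γ-error∣ : ∀ s N → ∣ γ-error s N ∣ ≤ Z s N * (H N * u N + H N * u N)
  ∣γ-error∣ s N = ℚ.≤-trans
    (∣sum∣ N λ k k<N → *-mono-∣∣ (d k s) (γ-remainder N (suc k)) (ℚ.≤-reflexive (0≤⇒∣∣ (0≤d k s)))
      (+-mono-∣∣ (H N * (L (suc k ℕ.+ N) - L N)) (tail-sum N (suc k))
        (*-mono-∣∣ (H N) _ (ℚ.≤-reflexive (0≤⇒∣∣ (0≤H N))) (∣L-L∣ N (suc k)))
        (ℚ.≤-trans (∣tail-sum∣ N (suc k)) (*-mono (0≤H (suc k)) (0≤u N) (H-mono k<N) ℚ.≤-refl))))
    (ℚ.≤-reflexive (sum-*ʳ N (λ k → d k s) (H N * u N + H N * u N)))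

  ∣W-error∣ : ∀ s N → ∣ W-error s N ∣ ≤ Z s N * (H N * u N)
  ∣W-error∣ s N = ℚ.≤-trans
    (∣sum∣ N λ m m<N → begin
      ∣ H m * d m s * (L (suc m ℕ.+ N) - L N) ∣
        ≤⟨ *-mono-∣∣ (H m * d m s) _ (ℚ.≤-reflexive (0≤⇒∣∣ (0≤* (0≤H m) (0≤d m s)))) (∣L-L∣ N (suc m)) ⟩
      H m * d m s * u N
        ≤⟨ *-mono (0≤* (0≤H m) (0≤d m s)) (0≤u N) (*-mono (0≤H m) (0≤d m s) (H-mono (ℕ.<⇒≤ m<N)) ℚ.≤-refl) ℚ.≤-refl ⟩
      H N * d m s * u N
        ≡⟨ solve 3 (λ h a v → h :* a :* v := a :* (h :* v)) refl (H N) (d m s) (u N) ⟩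
      d m s * (H N * u N) ∎)
    (ℚ.≤-reflexive (sum-*ʳ N (λ m → d m s) (H N * u N)))

-- From truncated sums to real numbers.

module Approximation where

  open ℝ hiding (_+_; _-_; _*_; H; L; ι)
  open Sums
  open Identities
  open Estimates

  private
    variable
      a b c : ℕ → ℚ

  opaque
    unfolding _+_
    null-+ : Null a → Null b → Null (λ n → a n + b n)
    null-+ {a} {b} = CauchyProperties.null-+ {a} {b}

    null-neg : Null a → Null (λ n → - a n)
    null-neg {a} p ε 0<ε with p ε 0<ε
    ... | N , f = N , λ n N≤n → ℚ.≤-<-trans (ℚ.≤-reflexive (∣-∣ (a n))) (f n N≤n)

    null-cong : (∀ n → a n ≡ b n) → Null a → Null b
    null-cong e p ε 0<ε with p ε 0<ε
    ... | N , f = N , λ n N≤n → subst (λ x → ∣ x ∣ ℚ.< ε) (e n) (f n N≤n)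

    null-squeeze : (∀ n → ∣ a n ∣ ≤ b n) → Null b → Null a
    null-squeeze {a} {b} = CauchyProperties.null-squeeze {a} {b}

    null-0 : Null (λ _ → 0ℚ)
    null-0 ε 0<ε = 0 , λ _ _ → 0<ε

    null⇒cauchy : Null a → Cauchy a
    null⇒cauchy {a} = CauchyProperties.null⇒cauchy {a}

    cauchy-cong : (∀ n → a n ≡ b n) → Cauchy a → Cauchy b
    cauchy-cong = CauchyProperties.cauchy-cong

    cauchy-+ : Cauchy a → Cauchy b → Cauchy (λ n → a n + b n)
    cauchy-+ {a} {b} = CauchyProperties.cauchy-+ {a} {b}

    cauchy-const : ∀ q → Cauchy (λ _ → q)
    cauchy-const = CauchyProperties.cauchy-const

    cauchy*null : Cauchy c → Null a → Null (λ n → c n * a n)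
    cauchy*null {c} {a} p nul with CauchyProperties.cauchy-bounded {c} p
    ... | B , c≤B = null-squeeze {λ n → c n * a n} {λ n → ∣ B * a n ∣}
      (λ n → ℚ.≤-trans (ℚ.≤-reflexive (∣*∣ (c n) (a n))) (ℚ.≤-trans
        (*-mono (0≤∣ c n ∣) (0≤∣ a n ∣) (c≤B n) ℚ.≤-refl)
        (ℚ.≤-reflexive (trans (cong (_* ∣ a n ∣) (sym (0≤⇒∣∣ (ℚ.≤-trans 0≤∣ c 0 ∣ (c≤B 0))))) (sym (∣*∣ B (a n)))))))
      ∣Ba∣
      where
      ∣Ba∣ : Null (λ n → ∣ B * a n ∣)
      ∣Ba∣ ε 0<ε with CauchyProperties.null-scale B {a} (ℚ.≤-trans 0≤∣ c 0 ∣ (c≤B 0)) nul ε 0<ε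
      ... | N , f = N , λ n N≤n → ℚ.≤-<-trans (ℚ.≤-reflexive (0≤⇒∣∣ 0≤∣ B * a n ∣)) (f n N≤n)

  infix 4 _⇝_

  -- The sequence a approximates the real number x; it need not be the one that presents x.
  record _⇝_ (x : ℝ) (a : ℕ → ℚ) : Set where
    constructor approximation
    field
      null : Null (λ n → seq x n - a n)

  open _⇝_

  opaque
    unfolding _+_

    seq-+ : ∀ x y n → seq x n + seq y n ≡ seq (x ℝ.+ y) n
    seq-+ _ _ _ = refl

    seq-- : ∀ x y n → seq x n - seq y n ≡ seq (x ℝ.- y) n
    seq-- _ _ _ = refl

    seq-* : ∀ x y n → seq x n * seq y n ≡ seq (x ℝ.* y) n
    seq-* _ _ _ = refl

    null⇒≈ : ∀ x y → Null (λ n → seq x n - seq y n) → x ≈ y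
    null⇒≈ _ _ p = p

  infixl 6 _⇝+_ _⇝-_
  infixl 7 _⇝*_

  ⇝-exact : ∀ {x a} → (∀ n → seq x n ≡ a n) → x ⇝ a
  ⇝-exact {x} {a} e = approximation (null-cong {λ _ → 0ℚ} (λ n → sym (trans (cong (_- a n) (e n))
    (solve 1 (λ a → a :- a := con 0ℚ) refl (a n)))) null-0)

  _⇝+_ : ∀ {x y a b} → x ⇝ a → y ⇝ b → x ℝ.+ y ⇝ λ n → a n + b n
  _⇝+_ {x} {y} {a} {b} p q = approximation (null-cong {λ n → (seq x n - a n) + (seq y n - b n)}
    (λ n → trans
      (solve 4 (λ x a y b → x :- a :+ (y :- b) := x :+ y :- (a :+ b)) refl (seq x n) (a n) (seq y n) (b n))
      (cong (_- (a n + b n)) (seq-+ x y n)))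
    (null-+ {λ n → seq x n - a n} {λ n → seq y n - b n} (null p) (null q)))

  _⇝-_ : ∀ {x y a b} → x ⇝ a → y ⇝ b → x ℝ.- y ⇝ λ n → a n - b n
  _⇝-_ {x} {y} {a} {b} p q = approximation (null-cong {λ n → (seq x n - a n) - (seq y n - b n)}
    (λ n → trans
      (solve 4 (λ x a y b → x :- a :- (y :- b) := x :- y :- (a :- b)) refl (seq x n) (a n) (seq y n) (b n))
      (cong (_- (a n - b n)) (seq-- x y n)))
    (null-+ {λ n → seq x n - a n} {λ n → - (seq y n - b n)} (null p) (null-neg {λ n → seq y n - b n} (null q))))

  -- The error is expanded as x (y - b) + y (x - a) - (x - a)(y - b): each product has a null factor
  -- and a Cauchy, hence bounded, one. In the last product a null sequence plays both roles.
  _⇝*_ : ∀ {x y a b} → x ⇝ a → y ⇝ b → x ℝ.* y ⇝ λ n → a n * b n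
  _⇝*_ {x} {y} {a} {b} p q = approximation (null-cong {λ n → seq x n * q′ n + (seq y n * p′ n + - (p′ n * q′ n))}
    (λ n → trans
      (solve 4 (λ x a y b → x :* (y :- b) :+ (y :* (x :- a) :+ :- ((x :- a) :* (y :- b))) := x :* y :- a :* b) refl
        (seq x n) (a n) (seq y n) (b n))
      (cong (_- (a n * b n)) (seq-* x y n)))
    (null-+ {λ n → seq x n * q′ n} {λ n → seq y n * p′ n + - (p′ n * q′ n)}
      (cauchy*null {seq x} {q′} (cauchy x) (null q))
      (null-+ {λ n → seq y n * p′ n} {λ n → - (p′ n * q′ n)}
        (cauchy*null {seq y} {p′} (cauchy y) (null p))
        (null-neg {λ n → p′ n * q′ n} (cauchy*null {p′} {q′} (null⇒cauchy {p′} (null p)) (null q))))))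
    where
    p′ q′ : ℕ → ℚ
    p′ n = seq x n - a n
    q′ n = seq y n - b n

  ⇝-≈ : ∀ {x y a b} → x ⇝ a → y ⇝ b → Null (λ n → a n - b n) → x ≈ y
  ⇝-≈ {x} {y} {a} {b} p q r = null⇒≈ x y (null-cong {λ n → (seq x n - a n) + ((a n - b n) + - (seq y n - b n))}
    (λ n → solve 4 (λ x a y b → x :- a :+ (a :- b :+ :- (y :- b)) := x :- y) refl (seq x n) (a n) (seq y n) (b n))
    (null-+ {λ n → seq x n - a n} {λ n → (a n - b n) + - (seq y n - b n)} (null p)
      (null-+ {λ n → a n - b n} {λ n → - (seq y n - b n)} r (null-neg {λ n → seq y n - b n} (null q)))))

  ⇝-sum : ∀ n {f : ∀ i → .{{NonZero i}} → ℝ} {a : ℕ → ℕ → ℚ} → (∀ i → f (suc i) ⇝ a i) →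
    sumℝ n f ⇝ λ N → Σ[ i < n ] a i N
  ⇝-sum zero    p = ⇝-exact (λ _ → refl)
  ⇝-sum (suc n) p = ⇝-sum n p ⇝+ p n

  opaque
    unfolding _+_ u

    sumℚ≡ : ∀ N {f : ∀ n → .{{NonZero n}} → ℚ} {g : ℕ → ℚ} → (∀ k → f (suc k) ≡ g k) → sumℚ N f ≡ sum N g
    sumℚ≡ zero    e = refl
    sumℚ≡ (suc N) e = cong₂ _+_ (sumℚ≡ N e) (e N)

    d≡ : ∀ k s → 1ℤ / suc k ^ s ≡ d k s
    d≡ k zero    = refl
    d≡ k (suc s) = trans (CauchyProperties.d-suc k s) (cong (u k *_) (d≡ k s))

    σ≡ : ∀ n → (-1ℤ ℤ.^ n) ℚ./ 1 ≡ σ n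
    σ≡ zero    = refl
    σ≡ (suc n) = trans (CauchyProperties.σ-suc n) (cong -_ (σ≡ n))

    σd≡ : ∀ n k s → (-1ℤ ℤ.^ n) / suc k ^ s ≡ σ n * d k s
    σd≡ n k s = trans (CauchyProperties./-^ (-1ℤ ℤ.^ n) k s) (cong₂ _*_ (σ≡ n) (d≡ k s))

    H≡ : ∀ n → ℝ.H n ≡ H n
    H≡ n = sumℚ≡ n (λ _ → refl)

    L≡ : ∀ n → ℝ.L n 1 ≡ L n
    L≡ n = sumℚ≡ n (λ k → trans (σd≡ k k 1) (cong (σ k *_) (*-identityʳ (u k))))

    factor-bar : ∀ s k → .{{_ : NonZero s}} → factor (bar s) (suc k) ≡ - (σ k * d k s)
    factor-bar s k = trans (σd≡ (suc k) k s) (solve 2 (λ s a → :- s :* a := :- (s :* a)) refl (σ k) (d k s))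

    S⋆-plain-1 : ∀ n → S⋆ (plain 1 ∷ []) n ≡ H n
    S⋆-plain-1 n = sumℚ≡ n (λ k → trans (*-identityʳ _) (trans (d≡ k 1) (*-identityʳ (u k))))

    S⋆-bar : ∀ s n → .{{_ : NonZero s}} → S⋆ (bar s ∷ []) n ≡ - Z̄ s n
    S⋆-bar s n = trans (sumℚ≡ n (λ k → trans (*-identityʳ _) (factor-bar s k))) (sum-neg n (λ k → σ k * d k s))

    Z̄1≡L : ∀ n → Z̄ 1 n ≡ L n
    Z̄1≡L n = sum-cong n (λ k → cong (σ k *_) (*-identityʳ (u k)))

    S⋆-plain : ∀ s t (f : ℕ → ℚ) → .{{_ : NonZero s}} → (∀ n → S⋆ (t ∷ []) n ≡ f n) → ∀ N →
      S⋆ (plain s ∷ t ∷ []) N ≡ S s f N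
    S⋆-plain s t f e N = sumℚ≡ N (λ k → cong₂ _*_ (d≡ k s) (e (suc k)))

    S⋆-plain-neg : ∀ s t (f : ℕ → ℚ) → .{{_ : NonZero s}} → (∀ n → S⋆ (t ∷ []) n ≡ - f n) → ∀ N →
      S⋆ (plain s ∷ t ∷ []) N ≡ - S s f N
    S⋆-plain-neg s t f e N = trans
      (sumℚ≡ N (λ k → trans (cong₂ _*_ (d≡ k s) (e (suc k)))
        (solve 2 (λ a b → a :* :- b := :- (a :* b)) refl (d k s) (f (suc k)))))
      (sum-neg N (λ k → d k s * f (suc k)))

    S⋆-bar-plain : ∀ s t (f : ℕ → ℚ) → .{{_ : NonZero s}} → (∀ n → S⋆ (t ∷ []) n ≡ f n) → ∀ N →
      S⋆ (bar s ∷ t ∷ []) N ≡ - S̄ s f N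
    S⋆-bar-plain s t f e N = trans
      (sumℚ≡ N (λ k → trans (cong₂ _*_ (factor-bar s k) (e (suc k)))
        (solve 2 (λ a b → :- a :* b := :- (a :* b)) refl (σ k * d k s) (f (suc k)))))
      (sum-neg N (λ k → σ k * d k s * f (suc k)))

    S⋆-bar-neg : ∀ s t (f : ℕ → ℚ) → .{{_ : NonZero s}} → (∀ n → S⋆ (t ∷ []) n ≡ - f n) → ∀ N →
      S⋆ (bar s ∷ t ∷ []) N ≡ S̄ s f N
    S⋆-bar-neg s t f e N =
      sumℚ≡ N (λ k → trans (cong₂ _*_ (factor-bar s k) (e (suc k)))
        (solve 2 (λ a b → :- a :* :- b := a :* b) refl (σ k * d k s) (f (suc k))))

    -- Catalan's identity 1/(n + 1) + ⋯ + 1/(2n) = 1 - 1/2 + ⋯ - 1/(2n). Passing to n + 1 changes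
    -- both sides by 1/(2n + 1) - 1/(2n + 2), where the signs follow from (-1)^(2n) = 1.
    ln2-riemann≡ : ∀ n → ln2-riemann n ≡ L (n ℕ.+ n)
    ln2-riemann≡ zero    = refl
    ln2-riemann≡ (suc n) = begin
      P (suc n) (suc n)
        ≡⟨ solve 2 (λ a b → a := b :+ (a :- b)) refl (P (suc n) (suc n)) (P n n) ⟩
      P n n + (P (suc n) (suc n) - P n n)
        ≡⟨ cong₂ _+_ (ln2-riemann≡ n) (CauchyProperties.P-step n) ⟩
      L (n ℕ.+ n) + (u (n ℕ.+ n) - u (suc (n ℕ.+ n)))
        ≡⟨ solve 3 (λ l v w → l :+ (v :- w) := l :+ con 1ℚ :* v :+ :- con 1ℚ :* w) refl
             (L (n ℕ.+ n)) (u (n ℕ.+ n)) (u (suc (n ℕ.+ n))) ⟩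
      L (n ℕ.+ n) + 1ℚ * u (n ℕ.+ n) + - 1ℚ * u (suc (n ℕ.+ n))
        ≡⟨ cong (λ s → L (n ℕ.+ n) + s * u (n ℕ.+ n) + - s * u (suc (n ℕ.+ n))) (trans (sym (σ*σ n)) (sym (σ-+ n n))) ⟩
      L (suc (suc (n ℕ.+ n)))
        ≡⟨ cong (λ m → L (suc m)) (ℕ.+-suc n n) ⟨
      L (suc n ℕ.+ suc n) ∎
      where
      open ≡-Reasoning
      open CauchyProperties using (P)

    null-u : Null u
    null-u = CauchyProperties.null-u

    null-Hu : Null (λ n → H n * u n)
    null-Hu = null-squeeze {λ n → H n * u n} {CauchyProperties.g}
      (λ n → ℚ.≤-trans (ℚ.≤-reflexive (0≤⇒∣∣ (0≤* (0≤H n) (0≤u n))))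
        (*-mono (0≤H n) (0≤u n)
          (ℚ.≤-trans (H-mono (ℕ.n≤1+n n)) (ℚ.≤-trans (x≤x+ 0≤1) (ℚ.≤-reflexive (cong (_+ 1ℚ) (sym (H≡ (suc n)))))))
          ℚ.≤-refl))
      CauchyProperties.null-g

  -- The presentation of ln 2 runs through L (2n), whereas the truncated identity contains L n. By
  -- the Leibniz bound they differ by at most 1/(n + 1).
  ln2⇝ : ln2 ⇝ L
  ln2⇝ = approximation (null-squeeze
    (λ n → ℚ.≤-trans (ℚ.≤-reflexive (cong (λ x → ∣ x - L n ∣) (ln2-riemann≡ n))) (∣L-L∣ n n))
    null-u)

  cauchy-Z : ∀ s → .{{_ : NonZero (s ∸ 1)}} → Cauchy (Z s)
  cauchy-Z s = cauchy-cong {seq (ζ s)} (λ N → sumℚ≡ N (λ k → d≡ k s)) (cauchy (ζ s))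

  cauchy-Z̄ : ∀ s → .{{_ : NonZero s}} → Cauchy (Z̄ s)
  cauchy-Z̄ s = cauchy-cong {seq (ζ̄ s)} (λ N → sumℚ≡ N (λ k → σd≡ k k s)) (cauchy (ζ̄ s))

  -- As s ≥ 2, `Z s` is Cauchy and so bounded. Each part of the error is then at most a bounded
  -- factor times H N / (N + 1), which tends to 0.
  null-error : ∀ q → Null (error q)
  null-error q =
    null-+ {λ N → (Z s N + Z̄ s N) * tail-sum N N} {λ N → σ q * W-error s N + (- Q-error s N + - γ-error s N)}
      (cauchy*null {λ N → Z s N + Z̄ s N} {λ N → tail-sum N N}
        (cauchy-+ {Z s} {Z̄ s} (cauchy-Z s) (cauchy-Z̄ s))
        (null-squeeze {λ N → tail-sum N N} (λ N → ∣tail-sum∣ N N) null-Hu))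
      (null-+ {λ N → σ q * W-error s N} {λ N → - Q-error s N + - γ-error s N}
        (cauchy*null {λ _ → σ q} {W-error s} (cauchy-const (σ q))
          (null-squeeze (∣W-error∣ s) (cauchy*null {Z s} {Hu} (cauchy-Z s) null-Hu)))
        (null-+ {λ N → - Q-error s N} {λ N → - γ-error s N}
          (null-neg {Q-error s} (null-squeeze (∣Q-error∣ q) (cauchy*null {λ _ → num 6} {Hu} (cauchy-const (num 6)) null-Hu)))
          (null-neg {γ-error s} (null-squeeze (∣γ-error∣ s)
            (cauchy*null {Z s} {λ N → Hu N + Hu N} (cauchy-Z s) (null-+ {Hu} {Hu} null-Hu null-Hu))))))
    where
    s : ℕ
    s = 2 ℕ.+ q
    Hu : ℕ → ℚ
    Hu N = H N * u N

  num⇝ : ∀ n → fromℕ n ⇝ λ _ → num n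
  num⇝ n = ⇝-exact (λ _ → sym (num≡ι n))

  σ⇝ : ∀ n → [-1]^ n ⇝ λ _ → σ n
  σ⇝ n = ⇝-exact (λ _ → σ≡ n)

  ½⇝ : ℝ.ι ½ ⇝ λ _ → ½
  ½⇝ = ⇝-exact (λ _ → refl)

  ζ⇝ : ∀ s → .{{_ : NonZero (s ∸ 1)}} → ζ s ⇝ Z s
  ζ⇝ s = ⇝-exact (λ N → sumℚ≡ N (λ k → d≡ k s))

  ζ̄⇝ : ∀ s → .{{_ : NonZero s}} → ζ̄ s ⇝ Z̄ s
  ζ̄⇝ s = ⇝-exact (λ N → sumℚ≡ N (λ k → σd≡ k k s))

  S⋆-bar-1 : ∀ n → S⋆ (bar 1 ∷ []) n ≡ - L n
  S⋆-bar-1 n = trans (S⋆-bar 1 n) (cong -_ (Z̄1≡L n))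

  module _ (s : ℕ) .{{_ : NonZero s}} where

    ζ⋆[s̄,1̄]⇝ : ζ⋆ (bar s) (bar 1) ⇝ S̄ s L
    ζ⋆[s̄,1̄]⇝ = ⇝-exact (S⋆-bar-neg s (bar 1) L S⋆-bar-1)

    ζ⋆[s̄,1]⇝ : ζ⋆ (bar s) (plain 1) ⇝ λ N → - S̄ s H N
    ζ⋆[s̄,1]⇝ = ⇝-exact (S⋆-bar-plain s (plain 1) H S⋆-plain-1)

    module _ .{{_ : NonZero (s ∸ 1)}} where

      ζ⋆[s,1̄]⇝ : ζ⋆ (plain s) (bar 1) ⇝ λ N → - S s L N
      ζ⋆[s,1̄]⇝ = ⇝-exact (S⋆-plain-neg s (bar 1) L S⋆-bar-1)

      ζ⋆[s,2̄]⇝ : ζ⋆ (plain s) (bar 2) ⇝ λ N → - S s L₂ N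
      ζ⋆[s,2̄]⇝ = ⇝-exact (S⋆-plain-neg s (bar 2) L₂ (λ n → S⋆-bar 2 n))

      ζ⋆[s,1]⇝ : ζ⋆ (plain s) (plain 1) ⇝ S s H
      ζ⋆[s,1]⇝ = ⇝-exact (S⋆-plain s (plain 1) H S⋆-plain-1)

  opaque
    unfolding _+_

    ∑L²⇝ : ∀ s → .{{_ : NonZero (s ∸ 1)}} →
      ∑∞ (λ n → (ℝ.L n 1 ℚ.* ℝ.L n 1) ℚ.* (1ℤ / n ^ s)) (L²-converges s) ⇝ S s L²
    ∑L²⇝ s = ⇝-exact (λ N → sumℚ≡ N (λ k → trans
      (cong₂ _*_ (cong₂ _*_ (L≡ (suc k)) (L≡ (suc k))) (d≡ k s)) (*-comm (L² (suc k)) (d k s))))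

    ∑HL⇝ : ∀ s → .{{_ : NonZero (s ∸ 1)}} →
      ∑∞ (λ n → (ℝ.H n ℚ.* ℝ.L n 1) ℚ.* (1ℤ / n ^ s)) (HL-converges s) ⇝ S s HL
    ∑HL⇝ s = ⇝-exact (λ N → sumℚ≡ N (λ k → trans
      (cong₂ _*_ (cong₂ _*_ (H≡ (suc k)) (L≡ (suc k))) (d≡ k s)) (*-comm (HL (suc k)) (d k s))))

open import Defs
open Approximation
open Identities using (error; truncated-identity)

theorem3p3 : ∀ (p : ℕ) → .{{_ : NonZero p}} →
    ∑∞ (λ n → (L n 1 ℚ.* L n 1) ℚ.* (1ℤ / n ^ suc p)) (L²-converges (suc p))
    + ([-1]^ (p ∸ 1) - fromℕ 1)
    * ∑∞ (λ n → (H n ℚ.* L n 1) ℚ.* (1ℤ / n ^ suc p)) (HL-converges (suc p))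
    ≈
    ζ⋆ (plain (suc p)) (bar 2)
    - ln2 * ζ⋆ (plain (suc p)) (bar 1)
    + ζ⋆ (bar (2 ℕ.+ p)) (bar 1)
    + ι ½ * ζ 2 * ζ (suc p)
    + ∑ℝ[ i ≤ suc p ] (ζ⋆ (bar i) (bar 1) * ζ̄ (suc (suc p ∸ i)))
    + (fromℕ (suc p) + [-1]^ p) * ζ⋆ (plain (2 ℕ.+ p)) (bar 1)
    + ι ½ * (ln2 * ln2) * (fromℕ 2 * ζ (suc p) + ζ̄ (suc p))
    + ln2 * [-1]^ (p ∸ 1) * (ζ⋆ (plain (suc p)) (plain 1) - ζ⋆ (bar (suc p)) (plain 1))
    - ∑ℝ[ i ≤ p ∸ 1 ] ([-1]^ (i ∸ 1) * ζ̄ (suc (p ∸ i)) * ζ⋆ (bar (suc i)) (plain 1))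
    - ln2 * (ζ⋆ (plain (suc p)) (plain 1) - ζ⋆ (plain (suc p)) (bar 1))
    - ∑ℝ[ i ≤ p ∸ 1 ] ([-1]^ (i ∸ 1) * ζ̄ (suc (p ∸ i)) * ζ̄ (2 ℕ.+ i))
    - ln2 * [-1]^ (p ∸ 1) * (ζ (2 ℕ.+ p) + ζ̄ (2 ℕ.+ p))
-- With p = q + 1 the exponent p ∸ 1 computes to q. The index i bound in each `⇝-sum` is one less
-- than the i of the statement.
theorem3p3 (suc q) = ⇝-≈
  (∑L²⇝ s ⇝+ (σ⇝ q ⇝- num⇝ 1) ⇝* ∑HL⇝ s)
  (ζ⋆[s,2̄]⇝ s
    ⇝- ln2⇝ ⇝* ζ⋆[s,1̄]⇝ s
    ⇝+ ζ⋆[s̄,1̄]⇝ (suc s)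
    ⇝+ ½⇝ ⇝* ζ⇝ 2 ⇝* ζ⇝ s
    ⇝+ ⇝-sum s (λ i → ζ⋆[s̄,1̄]⇝ (suc i) ⇝* ζ̄⇝ (suc (p ∸ i)))
    ⇝+ (num⇝ s ⇝+ σ⇝ p) ⇝* ζ⋆[s,1̄]⇝ (suc s)
    ⇝+ ½⇝ ⇝* (ln2⇝ ⇝* ln2⇝) ⇝* (num⇝ 2 ⇝* ζ⇝ s ⇝+ ζ̄⇝ s)
    ⇝+ ln2⇝ ⇝* σ⇝ q ⇝* (ζ⋆[s,1]⇝ s ⇝- ζ⋆[s̄,1]⇝ s)
    ⇝- ⇝-sum q (λ i → σ⇝ i ⇝* ζ̄⇝ (suc (q ∸ i)) ⇝* ζ⋆[s̄,1]⇝ (2 ℕ.+ i))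
    ⇝- ln2⇝ ⇝* (ζ⋆[s,1]⇝ s ⇝- ζ⋆[s,1̄]⇝ s)
    ⇝- ⇝-sum q (λ i → σ⇝ i ⇝* ζ̄⇝ (suc (q ∸ i)) ⇝* ζ̄⇝ (3 ℕ.+ i))
    ⇝- ln2⇝ ⇝* σ⇝ q ⇝* (ζ⇝ (suc s) ⇝+ ζ̄⇝ (suc s)))
  (null-cong {error q} (λ N → sym (truncated-identity q N)) (null-error q))
  where
  p s : ℕ
  p = suc q
  s = suc p
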